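{- For all positive integers $k$ and $n$, $$\Phi_k(n)\le\left(\frac{e\,\pi^2\,\lfloor (k+1)/2\rfloor\,k!}{2^{k+2}}\right)^{1/k} n^{1/k}+\frac{e-1}{e}\,k.$$
   Context: A finite set $\mathcal A$ of non-negative integers is a $B_k$-sequence if all sums $a_1+\dots+a_k$ of $k$ elements of $\mathcal A$ (repetitions allowed) are different, i.e. distinct multisets $\{a_1,\dots,a_k\}$ of elements of $\mathcal A$ have distinct sums. $\Phi_k(n)$ is the maximum size of a $B_k$-sequence contained in $[0,n]$. -}

module Defs where

open import Data.Nat.Base as ℕ using (ℕ; zero; suc; _!)
import Data.Nat.Properties as ℕ
open import Data.Integer.Base as ℤ using (+_)
import Data.Integer.Properties as ℤ
open import Data.Rational
  using (ℚ; 0ℚ; 1ℚ; ½; _+_; _*_; _-_; -_; _⊔_; ∣_∣; _≤_; _<_; _/_; 1/_; ↥_; toℚᵘ; Positive; positive; nonNegative)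
open import Data.Rational.Properties as ℚ hiding (_≟_)
import Data.Rational.Unnormalised as ℚᵘ
import Data.Rational.Unnormalised.Properties as ℚᵘ
open import Data.Rational.Solver using (module +-*-Solver)
open import Algebra.Bundles.Raw using (RawRing)
open import Algebra.Definitions.RawSemiring +-*-rawSemiring using (_^_)
import Algebra.Definitions.RawSemiring as RawSemiringDefs
open import Data.Fin.Base using (Fin; toℕ)
import Data.Fin.Properties as Fin
open import Data.Fin.Subset as Subset using (Subset; _∈_)
import Data.Fin.Subset.Properties as Subset
open import Data.List.Base as List using (List)
open import Data.List.Relation.Binary.Permutation.Propositional as ↭ using (_↭_; ↭-sym)
import Data.List.Relation.Binary.Permutation.Propositional.Properties as ↭
import Data.List.Membership.Propositional as List
import Data.List.Membership.Propositional.Properties as List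
import Data.List.Membership.DecPropositional as DecMembership
open import Data.List.Relation.Unary.Any using (here)
open import Data.Vec.Base as Vec using (Vec; []; _∷_; toList)
open import Data.Vec.Relation.Unary.All as All using (All)
open import Data.Product.Base using (∃-syntax; _×_; _,_; proj₁; proj₂)
open import Data.Sum.Base using (_⊎_; inj₁; inj₂; [_,_]′)
open import Data.Empty using (⊥-elim)
open import Level using (0ℓ)
open import Function.Base using (_∘_)
open import Relation.Unary using (Pred; Decidable)
open import Relation.Nullary using (¬_; Dec; yes; no; contradiction)
open import Relation.Nullary.Decidable using (map′; _→-dec_; _×-dec_)
open import Relation.Binary.Definitions using (DecidableEquality)
open import Relation.Binary.PropositionalEquality
  using (_≡_; refl; sym; trans; cong; cong₂; subst; subst₂)

-- The greatest j ≤ b satisfying P, and 0 if there is none.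
largest : ∀ {p} {P : Pred ℕ p} → Decidable P → ℕ → ℕ
largest P? zero = zero
largest P? (suc b) with P? (suc b)
... | yes _ = suc b
... | no  _ = largest P? b

module _ {p} {P : Pred ℕ p} (P? : Decidable P) where

  largest-sat : ∀ b → largest P? b ≡ 0 ⊎ P (largest P? b)
  largest-sat zero = inj₁ refl
  largest-sat (suc b) with P? (suc b)
  ... | yes q = inj₂ q
  ... | no  _ = largest-sat b

  largest-max : ∀ b {j} → j ℕ.≤ b → P j → j ℕ.≤ largest P? b
  largest-max zero    j≤b Pj = j≤b
  largest-max (suc b) j≤b Pj with P? (suc b)
  ... | yes _ = j≤b
  ... | no ¬q with ℕ.m≤n⇒m<n∨m≡n j≤b
  ...   | inj₁ j<1+b = largest-max b (ℕ.≤-pred j<1+b) Pj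
  ...   | inj₂ refl  = contradiction Pj ¬q

------------------------------------------------------------------------
-- B_k-sequences

-- A : Subset m is a subset of {0, …, m - 1}.  A multiset of k elements is
-- represented by a vector of length k, and multiset equality is _↭_.
IsB : ∀ {m} → ℕ → Subset m → Set
IsB {m} k A = ∀ (xs ys : Vec (Fin m) k) → All (_∈ A) xs → All (_∈ A) ys →
  Vec.sum (Vec.map toℕ xs) ≡ Vec.sum (Vec.map toℕ ys) → toList xs ↭ toList ys

allVec? : ∀ {m k p} {P : Pred (Vec (Fin m) k) p} → Decidable P → Dec (∀ v → P v)
allVec? {k = zero}  P? = map′ (λ { p [] → p }) (λ f → f []) (P? [])
allVec? {k = suc k} P? =
  map′ (λ { f (x ∷ v) → f x v }) (λ f x v → f (x ∷ v))
       (Fin.all? λ x → allVec? λ v → P? (x ∷ v))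

module _ {a} {A : Set a} (_≟_ : DecidableEquality A) where
  open DecMembership _≟_ using (_∈?_)

  ↭-dec : (xs ys : List A) → Dec (xs ↭ ys)
  ↭-dec List.[] List.[]      = yes ↭.refl
  ↭-dec List.[] (y List.∷ ys) = no λ p → contradiction (↭.↭-length p) λ ()
  ↭-dec (x List.∷ xs) ys with x ∈? ys
  ... | no x∉ys  = no λ p → x∉ys (↭.∈-resp-↭ p (here refl))
  ... | yes x∈ys with List.∈-∃++ x∈ys
  ...   | us , vs , refl =
    map′ (λ p → ↭.trans (↭.prep x p) (↭-sym (↭.shift x us vs)))
         (λ p → ↭.drop-∷ (↭.trans p (↭.shift x us vs)))
         (↭-dec xs (us List.++ vs))

IsB? : ∀ {m} k → Decidable (IsB {m} k)
IsB? k A = allVec? λ xs → allVec? λ ys →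
  All.all? (Subset._∈? A) xs →-dec (All.all? (Subset._∈? A) ys →-dec
  ((_ ℕ.≟ _) →-dec ↭-dec Fin._≟_ (toList xs) (toList ys)))

HasBOfSize : ℕ → ℕ → ℕ → Set
HasBOfSize k n s = ∃[ A ] IsB {suc n} k A × Subset.∣ A ∣ ≡ s

hasBOfSize? : ∀ k n → Decidable (HasBOfSize k n)
hasBOfSize? k n s = Subset.anySubset? λ A → IsB? k A ×-dec (Subset.∣ A ∣ ℕ.≟ s)

Φ : ℕ → ℕ → ℕ
Φ k n = largest (hasBOfSize? k n) (suc n)

Φ-attained : ∀ k n → HasBOfSize k n (Φ k n)
Φ-attained k n = [ (λ eq → Subset.⊥ , ⊥-isB k , trans (Subset.∣⊥∣≡0 (suc n)) (sym eq)) , (λ p → p) ]′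
  (largest-sat (hasBOfSize? k n) (suc n))
  where
  ⊥-isB : ∀ k → IsB {suc n} k Subset.⊥
  ⊥-isB zero    []       []       _ _ _ = ↭.refl
  ⊥-isB (suc k) (x ∷ xs) (y ∷ ys) (x∈ All.∷ _) _ _ = ⊥-elim (Subset.∉⊥ x∈)

Φ-maximal : ∀ k n (A : Subset (suc n)) → IsB k A → Subset.∣ A ∣ ℕ.≤ Φ k n
Φ-maximal k n A A-isB = largest-max (hasBOfSize? k n) (suc n) (Subset.∣p∣≤n A) (A , A-isB , refl)

------------------------------------------------------------------------
-- Rational arithmetic

open ℚ.≤-Reasoning

module RationalLemmas where

  *-mono-≤ : ∀ {a A b B} → 0ℚ ≤ a → 0ℚ ≤ B → a ≤ A → b ≤ B → a * b ≤ A * B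
  *-mono-≤ {a} {A} {b} {B} 0≤a 0≤B a≤A b≤B = begin
    a * b ≤⟨ *-monoˡ-≤-nonNeg a {{nonNegative 0≤a}} b≤B ⟩
    a * B ≤⟨ *-monoʳ-≤-nonNeg B {{nonNegative 0≤B}} a≤A ⟩
    A * B ∎

  0≤* : ∀ {a b} → 0ℚ ≤ a → 0ℚ ≤ b → 0ℚ ≤ a * b
  0≤* {a} {b} 0≤a 0≤b = begin
    0ℚ     ≡⟨ *-zeroˡ b ⟨
    0ℚ * b ≤⟨ *-monoʳ-≤-nonNeg b {{nonNegative 0≤b}} 0≤a ⟩
    a * b  ∎

  0<* : ∀ {a b} → 0ℚ < a → 0ℚ < b → 0ℚ < a * b
  0<* {a} {b} 0<a 0<b = begin-strict
    0ℚ     ≡⟨ *-zeroˡ b ⟨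
    0ℚ * b <⟨ *-monoˡ-<-pos b {{positive 0<b}} 0<a ⟩
    a * b  ∎

  p≤p+q : ∀ {p q} → 0ℚ ≤ q → p ≤ p + q
  p≤p+q {p} {q} 0≤q = begin
    p      ≡⟨ +-identityʳ p ⟨
    p + 0ℚ ≤⟨ +-monoʳ-≤ p 0≤q ⟩
    p + q  ∎

  p<p+q : ∀ {p q} → 0ℚ < q → p < p + q
  p<p+q {p} {q} 0<q = begin-strict
    p      ≡⟨ +-identityʳ p ⟨
    p + 0ℚ <⟨ +-monoʳ-< p 0<q ⟩
    p + q  ∎

  0<½* : ∀ {ε} → 0ℚ < ε → 0ℚ < ½ * ε
  0<½* = 0<* (positive⁻¹ ½)

  ½+½ : ∀ ε → ½ * ε + ½ * ε ≡ ε
  ½+½ ε = trans (sym (*-distribʳ-+ ε ½ ½)) (*-identityˡ ε)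

  p≤∣p∣ : ∀ p → p ≤ ∣ p ∣
  p≤∣p∣ p with ≤-total 0ℚ p
  ... | inj₁ 0≤p = ≤-reflexive (sym (0≤p⇒∣p∣≡p 0≤p))
  ... | inj₂ p≤0 = ≤-trans p≤0 (0≤∣p∣ p)

  ∣p∣≤ : ∀ {p r} → p ≤ r → - p ≤ r → ∣ p ∣ ≤ r
  ∣p∣≤ {p} {r} p≤r -p≤r with ∣p∣≡p∨∣p∣≡-p p
  ... | inj₁ eq = subst (_≤ r) (sym eq) p≤r
  ... | inj₂ eq = subst (_≤ r) (sym eq) -p≤r

  p-q+q : ∀ p q → (p - q) + q ≡ p
  p-q+q = solve 2 (λ p q → (p :- q) :+ q := p) refl
    where open +-*-Solver

  ∣p-q∣≡∣q-p∣ : ∀ p q → ∣ p - q ∣ ≡ ∣ q - p ∣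
  ∣p-q∣≡∣q-p∣ p q = trans (cong ∣_∣ (neg-swap p q)) (∣-p∣≡∣p∣ (q - p))
    where
    open +-*-Solver
    neg-swap : ∀ p q → p - q ≡ - (q - p)
    neg-swap = solve 2 (λ p q → p :- q := :- (q :- p)) refl

  close⇒≤ : ∀ {p q ε} → ∣ p - q ∣ ≤ ε → p ≤ q + ε
  close⇒≤ {p} {q} {ε} h = begin
    p             ≡⟨ p-q+q p q ⟨
    (p - q) + q   ≤⟨ +-monoˡ-≤ q (p≤∣p∣ (p - q)) ⟩
    ∣ p - q ∣ + q ≤⟨ +-monoˡ-≤ q h ⟩
    ε + q         ≡⟨ +-comm ε q ⟩
    q + ε         ∎

  ≤⇒-≤ : ∀ {p q ε} → p ≤ q + ε → p - q ≤ ε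
  ≤⇒-≤ {p} {q} {ε} h = begin
    p - q       ≤⟨ +-monoˡ-≤ (- q) h ⟩
    (q + ε) - q ≡⟨ solve 2 (λ q ε → (q :+ ε) :- q := ε) refl q ε ⟩
    ε           ∎
    where open +-*-Solver

  ≤⇒close : ∀ {p q ε} → p ≤ q + ε → q ≤ p + ε → ∣ p - q ∣ ≤ ε
  ≤⇒close {p} {q} {ε} h₁ h₂ = ∣p∣≤ (≤⇒-≤ h₁) (subst (_≤ ε) (neg p q) (≤⇒-≤ h₂))
    where
    open +-*-Solver
    neg : ∀ p q → q - p ≡ - (p - q)
    neg = solve 2 (λ p q → q :- p := :- (p :- q)) refl

  0≤^ : ∀ {p} → 0ℚ ≤ p → ∀ k → 0ℚ ≤ p ^ k
  0≤^ 0≤p zero    = nonNegative⁻¹ 1ℚ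
  0≤^ 0≤p (suc k) = 0≤* 0≤p (0≤^ 0≤p k)

  0<^ : ∀ {p} → 0ℚ < p → ∀ k → 0ℚ < p ^ k
  0<^ 0<p zero    = positive⁻¹ 1ℚ
  0<^ 0<p (suc k) = 0<* 0<p (0<^ 0<p k)

  ^-mono : ∀ {p q} → 0ℚ ≤ p → p ≤ q → ∀ k → p ^ k ≤ q ^ k
  ^-mono 0≤p p≤q zero    = ≤-refl
  ^-mono 0≤p p≤q (suc k) =
    *-mono-≤ 0≤p (0≤^ (≤-trans 0≤p p≤q) k) p≤q (^-mono 0≤p p≤q k)

  ^-superadditive : ∀ {p q} → 0ℚ ≤ p → 0ℚ ≤ q → ∀ k →
    p ^ suc k + q ^ suc k ≤ (p + q) ^ suc k
  ^-superadditive {p} {q} 0≤p 0≤q k = begin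
    p * p ^ k + q * q ^ k
      ≤⟨ +-mono-≤ (*-mono-≤ 0≤p (0≤^ 0≤p+q k) ≤-refl (^-mono 0≤p (p≤p+q 0≤q) k))
                  (*-mono-≤ 0≤q (0≤^ 0≤p+q k) ≤-refl (^-mono 0≤q q≤p+q k)) ⟩
    p * (p + q) ^ k + q * (p + q) ^ k
      ≡⟨ *-distribʳ-+ ((p + q) ^ k) p q ⟨
    (p + q) * (p + q) ^ k ∎
    where
    q≤p+q : q ≤ p + q
    q≤p+q = subst (q ≤_) (+-comm q p) (p≤p+q 0≤p)
    0≤p+q : 0ℚ ≤ p + q
    0≤p+q = ≤-trans 0≤p (p≤p+q 0≤q)

  p≤p^ : ∀ {p} → 1ℚ ≤ p → ∀ k → p ≤ p ^ suc k
  p≤p^ {p} 1≤p k = begin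
    p          ≡⟨ *-identityʳ p ⟨
    p * 1ℚ     ≤⟨ *-monoˡ-≤-nonNeg p {{nonNegative (≤-trans (nonNegative⁻¹ 1ℚ) 1≤p)}} (1≤^ k) ⟩
    p * p ^ k  ∎
    where
    1≤^ : ∀ k → 1ℚ ≤ p ^ k
    1≤^ zero    = ≤-refl
    1≤^ (suc k) = *-mono-≤ (nonNegative⁻¹ 1ℚ) (0≤^ (≤-trans (nonNegative⁻¹ 1ℚ) 1≤p) k) 1≤p (1≤^ k)

  toℚᵘ-/ : ∀ i d → toℚᵘ (i / suc d) ℚᵘ.≃ ℚᵘ.mkℚᵘ i d
  toℚᵘ-/ i d = toℚᵘ-fromℚᵘ (ℚᵘ.mkℚᵘ i d)

  /-mono : ∀ a b c d .{{_ : ℕ.NonZero b}} .{{_ : ℕ.NonZero d}} →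
    a ℕ.* d ℕ.≤ c ℕ.* b → + a / b ≤ + c / d
  /-mono a (suc b) c (suc d) h = toℚᵘ-cancel-≤
    (ℚᵘ.≤-respˡ-≃ (ℚᵘ.≃-sym (toℚᵘ-/ (+ a) b))
    (ℚᵘ.≤-respʳ-≃ (ℚᵘ.≃-sym (toℚᵘ-/ (+ c) d))
    (ℚᵘ.*≤* (subst₂ ℤ._≤_ (ℤ.pos-* a (suc d)) (ℤ.pos-* c (suc b)) (ℤ.+≤+ h)))))

  0≤/ : ∀ a b .{{_ : ℕ.NonZero b}} → 0ℚ ≤ + a / b
  0≤/ a b = /-mono 0 1 a b ℕ.z≤n

  /-+ : ∀ a b d .{{_ : ℕ.NonZero d}} → + a / d + + b / d ≡ + (a ℕ.+ b) / d
  /-+ a b (suc d) = toℚᵘ-injective (ℚᵘ.≃-trans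
    (toℚᵘ-homo-+ (+ a / suc d) (+ b / suc d)) (ℚᵘ.≃-trans
    (ℚᵘ.+-cong (toℚᵘ-/ (+ a) d) (toℚᵘ-/ (+ b) d)) (ℚᵘ.≃-trans
    (ℚᵘ.*≡* eq) (ℚᵘ.≃-sym (toℚᵘ-/ (+ (a ℕ.+ b)) d)))))
    where
    D = + suc d
    eq : (+ a ℤ.* D ℤ.+ + b ℤ.* D) ℤ.* D ≡ + (a ℕ.+ b) ℤ.* + (suc d ℕ.* suc d)
    eq = trans (cong (ℤ._* D) (sym (ℤ.*-distribʳ-+ D (+ a) (+ b))))
        (trans (ℤ.*-assoc (+ (a ℕ.+ b)) D D)
               (cong (+ (a ℕ.+ b) ℤ.*_) (sym (ℤ.pos-* (suc d) (suc d)))))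

  archimedean : ∀ {ε} → 0ℚ < ε → ∃[ N ] ∀ n → N ℕ.≤ n → + 1 / suc n ≤ ε
  archimedean {ε@(Data.Rational.mkℚ (+ suc a) d _)} _ = d , λ n d≤n →
    subst (+ 1 / suc n ≤_) (↥p/↧p≡p ε)
      (/-mono 1 (suc n) (suc a) (suc d)
        (ℕ.*-mono-≤ (ℕ.s≤s (ℕ.z≤n {a})) (ℕ.s≤s d≤n)))
  archimedean {ε@(Data.Rational.mkℚ (+ 0) d _)} 0<ε =
    ⊥-elim (ℤ.<-irrefl refl (subst₂ ℤ._<_ refl refl (drop-*<* 0<ε)))
  archimedean {ε@(Data.Rational.mkℚ ℤ.-[1+ a ] d _)} (Data.Rational.*<* ())

  p≤∣↥p∣ : ∀ p → p ≤ + ℤ.∣ ↥ p ∣ / 1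
  p≤∣↥p∣ p@(Data.Rational.mkℚ (+ a) d _) = subst (_≤ + a / 1) (↥p/↧p≡p p)
    (/-mono a (suc d) a 1 (ℕ.*-monoʳ-≤ a (ℕ.s≤s (ℕ.z≤n {d}))))
  p≤∣↥p∣ p@(Data.Rational.mkℚ ℤ.-[1+ a ] d _) =
    ≤-trans (nonPositive⁻¹ p) (0≤/ (suc a) 1)

open RationalLemmas

------------------------------------------------------------------------
-- Cauchy reals

IsCauchy : (ℕ → ℚ) → Set
IsCauchy x = ∀ ε → 0ℚ < ε →
  ∃[ N ] ∀ m n → N ℕ.≤ m → N ℕ.≤ n → ∣ x m - x n ∣ ≤ ε

record ℝ : Set where
  constructor mkℝ
  field
    seq    : ℕ → ℚ
    cauchy : IsCauchy seq

open ℝ public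

infix  4 _≤ᴿ_
infixl 6 _+ᴿ_ _-ᴿ_
infixl 7 _*ᴿ_ _/ᴿ_ _/ℕ_
infix  8 -ᴿ_

_≤ᴿ_ : ℝ → ℝ → Set
x ≤ᴿ y = ∀ ε → 0ℚ < ε → ∃[ N ] ∀ n → N ℕ.≤ n → seq x n ≤ seq y n + ε

_≈ᴿ_ : ℝ → ℝ → Set
x ≈ᴿ y = x ≤ᴿ y × y ≤ᴿ x

fromℚ : ℚ → ℝ
fromℚ q = mkℝ (λ _ → q) λ ε 0<ε → 0 , λ _ _ _ _ →
  subst (λ p → ∣ p ∣ ≤ ε) (sym (+-inverseʳ q)) (<⇒≤ 0<ε)

fromℕ : ℕ → ℝ
fromℕ n = fromℚ (+ n / 1)

module CauchyLemmas where
  module _ {a b : ℕ} where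
    ⊔≤ˡ : ∀ {m} → a ℕ.⊔ b ℕ.≤ m → a ℕ.≤ m
    ⊔≤ˡ = ℕ.≤-trans (ℕ.m≤m⊔n a b)

    ⊔≤ʳ : ∀ {m} → a ℕ.⊔ b ℕ.≤ m → b ℕ.≤ m
    ⊔≤ʳ = ℕ.≤-trans (ℕ.m≤n⊔m a b)

  +-cauchy : ∀ {x y} → IsCauchy x → IsCauchy y → IsCauchy (λ n → x n + y n)
  +-cauchy {x} {y} cx cy ε 0<ε with cx (½ * ε) (0<½* 0<ε) | cy (½ * ε) (0<½* 0<ε)
  ... | N₁ , h₁ | N₂ , h₂ = N₁ ℕ.⊔ N₂ , λ m n N≤m N≤n → begin
    ∣ (x m + y m) - (x n + y n) ∣   ≡⟨ cong ∣_∣ (rearrange (x m) (y m) (x n) (y n)) ⟩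
    ∣ (x m - x n) + (y m - y n) ∣   ≤⟨ ∣p+q∣≤∣p∣+∣q∣ (x m - x n) (y m - y n) ⟩
    ∣ x m - x n ∣ + ∣ y m - y n ∣   ≤⟨ +-mono-≤ (h₁ m n (⊔≤ˡ N≤m) (⊔≤ˡ N≤n))
                                               (h₂ m n (⊔≤ʳ {N₁} N≤m) (⊔≤ʳ {N₁} N≤n)) ⟩
    ½ * ε + ½ * ε                   ≡⟨ ½+½ ε ⟩
    ε                               ∎
    where
    open +-*-Solver
    rearrange : ∀ a b c d → (a + b) - (c + d) ≡ (a - c) + (b - d)
    rearrange = solve 4 (λ a b c d → (a :+ b) :- (c :+ d) := (a :- c) :+ (b :- d)) refl

  neg-cauchy : ∀ {x} → IsCauchy x → IsCauchy (λ n → - x n)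
  neg-cauchy {x} cx ε 0<ε with cx ε 0<ε
  ... | N , h = N , λ m n N≤m N≤n → begin
    ∣ - x m - - x n ∣ ≡⟨ cong ∣_∣ (neg-distrib-+ (x m) (- x n)) ⟨
    ∣ - (x m - x n) ∣ ≡⟨ ∣-p∣≡∣p∣ (x m - x n) ⟩
    ∣ x m - x n ∣     ≤⟨ h m n N≤m N≤n ⟩
    ε                 ∎

  bounded : ∀ {x} → IsCauchy x → ∃[ B ] 0ℚ < B × ∃[ N ] ∀ n → N ℕ.≤ n → ∣ x n ∣ ≤ B
  bounded {x} cx with cx 1ℚ (positive⁻¹ 1ℚ)
  ... | N , h = 1ℚ + ∣ x N ∣ , ≤-<-trans (0≤∣p∣ (x N)) ∣x∣<B , N , λ n N≤n → begin
    ∣ x n ∣               ≡⟨ cong ∣_∣ (p-q+q (x n) (x N)) ⟨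
    ∣ (x n - x N) + x N ∣ ≤⟨ ∣p+q∣≤∣p∣+∣q∣ (x n - x N) (x N) ⟩
    ∣ x n - x N ∣ + ∣ x N ∣ ≤⟨ +-monoˡ-≤ ∣ x N ∣ (h n N N≤n ℕ.≤-refl) ⟩
    1ℚ + ∣ x N ∣          ∎
    where
    ∣x∣<B : ∣ x N ∣ < 1ℚ + ∣ x N ∣
    ∣x∣<B = subst (∣ x N ∣ <_) (+-comm ∣ x N ∣ 1ℚ) (p<p+q (positive⁻¹ 1ℚ))

  -- ε / B
  scale : ∀ ε {B} → 0ℚ < B → ℚ
  scale ε {B} 0<B = 1/_ B {{pos⇒nonZero B {{positive 0<B}}}} * ε

  0<1/ : ∀ {B} (0<B : 0ℚ < B) → 0ℚ < 1/_ B {{pos⇒nonZero B {{positive 0<B}}}}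
  0<1/ {B} 0<B = positive⁻¹ _ {{1/pos⇒pos B {{positive 0<B}}}}

  0<scale : ∀ {ε B} → 0ℚ < ε → (0<B : 0ℚ < B) → 0ℚ < scale ε 0<B
  0<scale 0<ε 0<B = 0<* (0<1/ 0<B) 0<ε

  *-scale : ∀ ε {B} (0<B : 0ℚ < B) → B * scale ε 0<B ≡ ε
  *-scale ε {B} 0<B = begin-equality
    B * (B⁻¹ * ε) ≡⟨ *-assoc B B⁻¹ ε ⟨
    B * B⁻¹ * ε   ≡⟨ cong (_* ε) (*-inverseʳ B {{pos⇒nonZero B {{positive 0<B}}}}) ⟩
    1ℚ * ε        ≡⟨ *-identityˡ ε ⟩
    ε             ∎
    where B⁻¹ = 1/_ B {{pos⇒nonZero B {{positive 0<B}}}}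

  *-close : ∀ {a b c d X Y δ η} → 0ℚ ≤ δ → 0ℚ ≤ η → ∣ a ∣ ≤ X → ∣ d ∣ ≤ Y →
    ∣ b - d ∣ ≤ δ → ∣ a - c ∣ ≤ η → ∣ a * b - c * d ∣ ≤ X * δ + Y * η
  *-close {a} {b} {c} {d} {X} {Y} {δ} {η} 0≤δ 0≤η a≤X d≤Y b~d a~c = begin
    ∣ a * b - c * d ∣
      ≡⟨ cong ∣_∣ (rearrange a b c d) ⟩
    ∣ a * (b - d) + d * (a - c) ∣
      ≤⟨ ∣p+q∣≤∣p∣+∣q∣ (a * (b - d)) (d * (a - c)) ⟩
    ∣ a * (b - d) ∣ + ∣ d * (a - c) ∣
      ≡⟨ cong₂ _+_ (∣p*q∣≡∣p∣*∣q∣ a (b - d)) (∣p*q∣≡∣p∣*∣q∣ d (a - c)) ⟩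
    ∣ a ∣ * ∣ b - d ∣ + ∣ d ∣ * ∣ a - c ∣
      ≤⟨ +-mono-≤ (*-mono-≤ (0≤∣p∣ a) 0≤δ a≤X b~d) (*-mono-≤ (0≤∣p∣ d) 0≤η d≤Y a~c) ⟩
    X * δ + Y * η ∎
    where
    open +-*-Solver
    rearrange : ∀ a b c d → a * b - c * d ≡ a * (b - d) + d * (a - c)
    rearrange = solve 4 (λ a b c d → a :* b :- c :* d := a :* (b :- d) :+ d :* (a :- c)) refl

  *-cauchy : ∀ {x y} → IsCauchy x → IsCauchy y → IsCauchy (λ n → x n * y n)
  *-cauchy {x} {y} cx cy ε 0<ε =
    combine (bounded {x} cx) (bounded {y} cy)
    where
    combine : (∃[ X ] 0ℚ < X × ∃[ N ] ∀ n → N ℕ.≤ n → ∣ x n ∣ ≤ X) →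
              (∃[ Y ] 0ℚ < Y × ∃[ N ] ∀ n → N ℕ.≤ n → ∣ y n ∣ ≤ Y) →
              ∃[ N ] ∀ m n → N ℕ.≤ m → N ℕ.≤ n → ∣ x m * y m - x n * y n ∣ ≤ ε
    combine (X , 0<X , N₁ , hX) (Y , 0<Y , N₂ , hY) =
      (N₁ ℕ.⊔ N₂) ℕ.⊔ (N₃ ℕ.⊔ N₄) , λ m n N≤m N≤n →
        subst (∣ x m * y m - x n * y n ∣ ≤_) total
          (*-close (<⇒≤ 0<δ) (<⇒≤ 0<η)
            (hX m (⊔≤ˡ (⊔≤ˡ N≤m))) (hY n (⊔≤ʳ {N₁} (⊔≤ˡ N≤n)))
            (proj₂ cy′ m n (⊔≤ʳ {N₃} (⊔≤ʳ {N₁ ℕ.⊔ N₂} N≤m)) (⊔≤ʳ {N₃} (⊔≤ʳ {N₁ ℕ.⊔ N₂} N≤n)))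
            (proj₂ cx′ m n (⊔≤ˡ (⊔≤ʳ {N₁ ℕ.⊔ N₂} N≤m)) (⊔≤ˡ (⊔≤ʳ {N₁ ℕ.⊔ N₂} N≤n))))
      where
      δ = scale (½ * ε) 0<X
      η = scale (½ * ε) 0<Y
      0<δ : 0ℚ < δ
      0<δ = 0<scale (0<½* 0<ε) 0<X
      0<η : 0ℚ < η
      0<η = 0<scale (0<½* 0<ε) 0<Y
      cx′ = cx η 0<η
      cy′ = cy δ 0<δ
      N₃ = proj₁ cx′
      N₄ = proj₁ cy′
      total : X * δ + Y * η ≡ ε
      total = trans (cong₂ _+_ (*-scale (½ * ε) 0<X) (*-scale (½ * ε) 0<Y)) (½+½ ε)

open CauchyLemmas

_+ᴿ_ : ℝ → ℝ → ℝ
x +ᴿ y = mkℝ (λ n → seq x n + seq y n) (+-cauchy {seq x} {seq y} (cauchy x) (cauchy y))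

-ᴿ_ : ℝ → ℝ
-ᴿ x = mkℝ (λ n → - seq x n) (neg-cauchy {seq x} (cauchy x))

_-ᴿ_ : ℝ → ℝ → ℝ
x -ᴿ y = x +ᴿ -ᴿ y

_*ᴿ_ : ℝ → ℝ → ℝ
x *ᴿ y = mkℝ (λ n → seq x n * seq y n) (*-cauchy {seq x} {seq y} (cauchy x) (cauchy y))

ℝ-rawRing : RawRing 0ℓ 0ℓ
ℝ-rawRing = record
  { _≈_ = _≈ᴿ_ ; _+_ = _+ᴿ_ ; _*_ = _*ᴿ_ ; -_ = -ᴿ_ ; 0# = fromℚ 0ℚ ; 1# = fromℚ 1ℚ }

open RawSemiringDefs (RawRing.rawSemiring ℝ-rawRing) public
  using () renaming (_^_ to _^ᴿ_)

record Positiveᴿ (x : ℝ) : Set where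
  constructor mkPositiveᴿ
  field
    bound   : ℚ
    0<bound : 0ℚ < bound
    bounds  : ∃[ N ] ∀ n → N ℕ.≤ n → bound ≤ seq x n

module Reciprocal where
  recip⊔ : ∀ (c : ℚ) → 0ℚ < c → ℚ → ℚ
  recip⊔ c 0<c q =
    1/_ (q ⊔ c) {{pos⇒nonZero (q ⊔ c) {{positive (<-≤-trans 0<c (p≤q⊔p q c))}}}}

  recip⊔-cauchy : ∀ {x} c (0<c : 0ℚ < c) → IsCauchy x → IsCauchy (λ n → recip⊔ c 0<c (x n))
  recip⊔-cauchy {x} c 0<c cx ε 0<ε
    with cx (c * (c * ε)) (0<* 0<c (0<* 0<c 0<ε))
  ... | N , h = N , λ m n N≤m N≤n →
      ≤⇒close (one-sided (x m) (x n) (h m n N≤m N≤n))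
              (one-sided (x n) (x m) (h n m N≤n N≤m))
    where
    one-sided : ∀ p q → ∣ p - q ∣ ≤ c * (c * ε) → recip⊔ c 0<c p ≤ recip⊔ c 0<c q + ε
    one-sided p q p~q =
      *-cancelˡ-≤-pos a {{a>0}} (*-cancelˡ-≤-pos b {{b>0}} (begin
        b * (a * 1/a)         ≡⟨ cong (b *_) (*-inverseʳ a {{_}}) ⟩
        b * 1ℚ                ≡⟨ *-identityʳ b ⟩
        b                     ≤⟨ ⊔-lub (≤-trans (close⇒≤ {q} {p} q~p) (+-monoˡ-≤ (c * (c * ε)) (p≤p⊔q p c)))
                                       (≤-trans (p≤q⊔p p c) (p≤p+q (<⇒≤ (0<* 0<c (0<* 0<c 0<ε))))) ⟩
        a + c * (c * ε)       ≤⟨ +-monoʳ-≤ a (*-mono-≤ (<⇒≤ 0<c)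
                                   (0≤* (<⇒≤ a0) (<⇒≤ 0<ε)) (p≤q⊔p q c)
                                   (*-mono-≤ (<⇒≤ 0<c) (<⇒≤ 0<ε) (p≤q⊔p p c) ≤-refl)) ⟩
        a + b * (a * ε)       ≡⟨ cong (_+ b * (a * ε)) (*-identityʳ a) ⟨
        a * 1ℚ + b * (a * ε)  ≡⟨ cong (λ t → a * t + b * (a * ε)) (*-inverseʳ b {{_}}) ⟨
        a * (b * 1/b) + b * (a * ε) ≡⟨ rearrange a b 1/b ε ⟩
        b * (a * (1/b + ε))   ∎))
      where
      a = p ⊔ c
      b = q ⊔ c
      1/a = recip⊔ c 0<c p
      1/b = recip⊔ c 0<c q
      a0 : 0ℚ < a
      a0 = <-≤-trans 0<c (p≤q⊔p p c)
      a>0 : Positive a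
      a>0 = positive a0
      b>0 : Positive b
      b>0 = positive (<-≤-trans 0<c (p≤q⊔p q c))
      q~p : ∣ q - p ∣ ≤ c * (c * ε)
      q~p = subst (_≤ c * (c * ε)) (∣p-q∣≡∣q-p∣ p q) p~q
      open +-*-Solver
      rearrange : ∀ a b i ε → a * (b * i) + b * (a * ε) ≡ b * (a * (i + ε))
      rearrange = solve 4 (λ a b i ε → a :* (b :* i) :+ b :* (a :* ε) := b :* (a :* (i :+ ε))) refl

open Reciprocal

-- The maximum with the bound does not change the limit; it makes every term
-- of the sequence invertible.
1/ᴿ_ : ∀ x → {{Positiveᴿ x}} → ℝ
1/ᴿ_ x {{mkPositiveᴿ c 0<c _}} =
  mkℝ (λ n → recip⊔ c 0<c (seq x n)) (recip⊔-cauchy {seq x} c 0<c (cauchy x))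

_/ᴿ_ : ∀ x y → {{Positiveᴿ y}} → ℝ
x /ᴿ y = x *ᴿ 1/ᴿ y

_/ℕ_ : ℝ → (d : ℕ) .{{_ : ℕ.NonZero d}} → ℝ
x /ℕ d = x *ᴿ fromℚ (+ 1 / d)

------------------------------------------------------------------------
-- Roots

-- The largest j with (j/(m+1))^k ≤ q, or 0 if q < 0.  The search bound is
-- large enough for k ≥ 1, as ∣ ↥ q ∣ + 1 > q.
rootNumerator : (k : ℕ) → ℚ → ℕ → ℕ
rootNumerator k q m =
  largest (λ j → (+ j / suc m) ^ k ≤? q) (suc m ℕ.* suc ℤ.∣ ↥ q ∣)

rootℚ : (k : ℕ) → ℚ → ℕ → ℚ
rootℚ k q m = + rootNumerator k q m / suc m

module RootLemmas where
  0≤rootℚ : ∀ k q m → 0ℚ ≤ rootℚ k q m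
  0≤rootℚ k q m = 0≤/ (rootNumerator k q m) (suc m)

  rootℚ-lower : ∀ k q m → rootℚ k q m ≡ 0ℚ ⊎ rootℚ k q m ^ k ≤ q
  rootℚ-lower k q m =
    [ (λ eq → inj₁ (trans (cong (λ j → + j / suc m) eq) (0/n≡0 (suc m)))) , inj₂ ]′
    (largest-sat (λ j → (+ j / suc m) ^ k ≤? q) (suc m ℕ.* suc ℤ.∣ ↥ q ∣))

  beyond-bound : ∀ k q m j → suc m ℕ.* suc ℤ.∣ ↥ q ∣ ℕ.≤ j → q < (+ j / suc m) ^ suc k
  beyond-bound k q m j b≤j = begin-strict
    q                      ≤⟨ p≤∣↥p∣ q ⟩
    + a / 1                <⟨ p<p+q (positive⁻¹ 1ℚ) ⟩
    + a / 1 + 1ℚ           ≡⟨ /-+ a 1 1 ⟩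
    + (a ℕ.+ 1) / 1        ≤⟨ big ⟩
    + j / suc m            ≤⟨ p≤p^ (≤-trans 1≤ big) k ⟩
    (+ j / suc m) ^ suc k  ∎
    where
    a = ℤ.∣ ↥ q ∣
    1≤ : 1ℚ ≤ + (a ℕ.+ 1) / 1
    1≤ = /-mono 1 1 (a ℕ.+ 1) 1 (ℕ.*-monoˡ-≤ 1 (ℕ.m≤n+m 1 a))
    big : + (a ℕ.+ 1) / 1 ≤ + j / suc m
    big = /-mono (a ℕ.+ 1) 1 j (suc m)
      (subst₂ ℕ._≤_
        (trans (ℕ.*-comm (suc m) (suc a)) (cong (ℕ._* suc m) (ℕ.+-comm 1 a)))
        (sym (ℕ.*-identityʳ j)) b≤j)

  grid-upper : ∀ k q m l →
    (∀ {j} → j ℕ.≤ suc m ℕ.* suc ℤ.∣ ↥ q ∣ → (+ j / suc m) ^ suc k ≤ q → j ℕ.≤ l) →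
    q < (+ l / suc m + + 1 / suc m) ^ suc k
  grid-upper k q m l l-max = subst (λ r → q < r ^ suc k) (sym grid)
    ([ (λ 1+l≤b → ≰⇒> λ le → ℕ.<-irrefl refl (l-max 1+l≤b le))
     , (λ b<1+l → beyond-bound k q m (suc l) (ℕ.<⇒≤ b<1+l)) ]′
     (ℕ.≤-<-connex (suc l) (suc m ℕ.* suc ℤ.∣ ↥ q ∣)))
    where
    grid : + l / suc m + + 1 / suc m ≡ + suc l / suc m
    grid = trans (/-+ l 1 (suc m)) (cong (λ j → + j / suc m) (ℕ.+-comm l 1))

  rootℚ-upper : ∀ k q m → q < (rootℚ (suc k) q m + + 1 / suc m) ^ suc k
  rootℚ-upper k q m = grid-upper k q m (rootNumerator (suc k) q m)
    (largest-max (λ j → (+ j / suc m) ^ suc k ≤? q) (suc m ℕ.* suc ℤ.∣ ↥ q ∣))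

  root-step : ∀ k a b {x y t ε} → 0ℚ < ε → 0ℚ ≤ b → 0ℚ ≤ t →
    a ≡ 0ℚ ⊎ a ^ suc k ≤ x → y < (b + t) ^ suc k →
    x ≤ y + ½ * (½ * ε) ^ suc k → t ≤ ½ * ε → a ≤ b + ε
  root-step k a b 0<ε 0≤b 0≤t (inj₁ refl) _ _ _ = ≤-trans 0≤b (p≤p+q (<⇒≤ 0<ε))
  root-step k a b {x} {y} {t} {ε} 0<ε 0≤b 0≤t (inj₂ a^K≤x) y<s^K x≤y+½h^K t≤h =
    ≮⇒≥ λ b+ε<a → <-irrefl refl (begin-strict
      y + h ^ K                     <⟨ +-monoˡ-< (h ^ K) y<s^K ⟩
      (b + t) ^ K + h ^ K           ≤⟨ ^-superadditive 0≤s (<⇒≤ 0<h) k ⟩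
      (b + t + h) ^ K               ≤⟨ ^-mono (≤-trans 0≤s (p≤p+q (<⇒≤ 0<h))) (≤-trans s+h≤ (<⇒≤ b+ε<a)) K ⟩
      a ^ K                         ≤⟨ a^K≤x ⟩
      x                             ≤⟨ x≤y+½h^K ⟩
      y + ½ * h ^ K                 ≤⟨ +-monoʳ-≤ y (p≤p+q (<⇒≤ (0<½* (0<^ 0<h K)))) ⟩
      y + (½ * h ^ K + ½ * h ^ K)   ≡⟨ cong (λ p → y + p) (½+½ (h ^ K)) ⟩
      y + h ^ K                     ∎)
    where
    K = suc k
    h = ½ * ε
    0<h : 0ℚ < h
    0<h = 0<½* 0<ε
    0≤s : 0ℚ ≤ b + t
    0≤s = ≤-trans 0≤b (p≤p+q 0≤t)
    s+h≤ : b + t + h ≤ b + ε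
    s+h≤ = begin
      b + t + h   ≤⟨ +-monoˡ-≤ h (+-monoʳ-≤ b t≤h) ⟩
      b + h + h   ≡⟨ +-assoc b h h ⟩
      b + (h + h) ≡⟨ cong (λ p → b + p) (½+½ ε) ⟩
      b + ε       ∎

  root-cauchy : ∀ {x} k → IsCauchy x → IsCauchy (λ n → rootℚ (suc k) (x n) n)
  root-cauchy {x} k cx ε 0<ε =
    proj₁ cx′ ℕ.⊔ proj₁ arch , λ m n N≤m N≤n →
      ≤⇒close {rootℚ K (x m) m} {rootℚ K (x n) n}
        (one-sided m n (⊔≤ˡ N≤m) (⊔≤ˡ N≤n) (⊔≤ʳ {proj₁ cx′} N≤n))
        (one-sided n m (⊔≤ˡ N≤n) (⊔≤ˡ N≤m) (⊔≤ʳ {proj₁ cx′} N≤m))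
    where
    K = suc k
    cx′ = cx (½ * (½ * ε) ^ K) (0<½* (0<^ (0<½* 0<ε) K))
    arch = archimedean (0<½* 0<ε)

    one-sided : ∀ m n → proj₁ cx′ ℕ.≤ m → proj₁ cx′ ℕ.≤ n → proj₁ arch ℕ.≤ n →
      rootℚ K (x m) m ≤ rootℚ K (x n) n + ε
    one-sided m n N≤m N≤n N′≤n =
      root-step k (rootℚ K (x m) m) (rootℚ K (x n) n) 0<ε
        (0≤rootℚ K (x n) n) (0≤/ 1 (suc n))
        (rootℚ-lower K (x m) m) (rootℚ-upper k (x n) n)
        (close⇒≤ {x m} {x n} (proj₂ cx′ m n N≤m N≤n)) (proj₂ arch n N′≤n)

open RootLemmas

-- The k-th root of a non-negative real (0 for a negative real).
root : (k : ℕ) .{{_ : ℕ.NonZero k}} → ℝ → ℝ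
root (suc k) x = mkℝ (λ n → rootℚ (suc k) (seq x n) n) (root-cauchy {seq x} k (cauchy x))

------------------------------------------------------------------------
-- The constants e and π

-- f 0 + f 1 + ⋯ + f (n - 1)
sum : (ℕ → ℚ) → ℕ → ℚ
sum f zero    = 0ℚ
sum f (suc n) = f 0 + sum (f ∘ suc) n

-- f 0 - f 1 + f 2 - ⋯ ± f (n - 1)
altSum : (ℕ → ℚ) → ℕ → ℚ
altSum f zero    = 0ℚ
altSum f (suc n) = f 0 - altSum (f ∘ suc) n

module SeriesLemmas where
  cauchy-from-tail : ∀ x → (∀ n d → ∣ x (n ℕ.+ d) - x n ∣ ≤ + 1 / suc n + + 1 / suc n) → IsCauchy x
  cauchy-from-tail x tail ε 0<ε with archimedean (0<½* (0<½* 0<ε))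
  ... | N , hN = N , λ m n N≤m N≤n → begin
    ∣ x m - x n ∣                   ≡⟨ cong ∣_∣ (rearrange (x m) (x n) (x N)) ⟩
    ∣ (x m - x N) - (x n - x N) ∣   ≤⟨ ∣p-q∣≤∣p∣+∣q∣ (x m - x N) (x n - x N) ⟩
    ∣ x m - x N ∣ + ∣ x n - x N ∣   ≤⟨ +-mono-≤ (bnd m N≤m) (bnd n N≤n) ⟩
    ½ * ε + ½ * ε                   ≡⟨ ½+½ ε ⟩
    ε                               ∎
    where
    open +-*-Solver
    rearrange : ∀ a b c → a - b ≡ (a - c) - (b - c)
    rearrange = solve 3 (λ a b c → a :- b := (a :- c) :- (b :- c)) refl
    bnd : ∀ m → N ℕ.≤ m → ∣ x m - x N ∣ ≤ ½ * ε
    bnd m N≤m = begin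
      ∣ x m - x N ∣                       ≡⟨ cong (λ i → ∣ x i - x N ∣) (ℕ.m+[n∸m]≡n N≤m) ⟨
      ∣ x (N ℕ.+ (m ℕ.∸ N)) - x N ∣       ≤⟨ tail N (m ℕ.∸ N) ⟩
      + 1 / suc N + + 1 / suc N           ≤⟨ +-mono-≤ (hN N ℕ.≤-refl) (hN N ℕ.≤-refl) ⟩
      ½ * (½ * ε) + ½ * (½ * ε)           ≡⟨ ½+½ (½ * ε) ⟩
      ½ * ε                               ∎

  sum-nonneg : ∀ f → (∀ i → 0ℚ ≤ f i) → ∀ d → 0ℚ ≤ sum f d
  sum-nonneg f 0≤f zero    = ≤-refl
  sum-nonneg f 0≤f (suc d) = ≤-trans (0≤f 0) (p≤p+q (sum-nonneg (f ∘ suc) (0≤f ∘ suc) d))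

  sum-bound : ∀ (f c : ℕ → ℚ) → (∀ i → 0ℚ ≤ c i) → (∀ i → f i + c (suc i) ≤ c i) →
    ∀ d → sum f d ≤ c 0
  sum-bound f c 0≤c step zero    = 0≤c 0
  sum-bound f c 0≤c step (suc d) = ≤-trans
    (+-monoʳ-≤ (f 0) (sum-bound (f ∘ suc) (c ∘ suc) (0≤c ∘ suc) (step ∘ suc) d)) (step 0)

  cancelˡ : ∀ a b c → (a + b) - (a + c) ≡ b - c
  cancelˡ = solve 3 (λ a b c → (a :+ b) :- (a :+ c) := b :- c) refl
    where open +-*-Solver

  sum-tail : ∀ (f c : ℕ → ℚ) → (∀ i → 0ℚ ≤ f i) → (∀ i → 0ℚ ≤ c i) →
    (∀ i → f i + c (suc i) ≤ c i) → ∀ n d → ∣ sum f (n ℕ.+ d) - sum f n ∣ ≤ c n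
  sum-tail f c 0≤f 0≤c step zero d =
    subst (λ s → ∣ s ∣ ≤ c 0) (sym (+-identityʳ (sum f d)))
      (subst (_≤ c 0) (sym (0≤p⇒∣p∣≡p (sum-nonneg f 0≤f d))) (sum-bound f c 0≤c step d))
  sum-tail f c 0≤f 0≤c step (suc n) d = begin
    ∣ sum f (suc n ℕ.+ d) - sum f (suc n) ∣
      ≡⟨ cong ∣_∣ (cancelˡ (f 0) (sum (f ∘ suc) (n ℕ.+ d)) (sum (f ∘ suc) n)) ⟩
    ∣ sum (f ∘ suc) (n ℕ.+ d) - sum (f ∘ suc) n ∣
      ≤⟨ sum-tail (f ∘ suc) (c ∘ suc) (0≤f ∘ suc) (0≤c ∘ suc) (step ∘ suc) n d ⟩
    c (suc n) ∎

  altSum-bounds : ∀ f → (∀ i → f (suc i) ≤ f i) → (∀ i → 0ℚ ≤ f i) →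
    ∀ d → 0ℚ ≤ altSum f d × altSum f d ≤ f 0
  altSum-bounds f dec 0≤f zero = ≤-refl , 0≤f 0
  altSum-bounds f dec 0≤f (suc d) with altSum-bounds (f ∘ suc) (dec ∘ suc) (0≤f ∘ suc) d
  ... | lo , hi = lower , upper
    where
    t = altSum (f ∘ suc) d
    lower : 0ℚ ≤ f 0 - t
    lower = begin
      0ℚ      ≡⟨ +-inverseʳ t ⟨
      t - t   ≤⟨ +-monoˡ-≤ (- t) (≤-trans hi (dec 0)) ⟩
      f 0 - t ∎
    upper : f 0 - t ≤ f 0
    upper = ≤⇒-≤ (subst (f 0 ≤_) (+-comm (f 0) t) (p≤p+q lo))

  altSum-tail : ∀ f → (∀ i → f (suc i) ≤ f i) → (∀ i → 0ℚ ≤ f i) →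
    ∀ n d → ∣ altSum f (n ℕ.+ d) - altSum f n ∣ ≤ f n
  altSum-tail f dec 0≤f zero d with altSum-bounds f dec 0≤f d
  ... | lo , hi = subst (λ s → ∣ s ∣ ≤ f 0) (sym (+-identityʳ (altSum f d)))
                    (subst (_≤ f 0) (sym (0≤p⇒∣p∣≡p lo)) hi)
  altSum-tail f dec 0≤f (suc n) d = begin
    ∣ (f 0 - s) - (f 0 - t) ∣ ≡⟨ cong ∣_∣ (cancelˡ (f 0) (- s) (- t)) ⟩
    ∣ - s - - t ∣             ≡⟨ cong ∣_∣ (neg-distrib-+ s (- t)) ⟨
    ∣ - (s - t) ∣             ≡⟨ ∣-p∣≡∣p∣ (s - t) ⟩
    ∣ s - t ∣                 ≤⟨ altSum-tail (f ∘ suc) (dec ∘ suc) (0≤f ∘ suc) n d ⟩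
    f (suc n)                 ∎
    where
    s = altSum (f ∘ suc) (n ℕ.+ d)
    t = altSum (f ∘ suc) n

open SeriesLemmas

1/_! : ℕ → ℚ
1/ i ! = _/_ (+ 1) (i !) {{ℕ._!≢0 i}}

module ExpSeries where
  0≤1/! : ∀ i → 0ℚ ≤ 1/ i !
  0≤1/! i = 0≤/ 1 (i !) {{ℕ._!≢0 i}}

  e-tail : ∀ n d → ∣ sum 1/_! (suc (n ℕ.+ d)) - sum 1/_! (suc n) ∣ ≤ + 1 / suc n + + 1 / suc n
  e-tail n d = begin
    ∣ sum 1/_! (suc (n ℕ.+ d)) - sum 1/_! (suc n) ∣
      ≡⟨ cong ∣_∣ (cancelˡ 1ℚ (sum f (n ℕ.+ d)) (sum f n)) ⟩
    ∣ sum f (n ℕ.+ d) - sum f n ∣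
      ≤⟨ sum-tail f c (0≤1/! ∘ suc) (λ i → ≤-trans (0≤1/! (suc i)) (p≤p+q (0≤1/! (suc i)))) step n d ⟩
    c n
      ≤⟨ +-mono-≤ (≤1/ n) (≤1/ n) ⟩
    + 1 / suc n + + 1 / suc n ∎
    where
    f c : ℕ → ℚ
    f i = 1/ suc i !
    c i = f i + f i

    step : ∀ i → f i + c (suc i) ≤ c i
    step i = +-monoʳ-≤ (f i) (begin
      f (suc i) + f (suc i) ≡⟨ /-+ 1 1 (suc (suc i) !) {{ℕ._!≢0 (suc (suc i))}} ⟩
      _/_ (+ 2) (suc (suc i) !) {{ℕ._!≢0 (suc (suc i))}}
        ≤⟨ /-mono 2 (suc (suc i) !) 1 (suc i !) {{ℕ._!≢0 (suc (suc i))}} {{ℕ._!≢0 (suc i)}}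
             (subst (2 ℕ.* suc i ! ℕ.≤_) (sym (ℕ.*-identityˡ (suc (suc i) !)))
               (ℕ.*-monoˡ-≤ (suc i !) (ℕ.s≤s (ℕ.s≤s (ℕ.z≤n {i}))))) ⟩
      f i ∎)

    ≤1/ : ∀ n → f n ≤ + 1 / suc n
    ≤1/ n = /-mono 1 (suc n !) 1 (suc n) {{ℕ._!≢0 (suc n)}}
      (ℕ.*-monoʳ-≤ 1 (ℕ.m≤m*n (suc n) (n !) {{ℕ._!≢0 n}}))

open ExpSeries

e : ℝ
e = mkℝ (λ n → sum 1/_! (suc n)) (cauchy-from-tail (λ n → sum 1/_! (suc n)) e-tail)

instance
  e-positive : Positiveᴿ e
  e-positive = mkPositiveᴿ 1ℚ (positive⁻¹ 1ℚ)
    (0 , λ n _ → p≤p+q (sum-nonneg (λ i → 1/ suc i !) (0≤1/! ∘ suc) n))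

module LeibnizSeries where
  leibniz : ℕ → ℚ
  leibniz i = + 1 / suc (2 ℕ.* i)

  leibniz-tail : ∀ n d → ∣ altSum leibniz (n ℕ.+ d) - altSum leibniz n ∣ ≤ + 1 / suc n + + 1 / suc n
  leibniz-tail n d = begin
    ∣ altSum leibniz (n ℕ.+ d) - altSum leibniz n ∣
      ≤⟨ altSum-tail leibniz dec (λ i → 0≤/ 1 (suc (2 ℕ.* i))) n d ⟩
    leibniz n
      ≤⟨ /-mono 1 (suc (2 ℕ.* n)) 1 (suc n) (ℕ.*-monoʳ-≤ 1 (ℕ.s≤s (ℕ.m≤n*m n 2))) ⟩
    + 1 / suc n
      ≤⟨ p≤p+q (0≤/ 1 (suc n)) ⟩
    + 1 / suc n + + 1 / suc n ∎
    where
    dec : ∀ i → leibniz (suc i) ≤ leibniz i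
    dec i = /-mono 1 (suc (2 ℕ.* suc i)) 1 (suc (2 ℕ.* i))
      (ℕ.*-monoʳ-≤ 1 (ℕ.s≤s (ℕ.*-monoʳ-≤ 2 (ℕ.n≤1+n i))))

open LeibnizSeries

-- Leibniz series: π = 4 (1 - 1/3 + 1/5 - 1/7 + ⋯)
π : ℝ
π = fromℕ 4 *ᴿ mkℝ (altSum leibniz) (cauchy-from-tail (altSum leibniz) leibniz-tail)

{-# OPTIONS --safe #-}
-- For 1 ≤ k ≤ s = |A| consider the signed sums of the k-element subsets of A.  Those with p plus and
-- q = k - p minus signs are distinct, by the B_k property, and there are M_p = C(s,k) C(k,p) of them.
-- Centred at n/2, M distinct integers have Σ (2z - t)² ≥ (M³ - M)/3, while over all 2^k signs the
-- second moment of a sum of k terms in [-n,n] is at most k n².  Summing over p, and bounding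
-- Σ C(k,p)³ below by C(2k,k)²/2^k, gives 2^k C(s,k) ≤ (13/2) ⌊(k+1)/2⌋ n, where 13/2 < e π²/4.
-- The term (1 - 1/e) k comes from s(s-1)⋯(s-k+1) ≥ (s - (1 - 1/e) k)^k.  If s < k then A is a
-- B_s-sequence, and the bound for k = s suffices because v^k 2^t ≤ (v + t)^k when v + t ≤ k.
module Submission where

open import Defs
open import Data.Nat using (ℕ; zero; suc; NonZero; >-nonZero; ≢-nonZero⁻¹; _+_; _*_; _∸_; _^_; _/_; _%_; _!; _⊔_; _≤_; _<_; z≤n; s≤s; s≤s⁻¹)
open import Data.Nat.Properties
open import Data.Nat.Combinatorics
  using (_C_; nCn≡1; nCk≡nC[n∸k]; nCk≡n!/k![n-k]!; k![n∸k]!∣n!; nCk+nC[k+1]≡[n+1]C[k+1]; k>n⇒nCk≡0)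
open import Data.Nat.DivMod using (m/n*n≡m; m≡m%n+[m/n]*n; m%n<n; m≥n⇒m/n>0; /-monoˡ-≤)
open import Data.Nat.ListAction using () renaming (sum to Σ)
open import Data.Nat.ListAction.Properties using (sum-++; sum-↭)
open import Data.Nat.Tactic.RingSolver using (solve-∀)
open import Data.Integer as ℤ using (ℤ; +_; -[1+_]; ∣_∣)
import Data.Integer.Properties as ℤ
import Data.Integer.Tactic.RingSolver as ℤ-Solver
open import Data.Rational as ℚ using (ℚ; 0ℚ; 1ℚ)
import Data.Rational.Properties as ℚ
import Tactic.RingSolver as Ring
open import Tactic.RingSolver.Core.AlmostCommutativeRing using (AlmostCommutativeRing; fromCommutativeRing)
open import Algebra.Definitions.RawSemiring ℚ.+-*-rawSemiring using () renaming (_^_ to _^ℚ_)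
open import Data.Fin using (Fin; zero; suc; toℕ)
import Data.Fin.Properties as Fin
open import Data.Fin.Subset as Subset using (Subset; inside; outside)
import Data.Fin.Subset.Properties as Subset
open import Data.List using (List; []; _∷_; _++_; _∷ʳ_; map; length; initLast; _∷ʳ′_)
open import Data.List.Properties using (map-++; map-∘; map-cong; map-cong-local; length-++; length-map)
open import Data.List.Relation.Unary.AllPairs as AllPairs using (AllPairs; []; _∷_)
open import Data.List.Relation.Unary.All as All using (All; []; _∷_)
import Data.List.Relation.Unary.All.Properties as All
open import Data.List.Relation.Unary.Any using (here; there)
open import Data.List.Membership.Propositional using (_∈_; _∉_)
open import Data.List.Membership.Propositional.Properties using (∈-++⁺ʳ; ∈-++⁻; ∈-map⁻)
open import Data.List.Relation.Unary.Unique.Propositional using (Unique)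
import Data.List.Relation.Unary.Unique.Propositional.Properties as Unique
open import Data.List.Relation.Binary.Permutation.Propositional using (_↭_; ↭-sym; ↭⇒↭ₛ)
import Data.List.Relation.Binary.Permutation.Propositional.Properties as ↭
open import Data.List.Relation.Binary.Permutation.Setoid.Properties using (Unique-resp-↭)
open import Data.List.Relation.Unary.Sorted.TotalOrder.Properties using (Sorted⇒AllPairs)
open import Data.List.Sort ℤ.≤-decTotalOrder using (sort; sort-↭; sort-↗)
open import Data.Vec as Vec using (Vec; []; _∷_; fromList; toList; here; there)
open import Data.Vec.Properties using (∷-injectiveʳ; toList∘fromList)
import Data.Vec.Relation.Unary.All as VecAll
import Data.Vec.Relation.Unary.All.Properties as VecAll
open import Data.Product using (_×_; _,_; proj₁; proj₂; ∃-syntax)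
open import Data.Sum using (inj₁; inj₂; [_,_]′)
open import Function using (_∘_)
open import Level using (0ℓ)
open import Relation.Binary.PropositionalEquality
  using (_≡_; _≢_; refl; sym; trans; cong; cong₂; subst; subst₂; setoid; module ≡-Reasoning)
open import Relation.Nullary using (contradiction)
open import Relation.Nullary.Decidable using (dec⇒maybe; from-yes)

-- Two signed sums can collide without harm unless moving the minus terms across leaves k terms on
-- each side, which needs equal p and equal q; so distinctness is available only for fixed p. The
-- cross terms of the second moment, however, cancel only over all signs together. Replacing each a
-- by 2a - n reconciles the two: 2z - (p - q) n is then a signed sum of numbers in [-n, n], centred
-- at 0 for every p at once.
--
-- The constant 5/16 in `central-lower` is a rational stand-in for 1/π in C(2k,k)² ~ 16^k / (π k).
-- It leads to a leading term (48/5) k² n² for (2^k C(s,k))², against (13/2)² (k/2)² n², about 10.56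
-- k² n², on the other side. The margin is too thin for k = 2 and for k = 4, n = 1, which shapes the
-- case distinctions.
--
-- Reals are Cauchy sequences, so e is replaced by a rational partial sum E. Nothing is lost: (1 +
-- 1/i)^i ≤ E holds for every partial sum that reaches 1/i!. At each late stage the estimate is
-- exact, and only the rounding of the roots to a grid has to be absorbed by ε.

-- Binomial sums

-- f 0 k + f 1 (k - 1) + ⋯ + f k 0
Σ↘ : (ℕ → ℕ → ℕ) → ℕ → ℕ
Σ↘ f zero    = f 0 0
Σ↘ f (suc k) = f 0 (suc k) + Σ↘ (λ i j → f (suc i) j) k

-- The index lowered by one, as in Pascal's rule, with the default `d` where there is no
-- predecessor: 0 for numbers, `[]` for lists of sign vectors.
shiftˡ shiftʳ : ∀ {a} {A : Set a} → A → (ℕ → ℕ → A) → ℕ → ℕ → A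
shiftˡ d f zero    q = d
shiftˡ d f (suc p) q = f p q
shiftʳ d f p zero    = d
shiftʳ d f p (suc q) = f p q

Σ↘-mono : ∀ {f g} k → (∀ i j → i + j ≡ k → f i j ≤ g i j) → Σ↘ f k ≤ Σ↘ g k
Σ↘-mono zero    f≤g = f≤g 0 0 refl
Σ↘-mono (suc k) f≤g = +-mono-≤ (f≤g 0 (suc k) refl)
  (Σ↘-mono k λ i j i+j≡k → f≤g (suc i) j (cong suc i+j≡k))

Σ↘-cong : ∀ {f g} k → (∀ i j → i + j ≡ k → f i j ≡ g i j) → Σ↘ f k ≡ Σ↘ g k
Σ↘-cong zero    f≡g = f≡g 0 0 refl
Σ↘-cong (suc k) f≡g = cong₂ _+_ (f≡g 0 (suc k) refl)
  (Σ↘-cong k λ i j i+j≡k → f≡g (suc i) j (cong suc i+j≡k))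

Σ↘-+ : ∀ f g k → Σ↘ (λ i j → f i j + g i j) k ≡ Σ↘ f k + Σ↘ g k
Σ↘-+ f g zero    = refl
Σ↘-+ f g (suc k) rewrite Σ↘-+ (λ i j → f (suc i) j) (λ i j → g (suc i) j) k =
  interchange (f 0 (suc k)) (g 0 (suc k)) (Σ↘ (λ i j → f (suc i) j) k) (Σ↘ (λ i j → g (suc i) j) k)
  where
  interchange : ∀ a b c d → a + b + (c + d) ≡ a + c + (b + d)
  interchange = solve-∀

Σ↘-* : ∀ c f k → Σ↘ (λ i j → c * f i j) k ≡ c * Σ↘ f k
Σ↘-* c f zero    = refl
Σ↘-* c f (suc k) rewrite Σ↘-* c (λ i j → f (suc i) j) k =
  sym (*-distribˡ-+ c (f 0 (suc k)) (Σ↘ (λ i j → f (suc i) j) k))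

-- The default entry of `shiftʳ` is the last one on the diagonal, so an induction is needed; that of
-- `shiftˡ` is the first one, and there the equation holds by computation.
Σ↘-shiftʳ : ∀ f k → Σ↘ (shiftʳ 0 f) (suc k) ≡ Σ↘ f k
Σ↘-shiftʳ f zero    = +-identityʳ (f 0 0)
Σ↘-shiftʳ f (suc k) = cong (λ t → f 0 (suc k) + t) (trans
  (Σ↘-cong (suc k) shift-suc)
  (Σ↘-shiftʳ (λ i j → f (suc i) j) k))
  where
  shift-suc : ∀ i j → i + j ≡ suc k → shiftʳ 0 f (suc i) j ≡ shiftʳ 0 (λ i j → f (suc i) j) i j
  shift-suc i zero    _ = refl
  shift-suc i (suc j) _ = refl

vandermonde : ∀ m n r → Σ↘ (λ i j → (m C i) * (n C j)) r ≡ (m + n) C r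
vandermonde zero n zero = trans (*-identityˡ (n C 0)) refl
vandermonde zero n (suc r) = trans
  (cong₂ _+_ (*-identityˡ (n C suc r)) (trans (Σ↘-cong r λ _ _ _ → refl) (Σ↘-* 0 (λ _ _ → 0) r)))
  (+-identityʳ (n C suc r))
vandermonde (suc m) n zero = trans (*-identityˡ (n C 0)) refl
vandermonde (suc m) n (suc r) = begin-equality
  Σ↘ (λ i j → (suc m C i) * (n C j)) (suc r)
    ≡⟨ Σ↘-cong (suc r) pascal ⟩
  Σ↘ (λ i j → (m C i) * (n C j) + shiftˡ 0 (λ i j → (m C i) * (n C j)) i j) (suc r)
    ≡⟨ Σ↘-+ (λ i j → (m C i) * (n C j)) (shiftˡ 0 (λ i j → (m C i) * (n C j))) (suc r) ⟩
  Σ↘ (λ i j → (m C i) * (n C j)) (suc r) + Σ↘ (λ i j → (m C i) * (n C j)) r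
    ≡⟨ cong₂ _+_ (vandermonde m n (suc r)) (vandermonde m n r) ⟩
  (m + n) C suc r + (m + n) C r
    ≡⟨ +-comm ((m + n) C suc r) ((m + n) C r) ⟩
  (m + n) C r + (m + n) C suc r
    ≡⟨ nCk+nC[k+1]≡[n+1]C[k+1] (m + n) r ⟩
  suc (m + n) C suc r ∎
  where
  open ≤-Reasoning
  pascal : ∀ i j → i + j ≡ suc r →
    (suc m C i) * (n C j) ≡ (m C i) * (n C j) + shiftˡ 0 (λ i j → (m C i) * (n C j)) i j
  pascal zero    j _ = sym (+-identityʳ (1 * (n C j)))
  pascal (suc i) j _ = trans
    (cong (_* (n C j)) (trans (sym (nCk+nC[k+1]≡[n+1]C[k+1] m i)) (+-comm (m C i) (m C suc i))))
    (*-distribʳ-+ (n C j) (m C suc i) (m C i))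

Σ↘-C : ∀ k → Σ↘ (λ i j → k C i) k ≡ 2 ^ k
Σ↘-C zero    = refl
Σ↘-C (suc k) = begin-equality
  Σ↘ (λ i j → suc k C i) (suc k)
    ≡⟨ Σ↘-cong (suc k) pascal ⟩
  Σ↘ (λ i j → shiftˡ 0 kC i j + shiftʳ 0 kC i j) (suc k)
    ≡⟨ Σ↘-+ (shiftˡ 0 kC) (shiftʳ 0 kC) (suc k) ⟩
  Σ↘ kC k + Σ↘ (shiftʳ 0 kC) (suc k)
    ≡⟨ cong₂ _+_ (Σ↘-C k) (trans (Σ↘-shiftʳ kC k) (trans (Σ↘-C k) (sym (+-identityʳ (2 ^ k))))) ⟩
  2 ^ suc k ∎
  where
  open ≤-Reasoning
  kC : ℕ → ℕ → ℕ
  kC i j = k C i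
  pascal : ∀ i j → i + j ≡ suc k → suc k C i ≡ shiftˡ 0 kC i j + shiftʳ 0 kC i j
  pascal zero    (suc j) _ = refl
  pascal (suc i) (suc j) _ = sym (nCk+nC[k+1]≡[n+1]C[k+1] k i)
  pascal (suc i) zero    1+i+0≡1+k = trans (sym (nCk+nC[k+1]≡[n+1]C[k+1] k i))
    (cong (λ t → k C i + t) (k>n⇒nCk≡0 (≤-reflexive (trans (sym 1+i+0≡1+k) (+-identityʳ (suc i))))))

Σ↘-C² : ∀ k → Σ↘ (λ i j → (k C i) * (k C i)) k ≡ (k + k) C k
Σ↘-C² k = trans (Σ↘-cong k symmetric) (vandermonde k k k)
  where
  symmetric : ∀ i j → i + j ≡ k → (k C i) * (k C i) ≡ (k C i) * (k C j)
  symmetric i j refl = cong ((k C i) *_) (trans (nCk≡nC[n∸k] (m≤m+n i j)) (cong (k C_) (m+n∸m≡n i j)))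

2mn≤m²+n² : ∀ m n → 2 * (m * n) ≤ m * m + n * n
2mn≤m²+n² m n with ≤-total m n
... | inj₁ m≤n with m≤n⇒∃[o]m+o≡n m≤n
...   | d , refl = subst (2 * (m * n) ≤_) (eq m d) (m≤m+n (2 * (m * n)) (d * d))
  where
  eq : ∀ m d → 2 * (m * (m + d)) + d * d ≡ m * m + (m + d) * (m + d)
  eq = solve-∀
2mn≤m²+n² m n | inj₂ n≤m with m≤n⇒∃[o]m+o≡n n≤m
...   | d , refl = subst (2 * (m * n) ≤_) (eq n d) (m≤m+n (2 * (m * n)) (d * d))
  where
  eq : ∀ n d → 2 * ((n + d) * n) + d * d ≡ (n + d) * (n + d) + n * n
  eq = solve-∀

-- Cauchy-Schwarz with weights: the sum of x (S₂ - S₁ x)² ≥ 0 over all entries x, written without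
-- subtraction. Positivity of `S₁` permits the final cancellation.
Σ↘-cauchy : ∀ f k → 0 < Σ↘ f k →
  Σ↘ (λ i j → f i j * f i j) k * Σ↘ (λ i j → f i j * f i j) k ≤
  Σ↘ (λ i j → f i j * (f i j * f i j)) k * Σ↘ f k
Σ↘-cauchy f k 0<S₁ = *-cancelˡ-≤ S₁ {{>-nonZero 0<S₁}} (+-cancelˡ-≤ (S₁ * (S₂ * S₂)) _ _ (begin
  S₁ * (S₂ * S₂) + S₁ * (S₂ * S₂)
    ≡⟨ eq₁ S₁ S₂ ⟩
  2 * (S₁ * S₂) * S₂
    ≡⟨ Σ↘-* (2 * (S₁ * S₂)) (λ i j → f i j * f i j) k ⟨
  Σ↘ (λ i j → 2 * (S₁ * S₂) * (f i j * f i j)) k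
    ≤⟨ Σ↘-mono k (λ i j _ → termwise (f i j)) ⟩
  Σ↘ (λ i j → S₂ * S₂ * f i j + S₁ * S₁ * (f i j * (f i j * f i j))) k
    ≡⟨ Σ↘-+ (λ i j → S₂ * S₂ * f i j) (λ i j → S₁ * S₁ * (f i j * (f i j * f i j))) k ⟩
  Σ↘ (λ i j → S₂ * S₂ * f i j) k + Σ↘ (λ i j → S₁ * S₁ * (f i j * (f i j * f i j))) k
    ≡⟨ cong₂ _+_ (Σ↘-* (S₂ * S₂) f k) (Σ↘-* (S₁ * S₁) (λ i j → f i j * (f i j * f i j)) k) ⟩
  S₂ * S₂ * S₁ + S₁ * S₁ * S₃
    ≡⟨ eq₂ S₁ S₂ S₃ ⟩
  S₁ * (S₂ * S₂) + S₁ * (S₃ * S₁) ∎))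
  where
  open ≤-Reasoning
  S₁ S₂ S₃ : ℕ
  S₁ = Σ↘ f k
  S₂ = Σ↘ (λ i j → f i j * f i j) k
  S₃ = Σ↘ (λ i j → f i j * (f i j * f i j)) k
  eq₁ : ∀ a b → a * (b * b) + a * (b * b) ≡ 2 * (a * b) * b
  eq₁ = solve-∀
  eq₂ : ∀ a b c → b * b * a + a * a * c ≡ a * (b * b) + a * (c * a)
  eq₂ = solve-∀
  eq₃ : ∀ a b x → 2 * (a * b) * (x * x) ≡ x * (2 * (b * (a * x)))
  eq₃ = solve-∀
  eq₄ : ∀ a b x → x * (b * b + a * x * (a * x)) ≡ b * b * x + a * a * (x * (x * x))
  eq₄ = solve-∀
  termwise : ∀ x → 2 * (S₁ * S₂) * (x * x) ≤ S₂ * S₂ * x + S₁ * S₁ * (x * (x * x))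
  termwise x = subst₂ _≤_ (sym (eq₃ S₁ S₂ x)) (eq₄ S₁ S₂ x) (*-monoʳ-≤ x (2mn≤m²+n² S₂ (S₁ * x)))

C-! : ∀ a b → ((a + b) C a) * (a ! * b !) ≡ (a + b) !
C-! a b = begin-equality
  ((a + b) C a) * (a ! * b !)
    ≡⟨ cong (λ c → ((a + b) C a) * (a ! * c !)) (m+n∸m≡n a b) ⟨
  ((a + b) C a) * (a ! * (a + b ∸ a) !)
    ≡⟨ cong (_* (a ! * (a + b ∸ a) !)) (nCk≡n!/k![n-k]! (m≤m+n a b)) ⟩
  _/_ ((a + b) !) (a ! * (a + b ∸ a) !) {{nz}} * (a ! * (a + b ∸ a) !)
    ≡⟨ m/n*n≡m {{nz}} (k![n∸k]!∣n! (m≤m+n a b)) ⟩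
  (a + b) ! ∎
  where
  open ≤-Reasoning
  nz : NonZero (a ! * (a + b ∸ a) !)
  nz = a !* (a + b ∸ a) !≢0

central-rec : ∀ k → suc k * ((suc k + suc k) C suc k) ≡ 2 * suc (2 * k) * ((k + k) C k)
central-rec k = *-cancelʳ-≡ _ _ (suc k * (k ! * k !)) {{m*n≢0 (suc k) (k ! * k !) {{_}} {{k !* k !≢0}}}} (begin-equality
  suc k * B' * (suc k * (k ! * k !))
    ≡⟨ eq₁ k B' (k !) ⟩
  B' * (suc k ! * suc k !)
    ≡⟨ C-! (suc k) (suc k) ⟩
  (suc k + suc k) !
    ≡⟨ cong (λ n → suc n !) (+-suc k k) ⟩
  suc (suc (k + k)) * (suc (k + k) * (k + k) !)
    ≡⟨ cong (λ n → suc (suc (k + k)) * (suc (k + k) * n)) (C-! k k) ⟨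
  suc (suc (k + k)) * (suc (k + k) * (B * (k ! * k !)))
    ≡⟨ eq₂ k B (k !) ⟩
  2 * suc (2 * k) * B * (suc k * (k ! * k !)) ∎)
  where
  open ≤-Reasoning
  B = (k + k) C k
  B' = (suc k + suc k) C suc k
  eq₁ : ∀ k b f → suc k * b * (suc k * (f * f)) ≡ b * (suc k * f * (suc k * f))
  eq₁ = solve-∀
  eq₂ : ∀ k b f → suc (suc (k + k)) * (suc (k + k) * (b * (f * f))) ≡ 2 * suc (2 * k) * b * (suc k * (f * f))
  eq₂ = solve-∀

-- The constants make this an equality for k = 1; it fails for k = 0.
central-lower : ∀ k .{{_ : NonZero k}} → 5 * 16 ^ k ≤ (16 * k + 4) * (((k + k) C k) * ((k + k) C k))
central-lower 1 = ≤-refl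
central-lower (suc k@(suc _)) = *-cancelˡ-≤ (suc k * suc k) (begin
  suc k * suc k * (5 * 16 ^ suc k)
    ≡⟨ eq₁ k (16 ^ k) ⟩
  16 * (suc k * suc k) * (5 * 16 ^ k)
    ≤⟨ *-monoʳ-≤ (16 * (suc k * suc k)) (central-lower k) ⟩
  16 * (suc k * suc k) * ((16 * k + 4) * (B * B))
    -- (16 (k + 1) + 4) · 4 (2k + 1)² exceeds 16 (k + 1)² (16 k + 4) by exactly 16; the offset 4 in
    -- 16 k + 4 is what keeps this remainder positive.
    ≤⟨ m≤m+n _ (16 * (B * B)) ⟩
  16 * (suc k * suc k) * ((16 * k + 4) * (B * B)) + 16 * (B * B)
    ≡⟨ eq₂ k B ⟩
  (16 * suc k + 4) * (2 * suc (2 * k) * B * (2 * suc (2 * k) * B))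
    ≡⟨ cong (λ n → (16 * suc k + 4) * (n * n)) (central-rec k) ⟨
  (16 * suc k + 4) * (suc k * B' * (suc k * B'))
    ≡⟨ eq₃ k B' ⟩
  suc k * suc k * ((16 * suc k + 4) * (B' * B')) ∎)
  where
  open ≤-Reasoning
  B = (k + k) C k
  B' = (suc k + suc k) C suc k
  eq₁ : ∀ k t → suc k * suc k * (5 * (16 * t)) ≡ 16 * (suc k * suc k) * (5 * t)
  eq₁ = solve-∀
  eq₂ : ∀ k b → 16 * (suc k * suc k) * ((16 * k + 4) * (b * b)) + 16 * (b * b) ≡
    (16 * suc k + 4) * (2 * suc (2 * k) * b * (2 * suc (2 * k) * b))
  eq₂ = solve-∀
  eq₃ : ∀ k b → (16 * suc k + 4) * (suc k * b * (suc k * b)) ≡ suc k * suc k * ((16 * suc k + 4) * (b * b))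
  eq₃ = solve-∀

-- The size inequality

m²≤n²⇒m≤n : ∀ {m n} → m * m ≤ n * n → m ≤ n
m²≤n²⇒m≤n m²≤n² = ≮⇒≥ λ n<m → <⇒≱ (*-mono-< n<m n<m) m²≤n²

[m*m]^k≡m^k*m^k : ∀ m k → (m * m) ^ k ≡ m ^ k * m ^ k
[m*m]^k≡m^k*m^k m zero    = refl
[m*m]^k≡m^k*m^k m (suc k) = trans (cong (m * m *_) ([m*m]^k≡m^k*m^k m k)) (eq m (m ^ k))
  where
  eq : ∀ m t → m * m * (t * t) ≡ m * t * (m * t)
  eq = solve-∀

-- The Franel numbers.
sum-C³ : ℕ → ℕ
sum-C³ k = Σ↘ (λ i j → (k C i) * ((k C i) * (k C i))) k

module _ (k n c : ℕ) .{{_ : NonZero k}}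
  (cubes : c * c * sum-C³ k ≤ 2 ^ k * (3 * (k * (n * n)) + 1)) where

  -- Cauchy-Schwarz against the row sum 2^k gives `B * B ≤ sum-C³ k * 2 ^ k`, and `central-lower`
  -- replaces `B * B` by a power of 16. With 16^k = (2^k)^4 everything depends on 2^k c alone.
  central-bound : 5 * (2 ^ k * c * (2 ^ k * c)) ≤ (16 * k + 4) * (3 * (k * (n * n)) + 1)
  central-bound = *-cancelˡ-≤ (t * t) {{m*n≢0 t t {{m^n≢0 2 k}} {{m^n≢0 2 k}}}} (begin
    t * t * (5 * (t * c * (t * c)))
      ≡⟨ eq₁ t c ⟩
    5 * (t * t * (t * t)) * (c * c)
      ≡⟨ cong (λ u → 5 * u * (c * c)) (trans ([m*m]^k≡m^k*m^k 4 k) (cong (λ u → u * u) ([m*m]^k≡m^k*m^k 2 k))) ⟨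
    5 * 16 ^ k * (c * c)
      ≤⟨ *-monoˡ-≤ (c * c) (central-lower k) ⟩
    (16 * k + 4) * (B * B) * (c * c)
      ≤⟨ *-monoˡ-≤ (c * c) (*-monoʳ-≤ (16 * k + 4) B²≤) ⟩
    (16 * k + 4) * (sum-C³ k * t) * (c * c)
      ≡⟨ eq₂ (16 * k + 4) (sum-C³ k) t c ⟩
    (16 * k + 4) * t * (c * c * sum-C³ k)
      ≤⟨ *-monoʳ-≤ ((16 * k + 4) * t) cubes ⟩
    (16 * k + 4) * t * (t * (3 * (k * (n * n)) + 1))
      ≡⟨ eq₃ (16 * k + 4) t (3 * (k * (n * n)) + 1) ⟩
    t * t * ((16 * k + 4) * (3 * (k * (n * n)) + 1)) ∎)
    where
    open ≤-Reasoning
    t = 2 ^ k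
    B = (k + k) C k
    B²≤ : B * B ≤ sum-C³ k * t
    B²≤ = subst₂ (λ a b → a * a ≤ sum-C³ k * b) (Σ↘-C² k) (Σ↘-C k)
      (Σ↘-cauchy (λ i j → k C i) k (subst (0 <_) (sym (Σ↘-C k)) (m^n>0 2 k)))
    eq₁ : ∀ t c → t * t * (5 * (t * c * (t * c))) ≡ 5 * (t * t * (t * t)) * (c * c)
    eq₁ = solve-∀
    eq₂ : ∀ a s t c → a * (s * t) * (c * c) ≡ a * t * (c * c * s)
    eq₂ = solve-∀
    eq₃ : ∀ a t b → a * t * (t * b) ≡ t * t * (a * b)
    eq₃ = solve-∀

  -- Since 845 = 5 · 13², the premise is the square of the goal with `central-bound` inserted: a
  -- polynomial inequality in k, h, n, free of c and of powers of 2.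
  square-root : ∀ h → 4 * ((16 * k + 4) * (3 * (k * (n * n)) + 1)) ≤ 845 * (h * n * (h * n)) →
    2 * (2 ^ k * c) ≤ 13 * (h * n)
  square-root h bound = m²≤n²⇒m≤n (*-cancelˡ-≤ 5 (begin
    5 * (2 * K * (2 * K))        ≡⟨ eq₁ K ⟩
    4 * (5 * (K * K))            ≤⟨ *-monoʳ-≤ 4 central-bound ⟩
    4 * ((16 * k + 4) * (3 * (k * (n * n)) + 1)) ≤⟨ bound ⟩
    845 * (h * n * (h * n))      ≡⟨ eq₂ (h * n) ⟩
    5 * (13 * (h * n) * (13 * (h * n))) ∎))
    where
    open ≤-Reasoning
    K = 2 ^ k * c
    eq₁ : ∀ x → 5 * (2 * x * (2 * x)) ≡ 4 * (5 * (x * x))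
    eq₁ = solve-∀
    eq₂ : ∀ x → 845 * (x * x) ≡ 5 * (13 * x * (13 * x))
    eq₂ = solve-∀

-- For k = 2 the central binomial coefficient loses too much: here 1³ + 2³ + 1³ = 10 is used.
size-bound-two : ∀ n c .{{_ : NonZero n}} → c * c * sum-C³ 2 ≤ 2 ^ 2 * (3 * (2 * (n * n)) + 1) →
  2 * (2 ^ 2 * c) ≤ 13 * (1 * n)
-- For n = 1 the hypothesis reads 10 c² ≤ 28, so c ≤ 1. From n = 2 on, 1690 n² - 256 (6 n² + 1) =
-- 154 n² - 256 is positive.
size-bound-two 1 0 cubes = z≤n
size-bound-two 1 1 cubes = ≤ᵇ⇒≤ 8 13 _
size-bound-two 1 c@(suc (suc _)) cubes = contradiction
  (≤-trans (*-monoˡ-≤ 10 (*-mono-≤ {2} {c} {2} {c} (s≤s (s≤s z≤n)) (s≤s (s≤s z≤n)))) cubes)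
  (<⇒≱ (≤ᵇ⇒≤ 29 40 _))
size-bound-two n@(suc (suc m)) c cubes = m²≤n²⇒m≤n (*-cancelˡ-≤ 10 (begin
  10 * (2 * (4 * c) * (2 * (4 * c)))                     ≡⟨ eq₁ c ⟩
  64 * (c * c * 10)                                      ≤⟨ *-monoʳ-≤ 64 cubes ⟩
  64 * (4 * (3 * (2 * (n * n)) + 1))                     ≤⟨ m≤m+n _ (154 * (m * m) + 616 * m + 360) ⟩
  64 * (4 * (3 * (2 * (n * n)) + 1)) + (154 * (m * m) + 616 * m + 360) ≡⟨ eq₂ m ⟩
  10 * (13 * (1 * n) * (13 * (1 * n)))                   ∎))
  where
  open ≤-Reasoning
  eq₁ : ∀ c → 10 * (2 * (4 * c) * (2 * (4 * c))) ≡ 64 * (c * c * 10)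
  eq₁ = solve-∀
  eq₂ : ∀ m → 64 * (4 * (3 * (2 * ((2 + m) * (2 + m))) + 1)) + (154 * (m * m) + 616 * m + 360) ≡
    10 * (13 * (1 * (2 + m)) * (13 * (1 * (2 + m))))
  eq₂ = solve-∀

-- Expanded at h = 2 + m and n = 2 + d, the difference of the two sides has only positive
-- coefficients. The inequality is false at h = 1 for every n, and at h = 2, n = 1, where it would
-- say 3536 ≤ 3380.
size-bound-even : ∀ m n → 2 ≤ n → let h = suc (suc m) in
  4 * ((16 * (h * 2) + 4) * (3 * (h * 2 * (n * n)) + 1)) ≤ 845 * (h * n * (h * n))
size-bound-even m (suc (suc d)) _ = ≤-trans
  (m≤m+n _ ((77 * (m * m) + 212 * m + 116) * (d * d + 4 * d) + (308 * (m * m) + 720 * m + 192)))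
  (≤-reflexive (eq m d))
  where
  eq : ∀ m d → 4 * ((16 * ((2 + m) * 2) + 4) * (3 * ((2 + m) * 2 * ((2 + d) * (2 + d))) + 1)) +
    ((77 * (m * m) + 212 * m + 116) * (d * d + 4 * d) + (308 * (m * m) + 720 * m + 192)) ≡
    845 * ((2 + m) * (2 + d) * ((2 + m) * (2 + d)))
  eq = solve-∀
size-bound-even m (suc zero) (s≤s ())

-- For odd k the rounding makes h larger than k / 2, and this gain covers every n ≥ 1.
size-bound-odd : ∀ m n .{{_ : NonZero n}} → let h = suc m ; k = suc (m * 2) in
  4 * ((16 * k + 4) * (3 * (k * (n * n)) + 1)) ≤ 845 * (h * n * (h * n))
size-bound-odd m (suc d) = ≤-trans
  (m≤m+n _ ((77 * (m * m) + 826 * m + 605) * (2 * d + d * d) + (77 * (m * m) + 698 * m + 525)))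
  (≤-reflexive (eq m d))
  where
  eq : ∀ m d → 4 * ((16 * (1 + m * 2) + 4) * (3 * ((1 + m * 2) * ((1 + d) * (1 + d))) + 1)) +
    ((77 * (m * m) + 826 * m + 605) * (2 * d + d * d) + (77 * (m * m) + 698 * m + 525)) ≡
    845 * ((1 + m) * (1 + d) * ((1 + m) * (1 + d)))
  eq = solve-∀

-- The premise `3 ≤ k → 2 ≤ n` serves `size-bound-even`; it holds whenever [0, n] contains k
-- distinct elements.
size-bound : ∀ k n c .{{_ : NonZero k}} .{{_ : NonZero n}} → (3 ≤ k → 2 ≤ n) →
  c * c * sum-C³ k ≤ 2 ^ k * (3 * (k * (n * n)) + 1) →
  2 * (2 ^ k * c) ≤ 13 * ((k + 1) / 2 * n)
size-bound k n c big cubes = cases ((k + 1) % 2) ((k + 1) / 2) (m%n<n (k + 1) 2)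
  (trans (+-comm 1 k) (m≡m%n+[m/n]*n (k + 1) 2)) big cubes
  where
  cases : ∀ r h → r < 2 → suc k ≡ r + h * 2 → (3 ≤ k → 2 ≤ n) →
    c * c * sum-C³ k ≤ 2 ^ k * (3 * (k * (n * n)) + 1) → 2 * (2 ^ k * c) ≤ 13 * (h * n)
  cases 0 (suc m) _ refl big cubes = square-root k n c cubes (suc m) (size-bound-odd m n)
  cases 1 1 _ refl big cubes = size-bound-two n c cubes
  cases 1 (suc (suc m)) _ refl big cubes =
    square-root k n c cubes (suc (suc m)) (size-bound-even m n (big (s≤s (s≤s (s≤s z≤n)))))
  cases (suc (suc _)) h (s≤s (s≤s ())) _ _ _

-- Sums of squares of distinct integers

∣_∣² : ℤ → ℕ
∣ z ∣² = ∣ z ∣ * ∣ z ∣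

+∣z∣² : ∀ z → + ∣ z ∣² ≡ z ℤ.* z
+∣z∣² (+ n)    = ℤ.pos-* n n
+∣z∣² -[1+ n ] = refl

parallelogram : ∀ y x → ∣ y ℤ.+ x ∣² + ∣ y ℤ.- x ∣² ≡ 2 * (∣ x ∣² + ∣ y ∣²)
parallelogram y x = ℤ.+-injective (≡.begin
  + (∣ y ℤ.+ x ∣² + ∣ y ℤ.- x ∣²)
    ≡.≡⟨ ℤ.pos-+ ∣ y ℤ.+ x ∣² ∣ y ℤ.- x ∣² ⟩
  + ∣ y ℤ.+ x ∣² ℤ.+ + ∣ y ℤ.- x ∣²
    ≡.≡⟨ cong₂ ℤ._+_ (+∣z∣² (y ℤ.+ x)) (+∣z∣² (y ℤ.- x)) ⟩
  (y ℤ.+ x) ℤ.* (y ℤ.+ x) ℤ.+ (y ℤ.- x) ℤ.* (y ℤ.- x)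
    ≡.≡⟨ eq y x ⟩
  + 2 ℤ.* (x ℤ.* x ℤ.+ y ℤ.* y)
    ≡.≡⟨ cong (+ 2 ℤ.*_) (cong₂ ℤ._+_ (+∣z∣² x) (+∣z∣² y)) ⟨
  + 2 ℤ.* (+ ∣ x ∣² ℤ.+ + ∣ y ∣²)
    ≡.≡⟨ cong (+ 2 ℤ.*_) (ℤ.pos-+ ∣ x ∣² ∣ y ∣²) ⟨
  + 2 ℤ.* + (∣ x ∣² + ∣ y ∣²)
    ≡.≡⟨ ℤ.pos-* 2 (∣ x ∣² + ∣ y ∣²) ⟨
  + (2 * (∣ x ∣² + ∣ y ∣²)) ≡.∎)
  where
  module ≡ = ≡-Reasoning
  eq : ∀ y x → (y ℤ.+ x) ℤ.* (y ℤ.+ x) ℤ.+ (y ℤ.- x) ℤ.* (y ℤ.- x) ≡ + 2 ℤ.* (x ℤ.* x ℤ.+ y ℤ.* y)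
  eq = ℤ-Solver.solve-∀

gap : ∀ x zs {y} → AllPairs ℤ._<_ (x ∷ zs ∷ʳ y) → x ℤ.+ + suc (length zs) ℤ.≤ y
gap x []       ((x<y ∷ _) ∷ _) = subst (ℤ._≤ _) (ℤ.+-comm (+ 1) x) (ℤ.i<j⇒suc[i]≤j x<y)
gap x (z ∷ zs) {y} ((x<z ∷ _) ∷ incr) = begin
  x ℤ.+ + suc (suc (length zs))    ≡⟨ eq x (+ suc (length zs)) ⟩
  ℤ.suc x ℤ.+ + suc (length zs)    ≤⟨ ℤ.+-monoˡ-≤ (+ suc (length zs)) (ℤ.i<j⇒suc[i]≤j x<z) ⟩
  z ℤ.+ + suc (length zs)          ≤⟨ gap z zs incr ⟩
  y                                ∎
  where
  open ℤ.≤-Reasoning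
  eq : ∀ x l → x ℤ.+ (+ 1 ℤ.+ l) ≡ (+ 1 ℤ.+ x) ℤ.+ l
  eq = ℤ-Solver.solve-∀

AllPairs-init : ∀ zs {y} → AllPairs ℤ._<_ (zs ∷ʳ y) → AllPairs ℤ._<_ zs
AllPairs-init []       _            = []
AllPairs-init (z ∷ zs) (z< ∷ incr) = All.++⁻ˡ zs z< ∷ AllPairs-init zs incr

-- The least and the greatest of m + 2 distinct integers differ by at least m + 1,
-- so by the parallelogram law they contribute at least 2 (m + 1)².
extremes : ∀ t {x y} m → x ℤ.+ + suc m ℤ.≤ y →
  2 * (suc m * suc m) ≤ ∣ + 2 ℤ.* y ℤ.- t ∣² + ∣ + 2 ℤ.* x ℤ.- t ∣²
extremes t {x} {y} m x+m≤y = begin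
  2 * (suc m * suc m)
    ≤⟨ *-monoʳ-≤ 2 (*-mono-≤ m≤∣d∣ m≤∣d∣) ⟩
  2 * ∣ d ∣²
    ≤⟨ *-monoʳ-≤ 2 (m≤m+n ∣ d ∣² ∣ x ℤ.+ y ℤ.- t ∣²) ⟩
  2 * (∣ d ∣² + ∣ x ℤ.+ y ℤ.- t ∣²)
    ≡⟨ parallelogram (x ℤ.+ y ℤ.- t) d ⟨
  ∣ x ℤ.+ y ℤ.- t ℤ.+ d ∣² + ∣ x ℤ.+ y ℤ.- t ℤ.- d ∣²
    ≡⟨ cong₂ _+_ (cong ∣_∣² (eq₁ x y t)) (cong ∣_∣² (eq₂ x y t)) ⟩
  ∣ + 2 ℤ.* y ℤ.- t ∣² + ∣ + 2 ℤ.* x ℤ.- t ∣² ∎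
  where
  open ≤-Reasoning
  d = y ℤ.- x
  eq₀ : ∀ x l → (x ℤ.+ l) ℤ.- x ≡ l
  eq₀ = ℤ-Solver.solve-∀
  eq₁ : ∀ x y t → x ℤ.+ y ℤ.- t ℤ.+ (y ℤ.- x) ≡ + 2 ℤ.* y ℤ.- t
  eq₁ = ℤ-Solver.solve-∀
  eq₂ : ∀ x y t → x ℤ.+ y ℤ.- t ℤ.- (y ℤ.- x) ≡ + 2 ℤ.* x ℤ.- t
  eq₂ = ℤ-Solver.solve-∀
  m≤d : + suc m ℤ.≤ d
  m≤d = subst (ℤ._≤ d) (eq₀ x (+ suc m)) (ℤ.+-monoˡ-≤ (ℤ.- x) x+m≤y)
  m≤∣d∣ : suc m ≤ ∣ d ∣
  m≤∣d∣ = ℤ.drop‿+≤+ (subst (+ suc m ℤ.≤_) (sym (ℤ.0≤i⇒+∣i∣≡i (ℤ.≤-trans (ℤ.+≤+ z≤n) m≤d))) m≤d)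

module _ (t : ℤ) where
  -- Four times the squared distance from the centre t / 2; the scaling keeps half-integral centres
  -- within the integers.
  deviation : ℤ → ℕ
  deviation z = ∣ + 2 ℤ.* z ℤ.- t ∣²

  -- Both extremes are removed at once, so m drops by two: (m + 2)³ - (m + 2) = (m³ - m) + 3 · 2 (m
  -- + 1)², and `extremes` supplies the 2 (m + 1)².
  spread-increasing : ∀ m zs → length zs ≡ m → AllPairs ℤ._<_ zs →
    m * (m * m) ≤ 3 * Σ (map deviation zs) + m
  spread-increasing 0 zs _ _ = z≤n
  spread-increasing 1 zs _ _ = m≤n+m 1 (3 * Σ (map deviation zs))
  spread-increasing (suc (suc m)) (x ∷ zs) len incr with initLast zs
  ... | zs ∷ʳ′ y = begin
    suc (suc m) * (suc (suc m) * suc (suc m))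
      ≡⟨ eq₁ m ⟩
    3 * (2 * (suc m * suc m)) + m * (m * m) + 2
      ≤⟨ +-monoˡ-≤ 2 (+-mono-≤ (*-monoʳ-≤ 3 (extremes t {x} {y} m x+m≤y))
           (spread-increasing m zs len′ (AllPairs-init zs (AllPairs.tail incr)))) ⟩
    3 * (deviation y + deviation x) + (3 * S + m) + 2
      ≡⟨ eq₂ (deviation x) (deviation y) S m ⟩
    3 * (deviation x + (S + (deviation y + 0))) + suc (suc m)
      ≡⟨ cong (λ a → 3 * (deviation x + a) + suc (suc m))
           (trans (cong Σ (map-++ deviation zs (y ∷ []))) (sum-++ (map deviation zs) _)) ⟨
    3 * Σ (map deviation (x ∷ zs ∷ʳ y)) + suc (suc m) ∎
    where
    open ≤-Reasoning
    S = Σ (map deviation zs)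
    len′ : length zs ≡ m
    len′ = suc-injective (trans (+-comm 1 (length zs)) (trans (sym (length-++ zs)) (suc-injective len)))
    x+m≤y : x ℤ.+ + suc m ℤ.≤ y
    x+m≤y = subst (λ l → x ℤ.+ + suc l ℤ.≤ y) len′ (gap x zs incr)
    eq₁ : ∀ m → suc (suc m) * (suc (suc m) * suc (suc m)) ≡ 3 * (2 * (suc m * suc m)) + m * (m * m) + 2
    eq₁ = solve-∀
    eq₂ : ∀ a b s m → 3 * (b + a) + (3 * s + m) + 2 ≡ 3 * (a + (s + (b + 0))) + suc (suc m)
    eq₂ = solve-∀

  spread : ∀ zs → Unique zs →
    length zs * (length zs * length zs) ≤ 3 * Σ (map deviation zs) + length zs
  spread zs zs! = subst (λ s → length zs * (length zs * length zs) ≤ 3 * s + length zs)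
    (sum-↭ (↭.map⁺ deviation (sort-↭ zs)))
    (spread-increasing (length zs) (sort zs) (↭.↭-length (sort-↭ zs)) increasing)
    where
    increasing : AllPairs ℤ._<_ (sort zs)
    increasing = AllPairs.zipWith (λ (x≤y , x≢y) → ℤ.≤∧≢⇒< x≤y x≢y)
      ( Sorted⇒AllPairs ℤ.≤-totalOrder (sort-↗ zs)
      , Unique-resp-↭ (setoid ℤ) (↭⇒↭ₛ (↭-sym (sort-↭ zs))) zs!)

-- Sign vectors

data Sign : Set where
  ○ ⊕ ⊖ : Sign

-- All sign vectors with p entries ⊕ and q entries ⊖.
signings : ∀ s → ℕ → ℕ → List (Vec Sign s)
signings zero    zero zero = [] ∷ []
signings zero    _    _    = []
signings (suc s) p    q    = map (○ ∷_) (signings s p q) ++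
  (shiftˡ [] (λ p q → map (⊕ ∷_) (signings s p q)) p q ++
   shiftʳ [] (λ p q → map (⊖ ∷_) (signings s p q)) p q)

module _ {a} {A : Set a} where

  Σ-map-+ : ∀ (f g : A → ℕ) xs → Σ (map (λ x → f x + g x) xs) ≡ Σ (map f xs) + Σ (map g xs)
  Σ-map-+ f g []       = refl
  Σ-map-+ f g (x ∷ xs) rewrite Σ-map-+ f g xs = eq (f x) (g x) (Σ (map f xs)) (Σ (map g xs))
    where
    eq : ∀ a b c d → a + b + (c + d) ≡ a + c + (b + d)
    eq = solve-∀

  Σ-map-* : ∀ c (f : A → ℕ) xs → Σ (map (λ x → c * f x) xs) ≡ c * Σ (map f xs)
  Σ-map-* c f []       = sym (*-zeroʳ c)
  Σ-map-* c f (x ∷ xs) rewrite Σ-map-* c f xs = sym (*-distribˡ-+ c (f x) (Σ (map f xs)))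

  length-Σ : ∀ (xs : List A) → length xs ≡ Σ (map (λ _ → 1) xs)
  length-Σ []       = refl
  length-Σ (x ∷ xs) = cong suc (length-Σ xs)

sumOver : ∀ {s} → (Vec Sign s → ℕ) → ℕ → ℕ → ℕ
sumOver φ p q = Σ (map φ (signings _ p q))

sumOver-suc : ∀ {s} (φ : Vec Sign (suc s) → ℕ) p q → sumOver φ p q ≡
  sumOver (φ ∘ (○ ∷_)) p q + (shiftˡ 0 (sumOver (φ ∘ (⊕ ∷_))) p q + shiftʳ 0 (sumOver (φ ∘ (⊖ ∷_))) p q)
sumOver-suc {s} φ p q = trans (Σ-map-++ (map (○ ∷_) (signings s p q)) _) (cong₂ _+_
  (cong Σ (sym (map-∘ (signings s p q))))
  (trans (Σ-map-++ (shiftˡ [] (λ p q → map (⊕ ∷_) (signings s p q)) p q) _) (cong₂ _+_ (leftˡ p q) (rightʳ p q))))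
  where
  Σ-map-++ : ∀ us vs → Σ (map φ (us ++ vs)) ≡ Σ (map φ us) + Σ (map φ vs)
  Σ-map-++ us vs = trans (cong Σ (map-++ φ us vs)) (sum-++ (map φ us) (map φ vs))
  leftˡ : ∀ p q → Σ (map φ (shiftˡ [] (λ p q → map (⊕ ∷_) (signings s p q)) p q)) ≡
    shiftˡ 0 (sumOver (φ ∘ (⊕ ∷_))) p q
  leftˡ zero    q = refl
  leftˡ (suc p) q = cong Σ (sym (map-∘ (signings s p q)))
  rightʳ : ∀ p q → Σ (map φ (shiftʳ [] (λ p q → map (⊖ ∷_) (signings s p q)) p q)) ≡
    shiftʳ 0 (sumOver (φ ∘ (⊖ ∷_))) p q
  rightʳ p zero    = refl
  rightʳ p (suc q) = cong Σ (sym (map-∘ (signings s p q)))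

-- The sum over all sign vectors of support k, kept graded by the number of `⊕`: `spread` applies to
-- the single grades, `second-moment` to the whole.
total : ∀ {s} → (Vec Sign s → ℕ) → ℕ → ℕ
total φ = Σ↘ (sumOver φ)

total-suc : ∀ {s} (φ : Vec Sign (suc s) → ℕ) k → total φ (suc k) ≡
  total (φ ∘ (○ ∷_)) (suc k) + (total (φ ∘ (⊕ ∷_)) k + total (φ ∘ (⊖ ∷_)) k)
total-suc φ k = begin-equality
  total φ (suc k)
    ≡⟨ Σ↘-cong (suc k) (λ p q _ → sumOver-suc φ p q) ⟩
  Σ↘ (λ p q → u p q + (shiftˡ 0 v p q + shiftʳ 0 w p q)) (suc k)
    ≡⟨ Σ↘-+ u (λ p q → shiftˡ 0 v p q + shiftʳ 0 w p q) (suc k) ⟩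
  Σ↘ u (suc k) + Σ↘ (λ p q → shiftˡ 0 v p q + shiftʳ 0 w p q) (suc k)
    ≡⟨ cong (λ t → Σ↘ u (suc k) + t) (trans (Σ↘-+ (shiftˡ 0 v) (shiftʳ 0 w) (suc k))
         (cong (λ t → Σ↘ v k + t) (Σ↘-shiftʳ w k))) ⟩
  Σ↘ u (suc k) + (Σ↘ v k + Σ↘ w k) ∎
  where
  open ≤-Reasoning
  u v w : ℕ → ℕ → ℕ
  u = sumOver (φ ∘ (○ ∷_))
  v = sumOver (φ ∘ (⊕ ∷_))
  w = sumOver (φ ∘ (⊖ ∷_))

module _ {s} (φ ψ : Vec Sign s → ℕ) where

  total-+ : ∀ k → total (λ c → φ c + ψ c) k ≡ total φ k + total ψ k
  total-+ k = trans (Σ↘-cong k λ p q _ → Σ-map-+ φ ψ (signings s p q)) (Σ↘-+ (sumOver φ) (sumOver ψ) k)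

  total-* : ∀ m k → total (λ c → m * φ c) k ≡ m * total φ k
  total-* m k = trans (Σ↘-cong k λ p q _ → Σ-map-* m φ (signings s p q)) (Σ↘-* m (sumOver φ) k)

  total-cong : ∀ k → (∀ c → φ c ≡ ψ c) → total φ k ≡ total ψ k
  total-cong k φ≡ψ = Σ↘-cong k λ p q _ → cong Σ (map-cong φ≡ψ (signings s p q))

count : ℕ → ℕ → ℕ → ℕ
count s = sumOver {s} (λ _ → 1)

count-≡ : ∀ s p q → count s p q ≡ (s C (p + q)) * ((p + q) C p)
count-≡ zero    zero    zero    = refl
count-≡ zero    zero    (suc q) = refl
count-≡ zero    (suc p) q       = refl
count-≡ (suc s) p       q       = trans (sumOver-suc {s} (λ _ → 1) p q) (step p q)
  where
  open ≤-Reasoning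
  step : ∀ p q → count s p q + (shiftˡ 0 (count s) p q + shiftʳ 0 (count s) p q) ≡ (suc s C (p + q)) * ((p + q) C p)
  step zero    zero    = trans (+-identityʳ (count s 0 0)) (count-≡ s 0 0)
  step zero    (suc q) = begin-equality
    count s 0 (suc q) + count s 0 q          ≡⟨ cong₂ _+_ (count-≡ s 0 (suc q)) (count-≡ s 0 q) ⟩
    (s C suc q) * 1 + (s C q) * 1            ≡⟨ *-distribʳ-+ 1 (s C suc q) (s C q) ⟨
    ((s C suc q) + (s C q)) * 1              ≡⟨ cong (_* 1) (trans (+-comm (s C suc q) (s C q)) (nCk+nC[k+1]≡[n+1]C[k+1] s q)) ⟩
    (suc s C suc q) * 1                      ∎
  step (suc p) zero    = begin-equality
    count s (suc p) 0 + (count s p 0 + 0)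
      ≡⟨ cong₂ _+_ (trans (count-≡ s (suc p) 0) (cong (λ m → (s C m) * (m C suc p)) (+-identityʳ (suc p))))
           (trans (+-identityʳ (count s p 0)) (trans (count-≡ s p 0) (cong (λ m → (s C m) * (m C p)) (+-identityʳ p)))) ⟩
    (s C suc p) * (suc p C suc p) + (s C p) * (p C p)
      ≡⟨ cong (λ m → (s C suc p) * (suc p C suc p) + (s C p) * m) (trans (nCn≡1 p) (sym (nCn≡1 (suc p)))) ⟩
    (s C suc p) * (suc p C suc p) + (s C p) * (suc p C suc p)
      ≡⟨ *-distribʳ-+ (suc p C suc p) (s C suc p) (s C p) ⟨
    ((s C suc p) + (s C p)) * (suc p C suc p)
      ≡⟨ cong (_* (suc p C suc p)) (trans (+-comm (s C suc p) (s C p)) (nCk+nC[k+1]≡[n+1]C[k+1] s p)) ⟩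
    (suc s C suc p) * (suc p C suc p)
      ≡⟨ cong (λ m → (suc s C m) * (m C suc p)) (+-identityʳ (suc p)) ⟨
    (suc s C (suc p + 0)) * ((suc p + 0) C suc p) ∎
  step (suc p) (suc q) = begin-equality
    count s (suc p) (suc q) + (count s p (suc q) + count s (suc p) q)
      ≡⟨ cong₂ _+_ (count-≡ s (suc p) (suc q)) (cong₂ _+_ (count-≡ s p (suc q))
           (trans (count-≡ s (suc p) q) (cong (λ m → (s C m) * (m C suc p)) (sym (+-suc p q))))) ⟩
    (s C suc m) * (suc m C suc p) + ((s C m) * (m C p) + (s C m) * (m C suc p))
      ≡⟨ cong (λ t → (s C suc m) * (suc m C suc p) + t) (trans (sym (*-distribˡ-+ (s C m) (m C p) (m C suc p)))
           (cong ((s C m) *_) (nCk+nC[k+1]≡[n+1]C[k+1] m p))) ⟩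
    (s C suc m) * (suc m C suc p) + (s C m) * (suc m C suc p)
      ≡⟨ *-distribʳ-+ (suc m C suc p) (s C suc m) (s C m) ⟨
    ((s C suc m) + (s C m)) * (suc m C suc p)
      ≡⟨ cong (_* (suc m C suc p)) (trans (+-comm (s C suc m) (s C m)) (nCk+nC[k+1]≡[n+1]C[k+1] s m)) ⟩
    (suc s C suc m) * (suc m C suc p) ∎
    where m = p + suc q

total-count : ∀ s k → total {s} (λ _ → 1) k ≡ (s C k) * 2 ^ k
total-count s k = trans (Σ↘-cong k λ { p q refl → count-≡ s p q })
  (trans (Σ↘-* (s C k) (λ p q → k C p) k) (cong ((s C k) *_) (Σ↘-C k)))

signings-Unique : ∀ s p q → Unique (signings s p q)
signings-Unique zero    zero    zero    = [] ∷ []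
signings-Unique zero    zero    (suc q) = []
signings-Unique zero    (suc p) q       = []
signings-Unique (suc s) p       q       = Unique.++⁺
  (Unique.map⁺ ∷-injectiveʳ (signings-Unique s p q))
  (Unique.++⁺ (left! p q) (right! p q) (λ (∈l , ∈r) → ⊕≢⊖ (trans (sym (left-head p q ∈l)) (right-head p q ∈r))))
  (λ (∈m , ∈lr) → let (_ , _ , eq) = ∈-map⁻ (○ ∷_) ∈m in
    [ (λ ∈l → ○≢⊕ (trans (sym (cong Vec.head eq)) (left-head p q ∈l)))
    , (λ ∈r → ○≢⊖ (trans (sym (cong Vec.head eq)) (right-head p q ∈r))) ]′
    (∈-++⁻ (left p q) ∈lr))
  where
  left right : ℕ → ℕ → List (Vec Sign (suc s))
  left  = shiftˡ [] (λ p q → map (⊕ ∷_) (signings s p q))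
  right = shiftʳ [] (λ p q → map (⊖ ∷_) (signings s p q))
  left! : ∀ p q → Unique (left p q)
  left! zero    q = []
  left! (suc p) q = Unique.map⁺ ∷-injectiveʳ (signings-Unique s p q)
  right! : ∀ p q → Unique (right p q)
  right! p zero    = []
  right! p (suc q) = Unique.map⁺ ∷-injectiveʳ (signings-Unique s p q)
  left-head : ∀ p q {c} → c ∈ left p q → Vec.head c ≡ ⊕
  left-head (suc p) q ∈l = let (_ , _ , eq) = ∈-map⁻ (⊕ ∷_) ∈l in cong Vec.head eq
  right-head : ∀ p q {c} → c ∈ right p q → Vec.head c ≡ ⊖
  right-head p (suc q) ∈r = let (_ , _ , eq) = ∈-map⁻ (⊖ ∷_) ∈r in cong Vec.head eq
  ⊕≢⊖ : ⊕ ≢ ⊖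
  ⊕≢⊖ ()
  ○≢⊕ : ○ ≢ ⊕
  ○≢⊕ ()
  ○≢⊖ : ○ ≢ ⊖
  ○≢⊖ ()

-- Signed sums of a B_k-sequence

module _ {a} {A : Set a} where

  signedSum : (A → ℤ) → (xs : List A) → Vec Sign (length xs) → ℤ
  signedSum f []       []      = + 0
  signedSum f (x ∷ xs) (○ ∷ c) = signedSum f xs c
  signedSum f (x ∷ xs) (⊕ ∷ c) = signedSum f xs c ℤ.+ f x
  signedSum f (x ∷ xs) (⊖ ∷ c) = signedSum f xs c ℤ.- f x

  pos neg : (xs : List A) → Vec Sign (length xs) → List A
  pos []       []      = []
  pos (x ∷ xs) (○ ∷ c) = pos xs c
  pos (x ∷ xs) (⊕ ∷ c) = x ∷ pos xs c
  pos (x ∷ xs) (⊖ ∷ c) = pos xs c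
  neg []       []      = []
  neg (x ∷ xs) (○ ∷ c) = neg xs c
  neg (x ∷ xs) (⊕ ∷ c) = neg xs c
  neg (x ∷ xs) (⊖ ∷ c) = x ∷ neg xs c

  signings-sizes : ∀ xs p q →
    All (λ c → length (pos xs c) ≡ p × length (neg xs c) ≡ q) (signings (length xs) p q)
  signings-sizes []       zero    zero    = (refl , refl) ∷ []
  signings-sizes []       zero    (suc q) = []
  signings-sizes []       (suc p) q       = []
  signings-sizes (x ∷ xs) p       q       = All.++⁺ (All.map⁺ (signings-sizes xs p q)) (All.++⁺ (left p q) (right p q))
    where
    Sizes : ℕ → ℕ → Vec Sign (suc (length xs)) → Set
    Sizes p q c = length (pos (x ∷ xs) c) ≡ p × length (neg (x ∷ xs) c) ≡ q
    left : ∀ p q → All (Sizes p q) (shiftˡ [] (λ p q → map (⊕ ∷_) (signings (length xs) p q)) p q)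
    left zero    q = []
    left (suc p) q = All.map⁺ (All.map (λ (eq₁ , eq₂) → cong suc eq₁ , eq₂) (signings-sizes xs p q))
    right : ∀ p q → All (Sizes p q) (shiftʳ [] (λ p q → map (⊖ ∷_) (signings (length xs) p q)) p q)
    right p zero    = []
    right p (suc q) = All.map⁺ (All.map (λ (eq₁ , eq₂) → eq₁ , cong suc eq₂) (signings-sizes xs p q))

  -- Flipping the sign of x pairs the vectors whose support contains x. In each pair the
  -- parallelogram law cancels the cross terms, so x adds at most n² to the mean square. A pair
  -- joins different p, hence the total over all p + q = k.
  second-moment : ∀ (f : A → ℤ) {n} xs k → All (λ x → ∣ f x ∣ ≤ n) xs →
    total (λ c → ∣ signedSum f xs c ∣²) k ≤ k * (n * n) * total {length xs} (λ _ → 1) k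
  second-moment f {n} [] k [] = begin
    total (λ c → ∣ signedSum f [] c ∣²) k  ≡⟨ total-cong (λ c → ∣ signedSum f [] c ∣²) (λ _ → 0 * 1) k (λ { [] → refl }) ⟩
    total {0} (λ _ → 0 * 1) k              ≡⟨ total-* {0} (λ _ → 1) (λ _ → 1) 0 k ⟩
    0                                      ≤⟨ z≤n ⟩
    k * (n * n) * total {0} (λ _ → 1) k    ∎
    where open ≤-Reasoning
  second-moment f {n} (x ∷ xs) zero (_ ∷ ∣f∣≤n) = subst (_≤ 0) (sym (sumOver-suc (λ c → ∣ signedSum f (x ∷ xs) c ∣²) 0 0))
    (subst (_≤ 0) (sym (+-identityʳ _)) (second-moment f xs 0 ∣f∣≤n))
  second-moment f {n} (x ∷ xs) (suc k) (∣fx∣≤n ∷ ∣f∣≤n) = begin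
    total (λ c → ∣ signedSum f (x ∷ xs) c ∣²) (suc k)
      ≡⟨ total-suc (λ c → ∣ signedSum f (x ∷ xs) c ∣²) k ⟩
    total S² (suc k) + (total (λ c → ∣ S c ℤ.+ f x ∣²) k + total (λ c → ∣ S c ℤ.- f x ∣²) k)
      ≡⟨ cong (λ t → total S² (suc k) + t) square ⟩
    total S² (suc k) + 2 * (∣ f x ∣² * N k + total S² k)
      ≤⟨ +-mono-≤ (second-moment f xs (suc k) ∣f∣≤n)
           (*-monoʳ-≤ 2 (+-mono-≤ (*-monoˡ-≤ (N k) (*-mono-≤ ∣fx∣≤n ∣fx∣≤n)) (second-moment f xs k ∣f∣≤n))) ⟩
    suc k * (n * n) * N (suc k) + 2 * (n * n * N k + k * (n * n) * N k)
      ≡⟨ eq k (n * n) (N (suc k)) (N k) ⟩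
    suc k * (n * n) * (N (suc k) + (N k + N k))
      ≡⟨ cong (suc k * (n * n) *_) (total-suc {length xs} (λ _ → 1) k) ⟨
    suc k * (n * n) * total {suc (length xs)} (λ _ → 1) (suc k) ∎
    where
    open ≤-Reasoning
    S : Vec Sign (length xs) → ℤ
    S = signedSum f xs
    S² : Vec Sign (length xs) → ℕ
    S² c = ∣ S c ∣²
    N : ℕ → ℕ
    N = total {length xs} (λ _ → 1)
    square : total (λ c → ∣ S c ℤ.+ f x ∣²) k + total (λ c → ∣ S c ℤ.- f x ∣²) k ≡
      2 * (∣ f x ∣² * N k + total S² k)
    square = begin-equality
      total (λ c → ∣ S c ℤ.+ f x ∣²) k + total (λ c → ∣ S c ℤ.- f x ∣²) k
        ≡⟨ total-+ (λ c → ∣ S c ℤ.+ f x ∣²) (λ c → ∣ S c ℤ.- f x ∣²) k ⟨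
      total (λ c → ∣ S c ℤ.+ f x ∣² + ∣ S c ℤ.- f x ∣²) k
        -- The constant is written as a multiple of 1 so that `total-*` turns its total into a
        -- multiple of the number `N k` of vectors.
        ≡⟨ total-cong _ (λ c → 2 * (∣ f x ∣² * 1 + S² c)) k
             (λ c → trans (parallelogram (S c) (f x)) (cong (λ t → 2 * (t + S² c)) (sym (*-identityʳ (∣ f x ∣²))))) ⟩
      total (λ c → 2 * (∣ f x ∣² * 1 + S² c)) k
        ≡⟨ total-* (λ c → ∣ f x ∣² * 1 + S² c) S² 2 k ⟩
      2 * total (λ c → ∣ f x ∣² * 1 + S² c) k
        ≡⟨ cong (2 *_) (trans (total-+ (λ _ → ∣ f x ∣² * 1) S² k)
             (cong (_+ total S² k) (total-* (λ _ → 1) S² ∣ f x ∣² k))) ⟩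
      2 * (∣ f x ∣² * N k + total S² k) ∎
    eq : ∀ k m a b → suc k * m * a + 2 * (m * b + k * m * b) ≡ suc k * m * (a + (b + b))
    eq = solve-∀

  ∈-pos : ∀ xs c {y} → y ∈ pos xs c → y ∈ xs
  ∈-pos []       []      ()
  ∈-pos (x ∷ xs) (○ ∷ c) y∈ = there (∈-pos xs c y∈)
  ∈-pos (x ∷ xs) (⊕ ∷ c) (here eq)  = here eq
  ∈-pos (x ∷ xs) (⊕ ∷ c) (there y∈) = there (∈-pos xs c y∈)
  ∈-pos (x ∷ xs) (⊖ ∷ c) y∈ = there (∈-pos xs c y∈)

  ∈-neg : ∀ xs c {y} → y ∈ neg xs c → y ∈ xs
  ∈-neg []       []      ()
  ∈-neg (x ∷ xs) (○ ∷ c) y∈ = there (∈-neg xs c y∈)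
  ∈-neg (x ∷ xs) (⊖ ∷ c) (here eq)  = here eq
  ∈-neg (x ∷ xs) (⊖ ∷ c) (there y∈) = there (∈-neg xs c y∈)
  ∈-neg (x ∷ xs) (⊕ ∷ c) y∈ = there (∈-neg xs c y∈)

  -- As x does not occur in xs, its multiplicity is [s = ⊕] + [t = ⊖] on the left and [t = ⊕] +
  -- [s = ⊖] on the right. These agree only for s = t; then x is cancelled and the tails are
  -- compared.
  signing-injective : ∀ xs → Unique xs → ∀ c d → pos xs c ++ neg xs d ↭ pos xs d ++ neg xs c → c ≡ d
  signing-injective []       _          []      []      _ = refl
  signing-injective (x ∷ xs) xs!@(_ ∷ tail!) (s ∷ c) (t ∷ d) = cases s t
    where
    fresh : ∀ c d → x ∉ pos xs c ++ neg xs d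
    fresh c d x∈ = Unique.Unique[x∷xs]⇒x∉xs xs!
      ([ ∈-pos xs c , ∈-neg xs d ]′ (∈-++⁻ (pos xs c) x∈))
    mid : ∀ ys {zs : List A} → x ∈ ys ++ x ∷ zs
    mid ys = ∈-++⁺ʳ ys (here refl)
    cases : ∀ s t → pos (x ∷ xs) (s ∷ c) ++ neg (x ∷ xs) (t ∷ d) ↭ pos (x ∷ xs) (t ∷ d) ++ neg (x ∷ xs) (s ∷ c) →
      s ∷ c ≡ t ∷ d
    cases ○ ○ p = cong (○ ∷_) (signing-injective xs tail! c d p)
    cases ⊕ ⊕ p = cong (⊕ ∷_) (signing-injective xs tail! c d (↭.drop-∷ p))
    cases ⊖ ⊖ p = cong (⊖ ∷_) (signing-injective xs tail! c d (↭.drop-mid (pos xs c) (pos xs d) p))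
    cases ⊕ ○ p = contradiction (↭.∈-resp-↭ p (here refl)) (fresh d c)
    cases ⊕ ⊖ p = contradiction (↭.∈-resp-↭ p (here refl)) (fresh d c)
    cases ○ ⊖ p = contradiction (↭.∈-resp-↭ p (mid (pos xs c))) (fresh d c)
    cases ○ ⊕ p = contradiction (↭.∈-resp-↭ (↭-sym p) (here refl)) (fresh c d)
    cases ⊖ ⊕ p = contradiction (↭.∈-resp-↭ (↭-sym p) (here refl)) (fresh c d)
    cases ⊖ ○ p = contradiction (↭.∈-resp-↭ (↭-sym p) (mid (pos xs d))) (fresh c d)

  Unique-map-local : ∀ {p} {P : A → Set p} {b} {B : Set b} {f : A → B} {xs} →
    (∀ {x y} → P x → P y → f x ≡ f y → x ≡ y) → All P xs → Unique xs → Unique (map f xs)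
  Unique-map-local inj []         []          = []
  Unique-map-local inj (px ∷ pxs) (x≢ ∷ xs!) =
    All.map⁺ (All.zipWith (λ (py , x≢y) fx≡fy → x≢y (inj px py fx≡fy)) (pxs , x≢)) ∷ Unique-map-local inj pxs xs!

-- Lists whose k-fold sums are distinct

module _ {a} {A : Set a} (val : A → ℕ) where

  DistinctSums : ℕ → List A → Set a
  DistinctSums k xs = ∀ us vs → length us ≡ k → length vs ≡ k → All (_∈ xs) us → All (_∈ xs) vs →
    Σ (map val us) ≡ Σ (map val vs) → us ↭ vs

  -- Both lists are padded with the same element x, which afterwards cancels from the permutation.
  DistinctSums-pred : ∀ {k x} xs → x ∈ xs → DistinctSums (suc k) xs → DistinctSums k xs
  DistinctSums-pred {x = x} xs x∈xs distinct us vs eq₁ eq₂ us⊆ vs⊆ Σ≡ =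
    ↭.drop-∷ (distinct (x ∷ us) (x ∷ vs) (cong suc eq₁) (cong suc eq₂) (x∈xs ∷ us⊆) (x∈xs ∷ vs⊆)
      (cong (λ t → val x + t) Σ≡))

  DistinctSums-≤ : ∀ {k x} j xs → x ∈ xs → DistinctSums (j + k) xs → DistinctSums k xs
  DistinctSums-≤ zero    xs x∈xs distinct = distinct
  DistinctSums-≤ (suc j) xs x∈xs distinct = DistinctSums-≤ j xs x∈xs (DistinctSums-pred xs x∈xs distinct)

  signedSum+neg : ∀ xs c → signedSum (+_ ∘ val) xs c ℤ.+ + Σ (map val (neg xs c)) ≡ + Σ (map val (pos xs c))
  signedSum+neg []       []      = refl
  signedSum+neg (x ∷ xs) (○ ∷ c) = signedSum+neg xs c
  signedSum+neg (x ∷ xs) (⊕ ∷ c) = trans (eq (signedSum (+_ ∘ val) xs c) (+ val x) (+ Σ (map val (neg xs c))))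
    (cong (λ t → + val x ℤ.+ t) (signedSum+neg xs c))
    where
    eq : ∀ s v m → s ℤ.+ v ℤ.+ m ≡ v ℤ.+ (s ℤ.+ m)
    eq = ℤ-Solver.solve-∀
  signedSum+neg (x ∷ xs) (⊖ ∷ c) = trans (eq (signedSum (+_ ∘ val) xs c) (+ val x) (+ Σ (map val (neg xs c))))
    (signedSum+neg xs c)
    where
    eq : ∀ s v m → s ℤ.- v ℤ.+ (v ℤ.+ m) ≡ s ℤ.+ m
    eq = ℤ-Solver.solve-∀

  -- The passage from x to 2x - n shifts 2z by (p - q) n, a constant on each grade. So the
  -- deviations of a grade from its own centre are the squares of signed sums of a single function
  -- common to all grades.
  signedSum-affine : ∀ (n : ℤ) xs c → signedSum (λ x → + 2 ℤ.* + val x ℤ.- n) xs c ≡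
    + 2 ℤ.* signedSum (+_ ∘ val) xs c ℤ.- (+ length (pos xs c) ℤ.- + length (neg xs c)) ℤ.* n
  signedSum-affine n []       []      = refl
  signedSum-affine n (x ∷ xs) (○ ∷ c) = signedSum-affine n xs c
  signedSum-affine n (x ∷ xs) (⊕ ∷ c) = trans (cong (λ t → t ℤ.+ (+ 2 ℤ.* + val x ℤ.- n)) (signedSum-affine n xs c))
    (eq n (signedSum (+_ ∘ val) xs c) (+ length (pos xs c)) (+ length (neg xs c)) (+ val x))
    where
    eq : ∀ n s p q v → + 2 ℤ.* s ℤ.- (p ℤ.- q) ℤ.* n ℤ.+ (+ 2 ℤ.* v ℤ.- n) ≡
      + 2 ℤ.* (s ℤ.+ v) ℤ.- (+ 1 ℤ.+ p ℤ.- q) ℤ.* n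
    eq = ℤ-Solver.solve-∀
  signedSum-affine n (x ∷ xs) (⊖ ∷ c) = trans (cong (λ t → t ℤ.- (+ 2 ℤ.* + val x ℤ.- n)) (signedSum-affine n xs c))
    (eq n (signedSum (+_ ∘ val) xs c) (+ length (pos xs c)) (+ length (neg xs c)) (+ val x))
    where
    eq : ∀ n s p q v → + 2 ℤ.* s ℤ.- (p ℤ.- q) ℤ.* n ℤ.- (+ 2 ℤ.* v ℤ.- n) ≡
      + 2 ℤ.* (s ℤ.- v) ℤ.- (p ℤ.- (+ 1 ℤ.+ q)) ℤ.* n
    eq = ℤ-Solver.solve-∀

  -- If c and d have equal signed sums, then pos c with neg d and pos d with neg c have equal
  -- ordinary sums. Both lists have p + q elements because p and q are the same for c and d.
  signedSum-Unique : ∀ xs → Unique xs → ∀ p q → DistinctSums (p + q) xs →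
    Unique (map (signedSum (+_ ∘ val) xs) (signings (length xs) p q))
  signedSum-Unique xs xs! p q distinct = Unique-map-local inj (signings-sizes xs p q) (signings-Unique (length xs) p q)
    where
    z : Vec Sign (length xs) → ℤ
    z = signedSum (+_ ∘ val) xs
    inj : ∀ {c d} → length (pos xs c) ≡ p × length (neg xs c) ≡ q → length (pos xs d) ≡ p × length (neg xs d) ≡ q →
      z c ≡ z d → c ≡ d
    inj {c} {d} (pc , qc) (pd , qd) zc≡zd = signing-injective xs xs! c d
      (distinct (pos xs c ++ neg xs d) (pos xs d ++ neg xs c)
        (trans (length-++ (pos xs c)) (cong₂ _+_ pc qd)) (trans (length-++ (pos xs d)) (cong₂ _+_ pd qc))
        (⊆xs c d) (⊆xs d c) (ℤ.+-injective (trans (sum-split c d) (trans swap (sym (sum-split d c))))))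
      where
      ⊆xs : ∀ c d → All (_∈ xs) (pos xs c ++ neg xs d)
      ⊆xs c d = All.++⁺ (All.tabulate (∈-pos xs c)) (All.tabulate (∈-neg xs d))
      N : Vec Sign (length xs) → ℤ
      N c = + Σ (map val (neg xs c))
      sum-split : ∀ c d → + Σ (map val (pos xs c ++ neg xs d)) ≡ z c ℤ.+ N c ℤ.+ N d
      sum-split c d = trans (cong +_ (trans (cong Σ (map-++ val (pos xs c) (neg xs d))) (sum-++ (map val (pos xs c)) _)))
        (cong (λ t → t ℤ.+ N d) (sym (signedSum+neg xs c)))
      swap : z c ℤ.+ N c ℤ.+ N d ≡ z d ℤ.+ N d ℤ.+ N c
      swap = trans (cong (λ t → t ℤ.+ N c ℤ.+ N d) zc≡zd) (eq (z d) (N c) (N d))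
        where
        eq : ∀ z a b → z ℤ.+ a ℤ.+ b ≡ z ℤ.+ b ℤ.+ a
        eq = ℤ-Solver.solve-∀

  -- `spread` is summed over the grades, of sizes M_p = c C(k,p): the cubes produce c³ `sum-C³ k`,
  -- and the deviations add up to the second moment. The common factor c stays, as c is 0 when k
  -- exceeds the length; `distinct-bound` treats that case before cancelling.
  cube-bound : ∀ xs k n → Unique xs → All (λ x → val x ≤ n) xs → DistinctSums k xs →
    let c = length xs C k in c * (c * c * sum-C³ k) ≤ c * (2 ^ k * (3 * (k * (n * n)) + 1))
  cube-bound xs k n xs! xs≤n distinct = begin
    c * (c * c * sum-C³ k)
      ≡⟨ eq₁ c (sum-C³ k) ⟩
    c * c * c * sum-C³ k
      ≡⟨ Σ↘-* (c * c * c) (λ p q → (k C p) * ((k C p) * (k C p))) k ⟨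
    Σ↘ (λ p q → c * c * c * ((k C p) * ((k C p) * (k C p)))) k
      ≤⟨ Σ↘-mono k cubes ⟩
    Σ↘ (λ p q → 3 * sumOver S² p q + count s p q) k
      ≡⟨ trans (Σ↘-+ (λ p q → 3 * sumOver S² p q) (count s) k) (cong (_+ total {s} (λ _ → 1) k) (Σ↘-* 3 (sumOver S²) k)) ⟩
    3 * total S² k + total {s} (λ _ → 1) k
      ≤⟨ +-monoˡ-≤ (total {s} (λ _ → 1) k) (*-monoʳ-≤ 3 (second-moment f xs k (All.map centred xs≤n))) ⟩
    3 * (k * (n * n) * total {s} (λ _ → 1) k) + total {s} (λ _ → 1) k
      ≡⟨ cong (λ t → 3 * (k * (n * n) * t) + t) (total-count s k) ⟩
    3 * (k * (n * n) * (c * 2 ^ k)) + c * 2 ^ k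
      ≡⟨ eq₂ c (2 ^ k) (k * (n * n)) ⟩
    c * (2 ^ k * (3 * (k * (n * n)) + 1)) ∎
    where
    open ≤-Reasoning
    s = length xs
    c = s C k
    f : A → ℤ
    f x = + 2 ℤ.* + val x ℤ.- + n
    S² : Vec Sign s → ℕ
    S² d = ∣ signedSum f xs d ∣²
    eq₁ : ∀ c t → c * (c * c * t) ≡ c * c * c * t
    eq₁ = solve-∀
    eq₂ : ∀ c t m → 3 * (m * (c * t)) + c * t ≡ c * (t * (3 * m + 1))
    eq₂ = solve-∀
    eq₃ : ∀ c b → c * c * c * (b * (b * b)) ≡ c * b * (c * b * (c * b))
    eq₃ = solve-∀
    centred : ∀ {x} → val x ≤ n → ∣ f x ∣ ≤ n
    centred {x} x≤n with m≤n⇒∃[o]m+o≡n x≤n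
    ... | d , refl = subst (λ z → ∣ z ∣ ≤ val x + d) (eq (+ val x) (+ d)) (ℤ.∣i-j∣≤∣i∣+∣j∣ (+ val x) (+ d))
      where
      eq : ∀ v d → v ℤ.- d ≡ + 2 ℤ.* v ℤ.- (v ℤ.+ d)
      eq = ℤ-Solver.solve-∀
    cubes : ∀ p q → p + q ≡ k →
      c * c * c * ((k C p) * ((k C p) * (k C p))) ≤ 3 * sumOver S² p q + count s p q
    cubes p q refl = begin
      c * c * c * (((p + q) C p) * (((p + q) C p) * ((p + q) C p)))
        ≡⟨ eq₃ c ((p + q) C p) ⟩
      c * ((p + q) C p) * (c * ((p + q) C p) * (c * ((p + q) C p)))
        ≡⟨ cong (λ m → m * (m * m)) len ⟨
      length zs * (length zs * length zs)
        ≤⟨ spread t zs (signedSum-Unique xs xs! p q distinct) ⟩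
      3 * Σ (map (deviation t) zs) + length zs
        ≡⟨ cong₂ (λ a b → 3 * a + b) deviations (trans len (sym (count-≡ s p q))) ⟩
      3 * sumOver S² p q + count s p q ∎
      where
      zs = map (signedSum (+_ ∘ val) xs) (signings s p q)
      t = (+ p ℤ.- + q) ℤ.* + n
      len : length zs ≡ c * ((p + q) C p)
      len = trans (length-map _ (signings s p q)) (trans (length-Σ (signings s p q)) (count-≡ s p q))
      deviations : Σ (map (deviation t) zs) ≡ sumOver S² p q
      deviations = cong Σ (trans (sym (map-∘ (signings s p q))) (map-cong-local (All.map
        (λ { {d} (refl , refl) → cong ∣_∣² (sym (signedSum-affine (+ n) xs d)) }) (signings-sizes xs p q))))

  distinct-bound : ∀ xs k n .{{_ : NonZero k}} .{{_ : NonZero n}} → Unique xs → All (λ x → val x ≤ n) xs →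
    (3 ≤ k → 2 ≤ n) → DistinctSums k xs → 2 * (2 ^ k * (length xs C k)) ≤ 13 * ((k + 1) / 2 * n)
  distinct-bound xs k n xs! xs≤n big distinct with length xs C k | cube-bound xs k n xs! xs≤n distinct
  ... | zero      | _     = ≤-trans (≤-reflexive (cong (2 *_) (*-zeroʳ (2 ^ k)))) z≤n
  ... | c@(suc _) | cubes = size-bound k n c big (*-cancelˡ-≤ c cubes)

-- Subsets of [0, n] as lists

elements : ∀ {m} → Subset m → List (Fin m)
elements []            = []
elements (inside  ∷ A) = zero ∷ map suc (elements A)
elements (outside ∷ A) = map suc (elements A)

length-elements : ∀ {m} (A : Subset m) → length (elements A) ≡ Subset.∣ A ∣
length-elements []            = refl
length-elements (inside  ∷ A) = cong suc (trans (length-map suc (elements A)) (length-elements A))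
length-elements (outside ∷ A) = trans (length-map suc (elements A)) (length-elements A)

elements-Unique : ∀ {m} (A : Subset m) → Unique (elements A)
elements-Unique []            = []
elements-Unique (inside  ∷ A) = All.map⁺ (All.tabulate λ _ ()) ∷ Unique.map⁺ Fin.suc-injective (elements-Unique A)
elements-Unique (outside ∷ A) = Unique.map⁺ Fin.suc-injective (elements-Unique A)

elements-∈ : ∀ {m} (A : Subset m) → All (Subset._∈ A) (elements A)
elements-∈ []            = []
elements-∈ (inside  ∷ A) = here ∷ All.map⁺ (All.map there (elements-∈ A))
elements-∈ (outside ∷ A) = All.map⁺ (All.map there (elements-∈ A))

IsB⇒DistinctSums : ∀ {m k} (A : Subset m) → IsB k A → DistinctSums toℕ k (elements A)
IsB⇒DistinctSums {m} {k} A isB us vs us-len vs-len us⊆ vs⊆ Σ≡ with asVec us us-len | asVec vs vs-len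
  where
  asVec : ∀ ws → length ws ≡ k → ∃[ w ] toList {A = Fin m} {n = k} w ≡ ws
  asVec ws refl = fromList ws , toList∘fromList ws
... | u , refl | v , refl = isB u v (⊆A us⊆) (⊆A vs⊆) (trans (sum-toList u) (trans Σ≡ (sym (sum-toList v))))
  where
  ⊆A : ∀ {w : Vec (Fin m) k} → All (_∈ elements A) (toList w) → VecAll.All (Subset._∈ A) w
  ⊆A w⊆ = VecAll.toList⁻ (All.map (All.lookup (elements-∈ A)) w⊆)
  sum-toList : ∀ {k} (w : Vec (Fin m) k) → Vec.sum (Vec.map toℕ w) ≡ Σ (map toℕ (toList w))
  sum-toList []      = refl
  sum-toList (x ∷ w) = cong (λ t → toℕ x + t) (sum-toList w)

module _ {k n : ℕ} (A : Subset (suc n)) .{{_ : NonZero k}} .{{_ : NonZero n}} (isB : IsB k A) where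

  -- Meant for j = k when k ≤ |A| and for j = |A| otherwise. The empty set leads to j = 0, where the
  -- claim follows from 2 ≤ 13. For j > 0 there is an element available for padding, so distinct
  -- k-fold sums give distinct j-fold sums.
  isB-bound : ∀ j → j ≤ k → j ≤ Subset.∣ A ∣ → 2 * (2 ^ j * (Subset.∣ A ∣ C j)) ≤ 13 * ((k + 1) / 2 * n)
  isB-bound zero _ _ = ≤-trans (≤ᵇ⇒≤ 2 13 _) (*-monoʳ-≤ 13 {1} (*-mono-≤
    (m≥n⇒m/n>0 (+-monoˡ-≤ 1 (n≢0⇒n>0 (≢-nonZero⁻¹ k)))) (n≢0⇒n>0 (≢-nonZero⁻¹ n))))
  isB-bound j@(suc _) j≤k j≤∣A∣ = begin
    2 * (2 ^ j * (Subset.∣ A ∣ C j))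
      ≡⟨ cong (λ s → 2 * (2 ^ j * (s C j))) (length-elements A) ⟨
    2 * (2 ^ j * (length (elements A) C j))
      ≤⟨ distinct-bound toℕ (elements A) j n (elements-Unique A) (All.tabulate λ {x} _ → Fin.toℕ≤pred[n] x) big
           (distinct (elements A) (subst (j ≤_) (sym (length-elements A)) j≤∣A∣) (IsB⇒DistinctSums A isB)) ⟩
    13 * ((j + 1) / 2 * n)
      ≤⟨ *-monoʳ-≤ 13 (*-monoˡ-≤ n (/-monoˡ-≤ 2 (+-monoˡ-≤ 1 j≤k))) ⟩
    13 * ((k + 1) / 2 * n) ∎
    where
    open ≤-Reasoning
    -- At least j of the n + 1 elements of [0, n] belong to A.
    big : 3 ≤ j → 2 ≤ n
    big 3≤j = s≤s⁻¹ (≤-trans 3≤j (≤-trans j≤∣A∣ (Subset.∣p∣≤n A)))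
    distinct : ∀ xs → j ≤ length xs → DistinctSums toℕ k xs → DistinctSums toℕ j xs
    distinct (x ∷ xs) _ d = DistinctSums-≤ toℕ (k ∸ j) (x ∷ xs) (here refl)
      (subst (λ i → DistinctSums toℕ i (x ∷ xs)) (sym (m∸n+n≡m j≤k)) d)

-- Rational arithmetic

open RationalLemmas using (0≤*; p≤p+q; p<p+q; 0≤^; 0<^; ^-mono; /-mono; 0≤/; /-+; archimedean)
  renaming (*-mono-≤ to ℚ-*-mono-≤)

ℚ-ring : AlmostCommutativeRing 0ℓ 0ℓ
ℚ-ring = fromCommutativeRing ℚ.+-*-commutativeRing λ p → dec⇒maybe (0ℚ ℚ.≟ p)

ι : ℕ → ℚ
ι n = + n ℚ./ 1

0≤ι : ∀ n → 0ℚ ℚ.≤ ι n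
0≤ι n = 0≤/ n 1

ι-mono : ∀ {m n} → m ≤ n → ι m ℚ.≤ ι n
ι-mono {m} {n} m≤n = /-mono m 1 n 1 (*-monoˡ-≤ 1 m≤n)

ι-+ : ∀ m n → ι (m + n) ≡ ι m ℚ.+ ι n
ι-+ m n = sym (/-+ m n 1)

ι-suc : ∀ n → ι (suc n) ≡ 1ℚ ℚ.+ ι n
ι-suc = ι-+ 1

ι*1/ : ∀ a b .{{_ : NonZero b}} → ι a ℚ.* (+ 1 ℚ./ b) ≡ + a ℚ./ b
ι*1/ zero    b = trans (ℚ.*-zeroˡ (+ 1 ℚ./ b)) (sym (ℚ.0/n≡0 b))
ι*1/ (suc a) b = trans (cong (ℚ._* (+ 1 ℚ./ b)) (ι-suc a)) (trans (ℚ.*-distribʳ-+ (+ 1 ℚ./ b) 1ℚ (ι a))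
  (trans (cong₂ ℚ._+_ (ℚ.*-identityˡ (+ 1 ℚ./ b)) (ι*1/ a b)) (/-+ 1 a b)))

ι-* : ∀ m n → ι (m * n) ≡ ι m ℚ.* ι n
ι-* zero    n = sym (ℚ.*-zeroˡ (ι n))
ι-* (suc m) n = trans (ι-+ n (m * n)) (trans (cong (λ t → ι n ℚ.+ t) (ι-* m n))
  (sym (trans (cong (ℚ._* ι n) (ι-suc m)) (eq (ι m) (ι n)))))
  where
  eq : ∀ m n → (1ℚ ℚ.+ m) ℚ.* n ≡ n ℚ.+ m ℚ.* n
  eq = Ring.solve-∀ ℚ-ring

^ℚ-* : ∀ p q k → (p ℚ.* q) ^ℚ k ≡ (p ^ℚ k) ℚ.* (q ^ℚ k)
^ℚ-* p q zero    = refl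
^ℚ-* p q (suc k) = trans (cong (λ t → p ℚ.* q ℚ.* t) (^ℚ-* p q k))
  (eq p q (p ^ℚ k) (q ^ℚ k))
  where
  eq : ∀ p q r s → p ℚ.* q ℚ.* (r ℚ.* s) ≡ p ℚ.* r ℚ.* (q ℚ.* s)
  eq = Ring.solve-∀ ℚ-ring

1^ : ∀ k → 1ℚ ^ℚ k ≡ 1ℚ
1^ zero    = refl
1^ (suc k) = trans (ℚ.*-identityˡ (1ℚ ^ℚ k)) (1^ k)

p≤q⇒0≤q-p : ∀ {p q} → p ℚ.≤ q → 0ℚ ℚ.≤ q ℚ.- p
p≤q⇒0≤q-p {p} {q} p≤q = subst (ℚ._≤ q ℚ.- p) (ℚ.+-inverseʳ p) (ℚ.+-monoˡ-≤ (ℚ.- p) p≤q)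

*-monoˡ-0≤ : ∀ {r p q} → 0ℚ ℚ.≤ r → p ℚ.≤ q → r ℚ.* p ℚ.≤ r ℚ.* q
*-monoˡ-0≤ {r} 0≤r = ℚ.*-monoˡ-≤-nonNeg r {{ℚ.nonNegative 0≤r}}

*-cancelˡ-0< : ∀ {r p q} → 0ℚ ℚ.< r → r ℚ.* p ℚ.≤ r ℚ.* q → p ℚ.≤ q
*-cancelˡ-0< {r} 0<r = ℚ.*-cancelˡ-≤-pos r {{ℚ.positive 0<r}}

0≤+ : ∀ {p q} → 0ℚ ℚ.≤ p → 0ℚ ℚ.≤ q → 0ℚ ℚ.≤ p ℚ.+ q
0≤+ 0≤p 0≤q = ℚ.≤-trans 0≤p (p≤p+q 0≤q)

-- The first two terms of the binomial expansion. The homogeneous form needs no division by y, so y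
-- = 0 is included.
bernoulli : ∀ {y x} → 0ℚ ℚ.≤ y → 0ℚ ℚ.≤ x → ∀ j →
  (y ^ℚ suc j) ℚ.+ ι (suc j) ℚ.* (x ℚ.* (y ^ℚ j)) ℚ.≤ (y ℚ.+ x) ^ℚ suc j
bernoulli {y} {x} 0≤y 0≤x zero = ℚ.≤-reflexive (eq₁ y x)
  where
  eq₁ : ∀ y x → y ℚ.* 1ℚ ℚ.+ 1ℚ ℚ.* (x ℚ.* 1ℚ) ≡ (y ℚ.+ x) ℚ.* 1ℚ
  eq₁ = Ring.solve-∀ ℚ-ring
bernoulli {y} {x} 0≤y 0≤x (suc j) = begin
  y ℚ.* (y ℚ.* t) ℚ.+ ι (suc (suc j)) ℚ.* (x ℚ.* (y ℚ.* t))
    ≡⟨ cong (λ i → y ℚ.* (y ℚ.* t) ℚ.+ i ℚ.* (x ℚ.* (y ℚ.* t))) (ι-suc (suc j)) ⟩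
  y ℚ.* (y ℚ.* t) ℚ.+ (1ℚ ℚ.+ i) ℚ.* (x ℚ.* (y ℚ.* t))
    ≤⟨ p≤p+q (0≤* (0≤ι (suc j)) (0≤* (0≤* 0≤x 0≤x) (0≤^ 0≤y j))) ⟩
  y ℚ.* (y ℚ.* t) ℚ.+ (1ℚ ℚ.+ i) ℚ.* (x ℚ.* (y ℚ.* t)) ℚ.+ i ℚ.* (x ℚ.* x ℚ.* t)
    ≡⟨ eq₂ y x t i ⟩
  (y ℚ.+ x) ℚ.* (y ℚ.* t ℚ.+ i ℚ.* (x ℚ.* t))
    ≤⟨ *-monoˡ-0≤ (0≤+ 0≤y 0≤x) (bernoulli 0≤y 0≤x j) ⟩
  (y ℚ.+ x) ^ℚ suc (suc j) ∎
  where
  open ℚ.≤-Reasoning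
  eq₂ : ∀ y x t i → y ℚ.* (y ℚ.* t) ℚ.+ (1ℚ ℚ.+ i) ℚ.* (x ℚ.* (y ℚ.* t)) ℚ.+ i ℚ.* (x ℚ.* x ℚ.* t) ≡
    (y ℚ.+ x) ℚ.* (y ℚ.* t ℚ.+ i ℚ.* (x ℚ.* t))
  eq₂ = Ring.solve-∀ ℚ-ring
  t = y ^ℚ j
  i = ι (suc j)

-- Partial sums of the exponential series

sum-mono : ∀ {f g : ℕ → ℚ} → (∀ i → f i ℚ.≤ g i) → ∀ n → sum f n ℚ.≤ sum g n
sum-mono f≤g zero    = ℚ.≤-refl
sum-mono f≤g (suc n) = ℚ.+-mono-≤ (f≤g 0) (sum-mono (f≤g ∘ suc) n)

sum-≤-length : ∀ {f} → (∀ i → 0ℚ ℚ.≤ f i) → ∀ {m n} → m ≤ n → sum f m ℚ.≤ sum f n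
sum-≤-length {f} 0≤f {n = n} z≤n = SeriesLemmas.sum-nonneg f 0≤f n
sum-≤-length {f} 0≤f (s≤s m≤n)   = ℚ.+-monoʳ-≤ (f 0) (sum-≤-length (0≤f ∘ suc) m≤n)

sum-+* : ∀ (f g : ℕ → ℚ) x n → sum (λ i → f i ℚ.+ x ℚ.* g i) n ≡ sum f n ℚ.+ x ℚ.* sum g n
sum-+* f g x zero    = eq₁ x
  where
  eq₁ : ∀ x → 0ℚ ≡ 0ℚ ℚ.+ x ℚ.* 0ℚ
  eq₁ = Ring.solve-∀ ℚ-ring
sum-+* f g x (suc n) = trans (cong (λ t → f 0 ℚ.+ x ℚ.* g 0 ℚ.+ t) (sum-+* (f ∘ suc) (g ∘ suc) x n))
  (eq₂ (f 0) (g 0) x (sum (f ∘ suc) n) (sum (g ∘ suc) n))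
  where
  eq₂ : ∀ a b x s t → a ℚ.+ x ℚ.* b ℚ.+ (s ℚ.+ x ℚ.* t) ≡ (a ℚ.+ s) ℚ.+ x ℚ.* (b ℚ.+ t)
  eq₂ = Ring.solve-∀ ℚ-ring

[1+j]/[1+j]! : ∀ j → 1/ j ! ≡ ι (suc j) ℚ.* 1/ suc j !
[1+j]/[1+j]! j = trans (ℚ.≤-antisym
  (/-mono 1 (j !) (suc j) (suc j !) {{j !≢0}} {{suc j !≢0}} (≤-reflexive eq))
  (/-mono (suc j) (suc j !) 1 (j !) {{suc j !≢0}} {{j !≢0}} (≤-reflexive (sym eq))))
  (sym (ι*1/ (suc j) (suc j !) {{suc j !≢0}}))
  where
  eq : 1 * suc j ! ≡ suc j * j !
  eq = *-identityˡ (suc j !)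

expTerm : ℚ → ℕ → ℚ
expTerm y j = (y ^ℚ j) ℚ.* 1/ j !

0≤expTerm : ∀ {y} → 0ℚ ℚ.≤ y → ∀ j → 0ℚ ℚ.≤ expTerm y j
0≤expTerm 0≤y j = 0≤* (0≤^ 0≤y j) (ExpSeries.0≤1/! j)

-- `bernoulli` divided by (j + 1)!. Thus exp (y + x) ≥ (1 + x) exp y is visible term by term, which
-- makes it usable for partial sums.
expTerm-step : ∀ {y x} → 0ℚ ℚ.≤ y → 0ℚ ℚ.≤ x → ∀ j →
  expTerm y (suc j) ℚ.+ x ℚ.* expTerm y j ℚ.≤ expTerm (y ℚ.+ x) (suc j)
expTerm-step {y} {x} 0≤y 0≤x j = begin
  (y ^ℚ suc j) ℚ.* f ℚ.+ x ℚ.* ((y ^ℚ j) ℚ.* 1/ j !)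
    ≡⟨ cong (λ t → (y ^ℚ suc j) ℚ.* f ℚ.+ x ℚ.* ((y ^ℚ j) ℚ.* t)) ([1+j]/[1+j]! j) ⟩
  (y ^ℚ suc j) ℚ.* f ℚ.+ x ℚ.* ((y ^ℚ j) ℚ.* (ι (suc j) ℚ.* f))
    ≡⟨ eq (y ^ℚ suc j) (y ^ℚ j) (ι (suc j)) x f ⟩
  f ℚ.* ((y ^ℚ suc j) ℚ.+ ι (suc j) ℚ.* (x ℚ.* (y ^ℚ j)))
    ≤⟨ *-monoˡ-0≤ (ExpSeries.0≤1/! (suc j)) (bernoulli 0≤y 0≤x j) ⟩
  f ℚ.* ((y ℚ.+ x) ^ℚ suc j)
    ≡⟨ ℚ.*-comm f _ ⟩
  ((y ℚ.+ x) ^ℚ suc j) ℚ.* f ∎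
  where
  open ℚ.≤-Reasoning
  eq : ∀ s t i x f → s ℚ.* f ℚ.+ x ℚ.* (t ℚ.* (i ℚ.* f)) ≡ f ℚ.* (s ℚ.+ i ℚ.* (x ℚ.* t))
  eq = Ring.solve-∀ ℚ-ring
  f = 1/ suc j !

-- Each further factor 1 + x moves the argument from k x to (k + 1) x, by `expTerm-step`, and costs
-- one more term of the series.
[1+x]^k≤exp : ∀ {x} → 0ℚ ℚ.≤ x → ∀ k → (1ℚ ℚ.+ x) ^ℚ k ℚ.≤ sum (expTerm (ι k ℚ.* x)) (suc k)
[1+x]^k≤exp {x} 0≤x zero    = ℚ.≤-refl
[1+x]^k≤exp {x} 0≤x (suc k) = begin
  (1ℚ ℚ.+ x) ℚ.* ((1ℚ ℚ.+ x) ^ℚ k)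
    ≤⟨ *-monoˡ-0≤ (0≤+ (ℚ.nonNegative⁻¹ 1ℚ) 0≤x) ([1+x]^k≤exp 0≤x k) ⟩
  (1ℚ ℚ.+ x) ℚ.* T (suc k)
    ≡⟨ eq₁ x (T (suc k)) ⟩
  T (suc k) ℚ.+ x ℚ.* T (suc k)
    ≤⟨ ℚ.+-monoˡ-≤ (x ℚ.* T (suc k)) (sum-≤-length (0≤expTerm 0≤y) (n≤1+n (suc k))) ⟩
  T (suc (suc k)) ℚ.+ x ℚ.* T (suc k)
    ≡⟨ ℚ.+-assoc 1ℚ (sum (expTerm y ∘ suc) (suc k)) (x ℚ.* T (suc k)) ⟩
  1ℚ ℚ.+ (sum (expTerm y ∘ suc) (suc k) ℚ.+ x ℚ.* T (suc k))
    ≡⟨ cong (λ t → 1ℚ ℚ.+ t) (sum-+* (expTerm y ∘ suc) (expTerm y) x (suc k)) ⟨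
  1ℚ ℚ.+ sum (λ j → expTerm y (suc j) ℚ.+ x ℚ.* expTerm y j) (suc k)
    ≤⟨ ℚ.+-monoʳ-≤ 1ℚ (sum-mono (expTerm-step 0≤y 0≤x) (suc k)) ⟩
  sum (expTerm (y ℚ.+ x)) (suc (suc k))
    ≡⟨ cong (λ z → sum (expTerm z) (suc (suc k))) (trans
         (eq₂ (ι k) x) (cong (ℚ._* x) (sym (ι-suc k)))) ⟩
  sum (expTerm (ι (suc k) ℚ.* x)) (suc (suc k)) ∎
  where
  open ℚ.≤-Reasoning
  eq₂ : ∀ i x → i ℚ.* x ℚ.+ x ≡ (1ℚ ℚ.+ i) ℚ.* x
  eq₂ = Ring.solve-∀ ℚ-ring
  eq₁ : ∀ x t → (1ℚ ℚ.+ x) ℚ.* t ≡ t ℚ.+ x ℚ.* t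
  eq₁ = Ring.solve-∀ ℚ-ring
  y = ι k ℚ.* x
  0≤y : 0ℚ ℚ.≤ y
  0≤y = 0≤* (0≤ι k) 0≤x
  T = sum (expTerm y)

sum-cong : ∀ {f g : ℕ → ℚ} → (∀ i → f i ≡ g i) → ∀ n → sum f n ≡ sum g n
sum-cong f≡g zero    = refl
sum-cong f≡g (suc n) = cong₂ ℚ._+_ (f≡g 0) (sum-cong (f≡g ∘ suc) n)

n*1/n : ∀ n .{{_ : NonZero n}} → ι n ℚ.* (+ 1 ℚ./ n) ≡ 1ℚ
n*1/n n = trans (ι*1/ n n) (ℚ.≤-antisym
  (/-mono n n 1 1 (≤-reflexive (*-comm n 1))) (/-mono 1 1 n n (≤-reflexive (*-comm 1 n))))

-- The case x = 1/k, where k x = 1: the terms up to 1/k! already dominate (1 + 1/k)^k, so a rational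
-- approximation of e suffices from stage k on.
[1+k]^k≤e*k^k : ∀ k .{{_ : NonZero k}} {N} → k ≤ N → ι (suc k) ^ℚ k ℚ.≤ seq e N ℚ.* (ι k ^ℚ k)
[1+k]^k≤e*k^k k {N} k≤N = begin
  ι (suc k) ^ℚ k                  ≡⟨ cong (_^ℚ k) (trans (ι-suc k) (trans
                                       (cong (ℚ._+ ι k) (sym k*1/k)) (eq (ι k) x))) ⟩
  ((1ℚ ℚ.+ x) ℚ.* ι k) ^ℚ k       ≡⟨ ^ℚ-* (1ℚ ℚ.+ x) (ι k) k ⟩
  ((1ℚ ℚ.+ x) ^ℚ k) ℚ.* (ι k ^ℚ k) ≤⟨ ℚ.*-monoʳ-≤-nonNeg (ι k ^ℚ k) {{ℚ.nonNegative (0≤^ (0≤ι k) k)}} (begin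
    (1ℚ ℚ.+ x) ^ℚ k                        ≤⟨ [1+x]^k≤exp (0≤/ 1 k) k ⟩
    sum (expTerm (ι k ℚ.* x)) (suc k) ≡⟨ sum-cong (λ j → trans (cong (λ y → (y ^ℚ j) ℚ.* 1/ j !) k*1/k)
                                                (trans (cong (ℚ._* 1/ j !) (1^ j)) (ℚ.*-identityˡ (1/ j !)))) (suc k) ⟩
    sum 1/_! (suc k)                  ≤⟨ sum-≤-length ExpSeries.0≤1/! (s≤s k≤N) ⟩
    seq e N                                ∎) ⟩
  seq e N ℚ.* (ι k ^ℚ k)          ∎
  where
  open ℚ.≤-Reasoning
  eq : ∀ i x → i ℚ.* x ℚ.+ i ≡ (1ℚ ℚ.+ x) ℚ.* i
  eq = Ring.solve-∀ ℚ-ring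
  x = + 1 ℚ./ k
  k*1/k : ι k ℚ.* x ≡ 1ℚ
  k*1/k = n*1/n k

-- The shifted geometric mean inequality

-- (1 + y)^j ≤ 1 + (y / x) ((1 + x)^j - 1) for 0 ≤ y ≤ x, where y = 1/w and x = 1/v, with the denominators cleared.
power-convex : ∀ {v w} → 0ℚ ℚ.≤ v → v ℚ.≤ w → ∀ j →
  ((w ℚ.+ 1ℚ) ^ℚ j) ℚ.* (w ℚ.* (v ^ℚ j)) ℚ.+ (w ^ℚ j) ℚ.* (v ℚ.* (v ^ℚ j)) ℚ.≤
  (w ^ℚ j) ℚ.* (w ℚ.* (v ^ℚ j)) ℚ.+ (w ^ℚ j) ℚ.* (v ℚ.* ((v ℚ.+ 1ℚ) ^ℚ j))
power-convex 0≤v v≤w zero = ℚ.≤-refl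
power-convex {v} {w} 0≤v v≤w (suc j) = begin
  (w ℚ.+ 1ℚ) ℚ.* A ℚ.* (w ℚ.* (v ℚ.* b)) ℚ.+ w ℚ.* a ℚ.* (v ℚ.* (v ℚ.* b))
    ≡⟨ eq₁ v w A a b ⟩
  (w ℚ.+ 1ℚ) ℚ.* v ℚ.* (A ℚ.* (w ℚ.* b) ℚ.+ a ℚ.* (v ℚ.* b)) ℚ.- m
    ≤⟨ ℚ.+-monoˡ-≤ (ℚ.- m) (*-monoˡ-0≤ (0≤* (0≤+ 0≤w (ℚ.nonNegative⁻¹ 1ℚ)) 0≤v) (power-convex 0≤v v≤w j)) ⟩
  (w ℚ.+ 1ℚ) ℚ.* v ℚ.* (a ℚ.* (w ℚ.* b) ℚ.+ a ℚ.* (v ℚ.* B)) ℚ.- m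
    ≤⟨ p≤p+q (0≤* (0≤* (0≤* (0≤^ 0≤w j) 0≤v) (p≤q⇒0≤q-p v≤w))
         (p≤q⇒0≤q-p (^-mono 0≤v (p≤p+q (ℚ.nonNegative⁻¹ 1ℚ)) j))) ⟩
  (w ℚ.+ 1ℚ) ℚ.* v ℚ.* (a ℚ.* (w ℚ.* b) ℚ.+ a ℚ.* (v ℚ.* B)) ℚ.- m ℚ.+ a ℚ.* v ℚ.* (w ℚ.- v) ℚ.* (B ℚ.- b)
    ≡⟨ eq₂ v w a b B ⟩
  w ℚ.* a ℚ.* (w ℚ.* (v ℚ.* b)) ℚ.+ w ℚ.* a ℚ.* (v ℚ.* ((v ℚ.+ 1ℚ) ℚ.* B)) ∎
  where
  open ℚ.≤-Reasoning
  A = (w ℚ.+ 1ℚ) ^ℚ j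
  a = w ^ℚ j
  b = v ^ℚ j
  B = (v ℚ.+ 1ℚ) ^ℚ j
  m = a ℚ.* v ℚ.* v ℚ.* b
  0≤w : 0ℚ ℚ.≤ w
  0≤w = ℚ.≤-trans 0≤v v≤w
  eq₁ : ∀ v w A a b → (w ℚ.+ 1ℚ) ℚ.* A ℚ.* (w ℚ.* (v ℚ.* b)) ℚ.+ w ℚ.* a ℚ.* (v ℚ.* (v ℚ.* b)) ≡
    (w ℚ.+ 1ℚ) ℚ.* v ℚ.* (A ℚ.* (w ℚ.* b) ℚ.+ a ℚ.* (v ℚ.* b)) ℚ.- a ℚ.* v ℚ.* v ℚ.* b
  eq₁ = Ring.solve-∀ ℚ-ring
  eq₂ : ∀ v w a b B → (w ℚ.+ 1ℚ) ℚ.* v ℚ.* (a ℚ.* (w ℚ.* b) ℚ.+ a ℚ.* (v ℚ.* B)) ℚ.- a ℚ.* v ℚ.* v ℚ.* b ℚ.+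
    a ℚ.* v ℚ.* (w ℚ.- v) ℚ.* (B ℚ.- b) ≡
    w ℚ.* a ℚ.* (w ℚ.* (v ℚ.* b)) ℚ.+ w ℚ.* a ℚ.* (v ℚ.* ((v ℚ.+ 1ℚ) ℚ.* B))
  eq₂ = Ring.solve-∀ ℚ-ring

-- (t + 1) (t + 2) ⋯ (t + k)
rising : ℕ → ℕ → ℕ
rising t zero    = 1
rising t (suc k) = (t + suc k) * rising t k

rising-! : ∀ t k → rising t k * t ! ≡ (k + t) !
rising-! t zero    = *-identityˡ (t !)
rising-! t (suc k) = trans (*-assoc (t + suc k) (rising t k) (t !))
  (cong₂ _*_ (+-comm t (suc k)) (rising-! t k))

rising-C : ∀ t k → rising t k ≡ k ! * ((k + t) C k)
rising-C t k = *-cancelʳ-≡ _ _ (t !) {{t !≢0}} (trans (rising-! t k) (trans (sym (C-! k t)) (eq ((k + t) C k) (k !) (t !))))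
  where
  eq : ∀ c a b → c * (a * b) ≡ a * c * b
  eq = solve-∀

-- For x = t E, v = k and w = x + v, the letters a, b, A, B stand for the k-th powers of w, v, w +
-- 1, v + 1. Convexity and B ≤ E b give A / a ≤ 1 + (v / w) (E - 1). Multiplied by w + 1, this falls
-- short of x + v E + E by (E - 1) x / w, the term added before the last step.
rising-step : ∀ {E v x a b B A} → 1ℚ ℚ.≤ E → 0ℚ ℚ.< v → 0ℚ ℚ.≤ x → 0ℚ ℚ.≤ a → 0ℚ ℚ.< b → B ℚ.≤ E ℚ.* b →
  A ℚ.* ((x ℚ.+ v) ℚ.* b) ℚ.+ a ℚ.* (v ℚ.* b) ℚ.≤ a ℚ.* ((x ℚ.+ v) ℚ.* b) ℚ.+ a ℚ.* (v ℚ.* B) →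
  (x ℚ.+ v ℚ.+ 1ℚ) ℚ.* A ℚ.≤ a ℚ.* (x ℚ.+ v ℚ.* E ℚ.+ E)
rising-step {E} {v} {x} {a} {b} {B} {A} 1≤E 0<v 0≤x 0≤a 0<b B≤Eb convex = *-cancelˡ-0< {x ℚ.+ v} 0<w (*-cancelˡ-0< 0<b (begin
  b ℚ.* ((x ℚ.+ v) ℚ.* ((x ℚ.+ v ℚ.+ 1ℚ) ℚ.* A))
    ≡⟨ eq₁ v x a b A ⟩
  (x ℚ.+ v ℚ.+ 1ℚ) ℚ.* (A ℚ.* ((x ℚ.+ v) ℚ.* b) ℚ.+ a ℚ.* (v ℚ.* b)) ℚ.- m
    ≤⟨ ℚ.+-monoˡ-≤ (ℚ.- m) (*-monoˡ-0≤ 0≤w+1 (ℚ.≤-trans convex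
         (ℚ.+-monoʳ-≤ (a ℚ.* ((x ℚ.+ v) ℚ.* b)) (*-monoˡ-0≤ 0≤a (*-monoˡ-0≤ (ℚ.<⇒≤ 0<v) B≤Eb))))) ⟩
  (x ℚ.+ v ℚ.+ 1ℚ) ℚ.* (a ℚ.* ((x ℚ.+ v) ℚ.* b) ℚ.+ a ℚ.* (v ℚ.* (E ℚ.* b))) ℚ.- m
    ≤⟨ p≤p+q (0≤* (0≤* (0≤* (ℚ.<⇒≤ 0<b) 0≤a) 0≤x) (p≤q⇒0≤q-p 1≤E)) ⟩
  (x ℚ.+ v ℚ.+ 1ℚ) ℚ.* (a ℚ.* ((x ℚ.+ v) ℚ.* b) ℚ.+ a ℚ.* (v ℚ.* (E ℚ.* b))) ℚ.- m ℚ.+ b ℚ.* a ℚ.* x ℚ.* (E ℚ.- 1ℚ)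
    ≡⟨ eq₂ v x a b E ⟩
  b ℚ.* ((x ℚ.+ v) ℚ.* (a ℚ.* (x ℚ.+ v ℚ.* E ℚ.+ E))) ∎))
  where
  open ℚ.≤-Reasoning
  m = (x ℚ.+ v ℚ.+ 1ℚ) ℚ.* (a ℚ.* (v ℚ.* b))
  0<w : 0ℚ ℚ.< x ℚ.+ v
  0<w = ℚ.≤-<-trans 0≤x (p<p+q 0<v)
  0≤w+1 : 0ℚ ℚ.≤ x ℚ.+ v ℚ.+ 1ℚ
  0≤w+1 = 0≤+ (ℚ.<⇒≤ 0<w) (ℚ.nonNegative⁻¹ 1ℚ)
  eq₁ : ∀ v x a b A → b ℚ.* ((x ℚ.+ v) ℚ.* ((x ℚ.+ v ℚ.+ 1ℚ) ℚ.* A)) ≡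
    (x ℚ.+ v ℚ.+ 1ℚ) ℚ.* (A ℚ.* ((x ℚ.+ v) ℚ.* b) ℚ.+ a ℚ.* (v ℚ.* b)) ℚ.- (x ℚ.+ v ℚ.+ 1ℚ) ℚ.* (a ℚ.* (v ℚ.* b))
  eq₁ = Ring.solve-∀ ℚ-ring
  eq₂ : ∀ v x a b E → (x ℚ.+ v ℚ.+ 1ℚ) ℚ.* (a ℚ.* ((x ℚ.+ v) ℚ.* b) ℚ.+ a ℚ.* (v ℚ.* (E ℚ.* b))) ℚ.-
    (x ℚ.+ v ℚ.+ 1ℚ) ℚ.* (a ℚ.* (v ℚ.* b)) ℚ.+ b ℚ.* a ℚ.* x ℚ.* (E ℚ.- 1ℚ) ≡
    b ℚ.* ((x ℚ.+ v) ℚ.* (a ℚ.* (x ℚ.+ v ℚ.* E ℚ.+ E)))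
  eq₂ = Ring.solve-∀ ℚ-ring

0<ι : ∀ n .{{_ : NonZero n}} → 0ℚ ℚ.< ι n
0<ι (suc n) = ℚ.<-≤-trans (ℚ.positive⁻¹ 1ℚ) (ι-mono {1} {suc n} (s≤s z≤n))

-- ((t + 1) ⋯ (t + k))^{1/k} ≥ t + k/E for E ≥ (1 + 1/i)^i, i = 1, …, k - 1.
rising-bound : ∀ {E} → 1ℚ ℚ.≤ E → ∀ t k →
  (∀ i .{{_ : NonZero i}} → i ≤ k → ι (suc i) ^ℚ i ℚ.≤ E ℚ.* (ι i ^ℚ i)) →
  (ι t ℚ.* E ℚ.+ ι k) ^ℚ k ℚ.≤ (E ^ℚ k) ℚ.* ι (rising t k)
rising-bound 1≤E t zero H = ℚ.≤-refl
-- Treated apart because `rising-step` requires `0 < v` with v one less than the exponent, which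
-- would be 0 here.
rising-bound {E} 1≤E t (suc zero) H = begin
  (ι t ℚ.* E ℚ.+ 1ℚ) ℚ.* 1ℚ        ≡⟨ ℚ.*-identityʳ (ι t ℚ.* E ℚ.+ 1ℚ) ⟩
  ι t ℚ.* E ℚ.+ 1ℚ                 ≤⟨ ℚ.+-monoʳ-≤ (ι t ℚ.* E) 1≤E ⟩
  ι t ℚ.* E ℚ.+ E                  ≡⟨ eq₁ (ι t) E ⟩
  E ℚ.* 1ℚ ℚ.* (ι t ℚ.+ 1ℚ)        ≡⟨ cong (λ r → E ℚ.* 1ℚ ℚ.* r) (trans (cong ι (*-identityʳ (t + 1))) (ι-+ t 1)) ⟨
  E ℚ.* 1ℚ ℚ.* ι ((t + 1) * 1)     ∎
  where
  open ℚ.≤-Reasoning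
  eq₁ : ∀ t E → t ℚ.* E ℚ.+ E ≡ E ℚ.* 1ℚ ℚ.* (t ℚ.+ 1ℚ)
  eq₁ = Ring.solve-∀ ℚ-ring
rising-bound {E} 1≤E t (suc k@(suc _)) H = begin
  (ι t ℚ.* E ℚ.+ ι (suc k)) ^ℚ suc k
    ≡⟨ cong (_^ℚ suc k) (trans (cong (λ i → ι t ℚ.* E ℚ.+ i) (ι-suc k))
         (eq₂ (ι t ℚ.* E) (ι k))) ⟩
  (w ℚ.+ 1ℚ) ^ℚ suc k
    ≤⟨ rising-step {E} {ι k} {ι t ℚ.* E} {w ^ℚ k} {ι k ^ℚ k} {(ι k ℚ.+ 1ℚ) ^ℚ k} {(w ℚ.+ 1ℚ) ^ℚ k}
         1≤E (0<ι k) 0≤tE (0≤^ 0≤w k) (0<^ (0<ι k) k)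
         (subst (λ i → i ^ℚ k ℚ.≤ E ℚ.* (ι k ^ℚ k)) (trans (ι-suc k) (ℚ.+-comm 1ℚ (ι k))) (H k (n≤1+n k)))
         (power-convex (0≤ι k) k≤w k) ⟩
  (w ^ℚ k) ℚ.* (ι t ℚ.* E ℚ.+ ι k ℚ.* E ℚ.+ E)
    ≤⟨ ℚ.*-monoʳ-≤-nonNeg _ {{ℚ.nonNegative (0≤+ (0≤+ 0≤tE (0≤* (0≤ι k) 0≤E)) 0≤E)}}
         (rising-bound 1≤E t k (λ i i≤k → H i (m≤n⇒m≤1+n i≤k))) ⟩
  (E ^ℚ k) ℚ.* ι (rising t k) ℚ.* (ι t ℚ.* E ℚ.+ ι k ℚ.* E ℚ.+ E)
    ≡⟨ eq₃ (E ^ℚ k) (ι (rising t k)) (ι t) (ι k) E ⟩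
  (E ^ℚ suc k) ℚ.* ((ι t ℚ.+ (1ℚ ℚ.+ ι k)) ℚ.* ι (rising t k))
    ≡⟨ cong (λ r → (E ^ℚ suc k) ℚ.* r) (trans (ι-* (t + suc k) (rising t k)) (cong (ℚ._* ι (rising t k))
         (trans (ι-+ t (suc k)) (cong (λ i → ι t ℚ.+ i) (ι-suc k))))) ⟨
  (E ^ℚ suc k) ℚ.* ι (rising t (suc k)) ∎
  where
  open ℚ.≤-Reasoning
  eq₃ : ∀ e r t v E → e ℚ.* r ℚ.* (t ℚ.* E ℚ.+ v ℚ.* E ℚ.+ E) ≡ E ℚ.* e ℚ.* ((t ℚ.+ (1ℚ ℚ.+ v)) ℚ.* r)
  eq₃ = Ring.solve-∀ ℚ-ring
  eq₂ : ∀ x v → x ℚ.+ (1ℚ ℚ.+ v) ≡ x ℚ.+ v ℚ.+ 1ℚ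
  eq₂ = Ring.solve-∀ ℚ-ring
  w = ι t ℚ.* E ℚ.+ ι k
  0≤E : 0ℚ ℚ.≤ E
  0≤E = ℚ.≤-trans (ℚ.nonNegative⁻¹ 1ℚ) 1≤E
  0≤tE : 0ℚ ℚ.≤ ι t ℚ.* E
  0≤tE = 0≤* (0≤ι t) 0≤E
  k≤w : ι k ℚ.≤ w
  k≤w = subst (ι k ℚ.≤_) (ℚ.+-comm (ι k) (ι t ℚ.* E)) (p≤p+q 0≤tE)
  0≤w : 0ℚ ℚ.≤ w
  0≤w = 0≤+ 0≤tE (0≤ι k)

-- (1 + 1/v)^k ≥ 1 + k/v ≥ 2 for v ≤ k, cleared of denominators.
doubling : ∀ {v} → 0ℚ ℚ.≤ v → ∀ k .{{_ : NonZero k}} → v ℚ.≤ ι k → (v ^ℚ k) ℚ.* ι 2 ℚ.≤ (v ℚ.+ 1ℚ) ^ℚ k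
doubling {v} 0≤v (suc j) v≤k = begin
  v ℚ.* (v ^ℚ j) ℚ.* ι 2
    ≡⟨ eq v (v ^ℚ j) ⟩
  v ℚ.* (v ^ℚ j) ℚ.+ v ℚ.* (1ℚ ℚ.* (v ^ℚ j))
    ≤⟨ ℚ.+-monoʳ-≤ (v ℚ.* (v ^ℚ j)) (ℚ.*-monoʳ-≤-nonNeg _ {{ℚ.nonNegative (0≤* (ℚ.nonNegative⁻¹ 1ℚ) (0≤^ 0≤v j))}} v≤k) ⟩
  v ℚ.* (v ^ℚ j) ℚ.+ ι (suc j) ℚ.* (1ℚ ℚ.* (v ^ℚ j))
    ≤⟨ bernoulli 0≤v (ℚ.nonNegative⁻¹ 1ℚ) j ⟩
  (v ℚ.+ 1ℚ) ^ℚ suc j ∎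
  where
  open ℚ.≤-Reasoning
  eq : ∀ v t → v ℚ.* t ℚ.* ι 2 ≡ v ℚ.* t ℚ.+ v ℚ.* (1ℚ ℚ.* t)
  eq = Ring.solve-∀ ℚ-ring

doubling-iterated : ∀ k .{{_ : NonZero k}} t {v} → 0ℚ ℚ.≤ v → v ℚ.+ ι t ℚ.≤ ι k →
  (v ^ℚ k) ℚ.* ι (2 ^ t) ℚ.≤ (v ℚ.+ ι t) ^ℚ k
doubling-iterated k zero    {v} 0≤v _     = ℚ.≤-reflexive (trans (ℚ.*-identityʳ (v ^ℚ k)) (cong (_^ℚ k) (sym (ℚ.+-identityʳ v))))
doubling-iterated k (suc t) {v} 0≤v v+t≤k = begin
  (v ^ℚ k) ℚ.* ι (2 ^ suc t)            ≡⟨ trans (cong (λ r → (v ^ℚ k) ℚ.* r) (ι-* 2 (2 ^ t))) (sym (ℚ.*-assoc (v ^ℚ k) (ι 2) (ι (2 ^ t)))) ⟩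
  (v ^ℚ k) ℚ.* ι 2 ℚ.* ι (2 ^ t)        ≤⟨ ℚ.*-monoʳ-≤-nonNeg (ι (2 ^ t)) {{ℚ.nonNegative (0≤ι (2 ^ t))}}
                                             (doubling 0≤v k (ℚ.≤-trans (p≤p+q (0≤ι (suc t))) v+t≤k)) ⟩
  ((v ℚ.+ 1ℚ) ^ℚ k) ℚ.* ι (2 ^ t)       ≤⟨ doubling-iterated k t (0≤+ 0≤v (ℚ.nonNegative⁻¹ 1ℚ)) (subst (ℚ._≤ ι k) eq v+t≤k) ⟩
  (v ℚ.+ 1ℚ ℚ.+ ι t) ^ℚ k               ≡⟨ cong (_^ℚ k) eq ⟨
  (v ℚ.+ ι (suc t)) ^ℚ k                ∎
  where
  open ℚ.≤-Reasoning
  eq : v ℚ.+ ι (suc t) ≡ v ℚ.+ 1ℚ ℚ.+ ι t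
  eq = trans (cong (λ i → v ℚ.+ i) (ι-suc t)) (sym (ℚ.+-assoc v 1ℚ (ι t)))

-- For w = (s - k) E + k, i.e. w / E = s - (1 - 1/E) k.
power-bound : ∀ k .{{_ : NonZero k}} s m {E w} → 1ℚ ℚ.≤ E →
  (∀ i .{{_ : NonZero i}} → i ≤ k → ι (suc i) ^ℚ i ℚ.≤ E ℚ.* (ι i ^ℚ i)) →
  (∀ j → j ≤ k → j ≤ s → 2 * (2 ^ j * (s C j)) ≤ m) →
  0ℚ ℚ.≤ w → w ℚ.+ ι k ℚ.* E ≡ ι s ℚ.* E ℚ.+ ι k →
  ι (2 * 2 ^ k) ℚ.* (w ^ℚ k) ℚ.≤ (E ^ℚ k) ℚ.* ι (k ! * m)
power-bound k s m {E} {w} 1≤E H bound 0≤w w+kE≡sE+k with ≤-total k s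
... | inj₁ k≤s = large (s ∸ k) (m+[n∸m]≡n k≤s)
  where
  open ℚ.≤-Reasoning
  large : ∀ t → k + t ≡ s → ι (2 * 2 ^ k) ℚ.* (w ^ℚ k) ℚ.≤ (E ^ℚ k) ℚ.* ι (k ! * m)
  large t refl = begin
    ι (2 * 2 ^ k) ℚ.* (w ^ℚ k)
      ≡⟨ cong (λ w → ι (2 * 2 ^ k) ℚ.* (w ^ℚ k)) w≡tE+k ⟩
    ι (2 * 2 ^ k) ℚ.* ((ι t ℚ.* E ℚ.+ ι k) ^ℚ k)
      ≤⟨ *-monoˡ-0≤ (0≤ι (2 * 2 ^ k)) (rising-bound 1≤E t k H) ⟩
    ι (2 * 2 ^ k) ℚ.* ((E ^ℚ k) ℚ.* ι (rising t k))
      ≡⟨ trans (eq₁ (ι (2 * 2 ^ k)) (E ^ℚ k) (ι (rising t k))) (cong (λ r → (E ^ℚ k) ℚ.* r) (sym (ι-* (2 * 2 ^ k) (rising t k)))) ⟩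
    (E ^ℚ k) ℚ.* ι (2 * 2 ^ k * rising t k)
      ≤⟨ *-monoˡ-0≤ (0≤^ (ℚ.≤-trans (ℚ.nonNegative⁻¹ 1ℚ) 1≤E) k) (ι-mono (≤-trans
           (≤-reflexive (trans (cong (2 * 2 ^ k *_) (rising-C t k)) (eq₂ (2 ^ k) (k !) ((k + t) C k))))
           (*-monoʳ-≤ (k !) (bound k ≤-refl k≤s)))) ⟩
    (E ^ℚ k) ℚ.* ι (k ! * m) ∎
    where
    eq₁ : ∀ a b c → a ℚ.* (b ℚ.* c) ≡ b ℚ.* (a ℚ.* c)
    eq₁ = Ring.solve-∀ ℚ-ring
    eq₂ : ∀ a b c → 2 * a * (b * c) ≡ b * (2 * (a * c))
    eq₂ = solve-∀
    eq₃ : ∀ w k E → w ≡ w ℚ.+ k ℚ.* E ℚ.- k ℚ.* E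
    eq₃ = Ring.solve-∀ ℚ-ring
    eq₄ : ∀ t k E → (k ℚ.+ t) ℚ.* E ℚ.+ k ℚ.- k ℚ.* E ≡ t ℚ.* E ℚ.+ k
    eq₄ = Ring.solve-∀ ℚ-ring
    w≡tE+k : w ≡ ι t ℚ.* E ℚ.+ ι k
    w≡tE+k = trans (eq₃ w (ι k) E) (trans
      (cong (λ r → r ℚ.- ι k ℚ.* E) (trans w+kE≡sE+k (cong (λ r → r ℚ.* E ℚ.+ ι k) (ι-+ k t)))) (eq₄ (ι t) (ι k) E))
... | inj₂ s≤k = small (k ∸ s) (m+[n∸m]≡n s≤k)
  where
  open ℚ.≤-Reasoning
  -- With t = k - s the equation for w becomes w + t E = k, so w + t ≤ k as E ≥ 1. Since C(s,k)
  -- would carry no information, `bound` is taken at s, and the missing factor 2^t comes from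
  -- `doubling-iterated`. The inequality k^k ≤ E^k k! is `rising-bound` at 0.
  small : ∀ t → s + t ≡ k → ι (2 * 2 ^ k) ℚ.* (w ^ℚ k) ℚ.≤ (E ^ℚ k) ℚ.* ι (k ! * m)
  small t s+t≡k = begin
    ι (2 * 2 ^ k) ℚ.* (w ^ℚ k)
      ≡⟨ cong (λ r → r ℚ.* (w ^ℚ k)) (trans (cong ι 2*2^k) (ι-* (2 * 2 ^ s) (2 ^ t))) ⟩
    ι (2 * 2 ^ s) ℚ.* ι (2 ^ t) ℚ.* (w ^ℚ k)
      ≡⟨ eq₁ (ι (2 * 2 ^ s)) (ι (2 ^ t)) (w ^ℚ k) ⟩
    ι (2 * 2 ^ s) ℚ.* ((w ^ℚ k) ℚ.* ι (2 ^ t))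
      ≤⟨ *-monoˡ-0≤ (0≤ι (2 * 2 ^ s)) (begin
        (w ^ℚ k) ℚ.* ι (2 ^ t)           ≤⟨ doubling-iterated k t 0≤w w+t≤k ⟩
        (w ℚ.+ ι t) ^ℚ k                 ≤⟨ ^-mono (0≤+ 0≤w (0≤ι t)) w+t≤k k ⟩
        ι k ^ℚ k                         ≡⟨ cong (_^ℚ k) (sym (eq₂ E (ι k))) ⟩
        (ι 0 ℚ.* E ℚ.+ ι k) ^ℚ k         ≤⟨ rising-bound 1≤E 0 k H ⟩
        (E ^ℚ k) ℚ.* ι (rising 0 k)      ∎) ⟩
    ι (2 * 2 ^ s) ℚ.* ((E ^ℚ k) ℚ.* ι (rising 0 k))
      ≡⟨ trans (eq₃ (ι (2 * 2 ^ s)) (E ^ℚ k) (ι (rising 0 k))) (cong (λ r → (E ^ℚ k) ℚ.* r) (sym (ι-* (rising 0 k) (2 * 2 ^ s)))) ⟩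
    (E ^ℚ k) ℚ.* ι (rising 0 k * (2 * 2 ^ s))
      ≤⟨ *-monoˡ-0≤ (0≤^ (ℚ.≤-trans (ℚ.nonNegative⁻¹ 1ℚ) 1≤E) k) (ι-mono (*-mono-≤ (≤-reflexive rising₀)
           (≤-trans (≤-reflexive (cong (2 *_) (trans (sym (*-identityʳ (2 ^ s))) (cong (2 ^ s *_) (sym (nCn≡1 s)))))) (bound s s≤k ≤-refl)))) ⟩
    (E ^ℚ k) ℚ.* ι (k ! * m) ∎
    where
    2*2^k : 2 * 2 ^ k ≡ 2 * 2 ^ s * 2 ^ t
    2*2^k = trans (cong (λ k → 2 * 2 ^ k) (sym s+t≡k)) (trans (cong (2 *_) (^-distribˡ-+-* 2 s t)) (sym (*-assoc 2 (2 ^ s) (2 ^ t))))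
    rising₀ : rising 0 k ≡ k !
    rising₀ = trans (sym (*-identityʳ (rising 0 k))) (trans (rising-! 0 k) (cong _! (+-identityʳ k)))
    eq₁ : ∀ a b c → a ℚ.* b ℚ.* c ≡ a ℚ.* (c ℚ.* b)
    eq₁ = Ring.solve-∀ ℚ-ring
    eq₂ : ∀ E k → ι 0 ℚ.* E ℚ.+ k ≡ k
    eq₂ = Ring.solve-∀ ℚ-ring
    eq₃ : ∀ a b c → a ℚ.* (b ℚ.* c) ≡ b ℚ.* (c ℚ.* a)
    eq₃ = Ring.solve-∀ ℚ-ring
    eq₄ : ∀ w s t E → w ℚ.+ t ℚ.* E ≡ w ℚ.+ (s ℚ.+ t) ℚ.* E ℚ.- s ℚ.* E
    eq₄ = Ring.solve-∀ ℚ-ring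
    eq₅ : ∀ s k E → s ℚ.* E ℚ.+ k ℚ.- s ℚ.* E ≡ k
    eq₅ = Ring.solve-∀ ℚ-ring
    w+tE≡k : w ℚ.+ ι t ℚ.* E ≡ ι k
    w+tE≡k = trans (eq₄ w (ι s) (ι t) E) (trans (cong (λ r → r ℚ.- ι s ℚ.* E)
      (trans (cong (λ r → w ℚ.+ r ℚ.* E) (trans (sym (ι-+ s t)) (cong ι s+t≡k))) w+kE≡sE+k)) (eq₅ (ι s) (ι k) E))
    w+t≤k : w ℚ.+ ι t ℚ.≤ ι k
    w+t≤k = begin
      w ℚ.+ ι t            ≡⟨ cong (λ r → w ℚ.+ r) (ℚ.*-identityʳ (ι t)) ⟨
      w ℚ.+ ι t ℚ.* 1ℚ     ≤⟨ ℚ.+-monoʳ-≤ w (*-monoˡ-0≤ (0≤ι t) 1≤E) ⟩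
      w ℚ.+ ι t ℚ.* E      ≡⟨ w+tE≡k ⟩
      ι k                  ∎

e-lower : ∀ {N} → 4 ≤ N → + 65 ℚ./ 24 ℚ.≤ seq e N
e-lower {N} 4≤N = ℚ.≤-trans (from-yes (+ 65 ℚ./ 24 ℚ.≤? sum 1/_! 5)) (sum-≤-length ExpSeries.0≤1/! (s≤s 4≤N))

1≤e : ∀ N → 1ℚ ℚ.≤ seq e N
1≤e N = sum-≤-length ExpSeries.0≤1/! {1} {suc N} (s≤s z≤n)


altSum-even-lower : ∀ f → (∀ i → f (suc i) ℚ.≤ f i) → (∀ i → 0ℚ ℚ.≤ f i) →
  ∀ m d → altSum f (m * 2) ℚ.≤ altSum f (m * 2 + d)
altSum-even-lower f decr 0≤f zero    d = proj₁ (SeriesLemmas.altSum-bounds f decr 0≤f d)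
altSum-even-lower f decr 0≤f (suc m) d = ℚ.+-monoʳ-≤ (f 0) (ℚ.neg-antimono-≤ (ℚ.+-monoʳ-≤ (f 1) (ℚ.neg-antimono-≤
  (altSum-even-lower (λ i → f (suc (suc i))) (λ i → decr (suc (suc i))) (λ i → 0≤f (suc (suc i))) m d))))

-- Bounds for e, π and the roots

open LeibnizSeries using (leibniz)

leibniz-decreasing : ∀ i → leibniz (suc i) ℚ.≤ leibniz i
leibniz-decreasing i = /-mono 1 (suc (2 * suc i)) 1 (suc (2 * i)) (*-monoʳ-≤ 1 (s≤s (*-monoʳ-≤ 2 (n≤1+n i))))

-- Partial sums of even length lie below all later ones. Thirty terms miss π by about 1/30, which
-- leaves room above 3.1.
π-lower : ∀ {N} → 30 ≤ N → + 31 ℚ./ 10 ℚ.≤ seq π N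
π-lower {N} 30≤N = begin
  + 31 ℚ./ 10                          ≤⟨ from-yes (+ 31 ℚ./ 10 ℚ.≤? ι 4 ℚ.* altSum leibniz (15 * 2)) ⟩
  ι 4 ℚ.* altSum leibniz (15 * 2)      ≤⟨ *-monoˡ-0≤ (0≤ι 4) (altSum-even-lower leibniz leibniz-decreasing (λ i → 0≤/ 1 (suc (2 * i))) 15 (N ∸ 30)) ⟩
  ι 4 ℚ.* altSum leibniz (30 + (N ∸ 30)) ≡⟨ cong (λ i → ι 4 ℚ.* altSum leibniz i) (m+[n∸m]≡n 30≤N) ⟩
  ι 4 ℚ.* altSum leibniz N             ∎
  where open ℚ.≤-Reasoning

-- 26 is four times the constant 13/2 of the counting bound, and 65/24 · 3.1² is about 26.03. The
-- trailing `1ℚ` matches the unfolding of `π ^ᴿ 2`.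
eπ²-lower : ∀ {N} → 30 ≤ N → ι 26 ℚ.≤ seq e N ℚ.* (seq π N ℚ.* (seq π N ℚ.* 1ℚ))
eπ²-lower {N} 30≤N = ℚ.≤-trans (from-yes (ι 26 ℚ.≤? + 65 ℚ./ 24 ℚ.* (+ 31 ℚ./ 10 ℚ.* (+ 31 ℚ./ 10 ℚ.* 1ℚ))))
  (ℚ-*-mono-≤ (0≤/ 65 24) (0≤* 0≤π (0≤* 0≤π (ℚ.nonNegative⁻¹ 1ℚ))) (e-lower (≤-trans (≤ᵇ⇒≤ 4 30 _) 30≤N))
    (ℚ-*-mono-≤ (0≤/ 31 10) (0≤* 0≤π (ℚ.nonNegative⁻¹ 1ℚ)) (π-lower 30≤N)
      (ℚ-*-mono-≤ (0≤/ 31 10) (ℚ.nonNegative⁻¹ 1ℚ) (π-lower 30≤N) ℚ.≤-refl)))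
  where
  0≤π : 0ℚ ℚ.≤ seq π N
  0≤π = ℚ.≤-trans (0≤/ 31 10) (π-lower 30≤N)

-- The number under the root is thus at least 13 h k! / 2^(k + 1): the 2^(k + 2) in its denominator
-- is 2 · (2 · 2^k), and 26 = 2 · 13.
coefficient-lower : ∀ k h f {P} → ι 26 ℚ.≤ P →
  ι (13 * h) ℚ.* ι f ℚ.≤ ι (2 * 2 ^ k) ℚ.* (P ℚ.* ι h ℚ.* ι f ℚ.* ℚ._/_ (+ 1) (2 ^ (k + 2)) {{m^n≢0 2 (k + 2)}})
coefficient-lower k h f {P} 26≤P = *-cancelˡ-0< (0<ι 2) (begin
  ι 2 ℚ.* (ι (13 * h) ℚ.* ι f)
    ≡⟨ cong (λ r → ι 2 ℚ.* (r ℚ.* ι f)) (ι-* 13 h) ⟩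
  ι 2 ℚ.* (ι 13 ℚ.* ι h ℚ.* ι f)
    ≡⟨ eq₁ (ι h) (ι f) ⟩
  ι h ℚ.* ι f ℚ.* ι 26
    ≤⟨ *-monoˡ-0≤ (0≤* (0≤ι h) (0≤ι f)) 26≤P ⟩
  ι h ℚ.* ι f ℚ.* P
    ≡⟨ eq₂ (ι h) (ι f) P ⟩
  1ℚ ℚ.* (P ℚ.* ι h ℚ.* ι f)
    ≡⟨ cong (ℚ._* (P ℚ.* ι h ℚ.* ι f)) d*1/d ⟨
  ι d ℚ.* 1/d ℚ.* (P ℚ.* ι h ℚ.* ι f)
    ≡⟨ cong (λ r → r ℚ.* 1/d ℚ.* (P ℚ.* ι h ℚ.* ι f)) (trans (cong ι d≡) (ι-* 2 (2 * 2 ^ k))) ⟩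
  ι 2 ℚ.* ι (2 * 2 ^ k) ℚ.* 1/d ℚ.* (P ℚ.* ι h ℚ.* ι f)
    ≡⟨ eq₃ (ι 2) (ι (2 * 2 ^ k)) 1/d (P ℚ.* ι h ℚ.* ι f) ⟩
  ι 2 ℚ.* (ι (2 * 2 ^ k) ℚ.* (P ℚ.* ι h ℚ.* ι f ℚ.* 1/d)) ∎)
  where
  open ℚ.≤-Reasoning
  d = 2 ^ (k + 2)
  instance _ = m^n≢0 2 (k + 2)
  1/d = + 1 ℚ./ d
  d*1/d : ι d ℚ.* 1/d ≡ 1ℚ
  d*1/d = n*1/n d
  d≡ : d ≡ 2 * (2 * 2 ^ k)
  d≡ = cong (2 ^_) (+-comm k 2)
  eq₁ : ∀ h f → ι 2 ℚ.* (ι 13 ℚ.* h ℚ.* f) ≡ h ℚ.* f ℚ.* ι 26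
  eq₁ = Ring.solve-∀ ℚ-ring
  eq₂ : ∀ h f p → h ℚ.* f ℚ.* p ≡ 1ℚ ℚ.* (p ℚ.* h ℚ.* f)
  eq₂ = Ring.solve-∀ ℚ-ring
  eq₃ : ∀ a b c x → a ℚ.* b ℚ.* c ℚ.* x ≡ a ℚ.* (b ℚ.* (x ℚ.* c))
  eq₃ = Ring.solve-∀ ℚ-ring

-- `power-bound` at w = u E, divided by E^k. Here u is s - (1 - 1/E) k, to be compared with the
-- product of the two roots.
power-bound-unscaled : ∀ k .{{_ : NonZero k}} s n h {E c u} → 1ℚ ℚ.≤ E →
  (∀ i .{{_ : NonZero i}} → i ≤ k → ι (suc i) ^ℚ i ℚ.≤ E ℚ.* (ι i ^ℚ i)) →
  (∀ j → j ≤ k → j ≤ s → 2 * (2 ^ j * (s C j)) ≤ 13 * (h * n)) →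
  ι (13 * h) ℚ.* ι (k !) ℚ.≤ ι (2 * 2 ^ k) ℚ.* c →
  0ℚ ℚ.≤ u → u ℚ.* E ℚ.+ ι k ℚ.* E ≡ ι s ℚ.* E ℚ.+ ι k → u ^ℚ k ℚ.≤ c ℚ.* ι n
power-bound-unscaled k s n h {E} {c} {u} 1≤E H bound c-lower 0≤u eq =
  *-cancelˡ-0< (0<^ 0<E k) (*-cancelˡ-0< (0<ι (2 * 2 ^ k) {{m*n≢0 2 (2 ^ k) {{_}} {{m^n≢0 2 k}}}}) (begin
    ι (2 * 2 ^ k) ℚ.* ((E ^ℚ k) ℚ.* (u ^ℚ k))
      ≡⟨ cong (λ r → ι (2 * 2 ^ k) ℚ.* r) (trans (ℚ.*-comm (E ^ℚ k) (u ^ℚ k)) (sym (^ℚ-* u E k))) ⟩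
    ι (2 * 2 ^ k) ℚ.* ((u ℚ.* E) ^ℚ k)
      ≤⟨ power-bound k s (13 * (h * n)) 1≤E H bound (0≤* 0≤u (ℚ.<⇒≤ 0<E)) eq ⟩
    (E ^ℚ k) ℚ.* ι (k ! * (13 * (h * n)))
      ≡⟨ cong (λ r → (E ^ℚ k) ℚ.* r) (trans (cong ι (eq₁ (k !) h n)) (trans (ι-* n (13 * h * k !))
           (cong (λ r → ι n ℚ.* r) (ι-* (13 * h) (k !))))) ⟩
    (E ^ℚ k) ℚ.* (ι n ℚ.* (ι (13 * h) ℚ.* ι (k !)))
      ≤⟨ *-monoˡ-0≤ (ℚ.<⇒≤ (0<^ 0<E k)) (*-monoˡ-0≤ (0≤ι n) c-lower) ⟩
    (E ^ℚ k) ℚ.* (ι n ℚ.* (ι (2 * 2 ^ k) ℚ.* c))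
      ≡⟨ eq₂ (E ^ℚ k) (ι n) (ι (2 * 2 ^ k)) c ⟩
    ι (2 * 2 ^ k) ℚ.* ((E ^ℚ k) ℚ.* (c ℚ.* ι n)) ∎))
  where
  open ℚ.≤-Reasoning
  0<E : 0ℚ ℚ.< E
  0<E = ℚ.<-≤-trans (ℚ.positive⁻¹ 1ℚ) 1≤E
  eq₁ : ∀ f h n → f * (13 * (h * n)) ≡ n * (13 * h * f)
  eq₁ = solve-∀
  eq₂ : ∀ a n t c → a ℚ.* (n ℚ.* (t ℚ.* c)) ≡ t ℚ.* (a ℚ.* (c ℚ.* n))
  eq₂ = Ring.solve-∀ ℚ-ring

-- Passage to real roots

recip-inverse : ∀ {c q} (0<c : 0ℚ ℚ.< c) → c ℚ.≤ q → Reciprocal.recip⊔ c 0<c q ℚ.* q ≡ 1ℚ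
recip-inverse {c} {q} 0<c c≤q = trans
  (cong (λ r → Reciprocal.recip⊔ c 0<c q ℚ.* r) (sym (ℚ.p≥q⇒p⊔q≡p c≤q)))
  (ℚ.*-inverseˡ (q ℚ.⊔ c) {{_}})

-- One grid step above `rootℚ` strictly exceeds the true root, so a b < u would give c m < (a b)^k ≤
-- u^k ≤ c m. The power inequality is required only for u ≥ 0, which a b < u guarantees; in the
-- application s - (1 - 1/e) k may be negative.
≤-product-of-roots : ∀ k N {c m u} → 0ℚ ℚ.≤ m → (0ℚ ℚ.≤ u → u ^ℚ suc k ℚ.≤ c ℚ.* m) →
  u ℚ.≤ (rootℚ (suc k) c N ℚ.+ + 1 ℚ./ suc N) ℚ.* (rootℚ (suc k) m N ℚ.+ + 1 ℚ./ suc N)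
≤-product-of-roots k N {c} {m} {u} 0≤m u^k≤cm = ℚ.≮⇒≥ λ ab<u → ℚ.<-irrefl refl (begin-strict
  c ℚ.* m                            ≤⟨ ℚ.*-monoʳ-≤-nonNeg m {{ℚ.nonNegative 0≤m}} (ℚ.<⇒≤ (rootℚ-upper k c N)) ⟩
  (a ^ℚ suc k) ℚ.* m                 <⟨ ℚ.*-monoʳ-<-pos (a ^ℚ suc k) {{ℚ.positive (0<^ (0<r+δ c) (suc k))}} (rootℚ-upper k m N) ⟩
  (a ^ℚ suc k) ℚ.* (b ^ℚ suc k)      ≡⟨ ^ℚ-* a b (suc k) ⟨
  (a ℚ.* b) ^ℚ suc k                 ≤⟨ ^-mono 0≤ab (ℚ.<⇒≤ ab<u) (suc k) ⟩
  u ^ℚ suc k                         ≤⟨ u^k≤cm (ℚ.≤-trans 0≤ab (ℚ.<⇒≤ ab<u)) ⟩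
  c ℚ.* m                            ∎)
  where
  open ℚ.≤-Reasoning
  open RootLemmas using (rootℚ-upper; 0≤rootℚ)
  a = rootℚ (suc k) c N ℚ.+ + 1 ℚ./ suc N
  b = rootℚ (suc k) m N ℚ.+ + 1 ℚ./ suc N
  0<r+δ : ∀ x → 0ℚ ℚ.< rootℚ (suc k) x N ℚ.+ + 1 ℚ./ suc N
  0<r+δ x = ℚ.≤-<-trans (0≤rootℚ (suc k) x N) (p<p+q (ℚ.positive⁻¹ _ {{ℚ.normalize-pos 1 (suc N)}}))
  0≤ab : 0ℚ ℚ.≤ a ℚ.* b
  0≤ab = 0≤* (ℚ.<⇒≤ (0<r+δ c)) (ℚ.<⇒≤ (0<r+δ m))

perturbed-product : ∀ {r₁ r₂ δ B₁ B₂ η} → 0ℚ ℚ.≤ r₁ → 0ℚ ℚ.≤ r₂ → 0ℚ ℚ.≤ δ →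
  r₁ ℚ.≤ B₁ → r₂ ℚ.≤ B₂ → δ ℚ.≤ 1ℚ → δ ℚ.≤ η →
  (r₁ ℚ.+ δ) ℚ.* (r₂ ℚ.+ δ) ℚ.≤ r₁ ℚ.* r₂ ℚ.+ (B₁ ℚ.+ B₂ ℚ.+ 1ℚ) ℚ.* η
perturbed-product {r₁} {r₂} {δ} {B₁} {B₂} {η} 0≤r₁ 0≤r₂ 0≤δ r₁≤B₁ r₂≤B₂ δ≤1 δ≤η = begin
  (r₁ ℚ.+ δ) ℚ.* (r₂ ℚ.+ δ)                    ≡⟨ eq r₁ r₂ δ ⟩
  r₁ ℚ.* r₂ ℚ.+ (r₁ ℚ.+ r₂ ℚ.+ δ) ℚ.* δ        ≤⟨ ℚ.+-monoʳ-≤ (r₁ ℚ.* r₂) (ℚ-*-mono-≤ (0≤+ (0≤+ 0≤r₁ 0≤r₂) 0≤δ)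
                                                    (ℚ.≤-trans 0≤δ δ≤η) (ℚ.+-mono-≤ (ℚ.+-mono-≤ r₁≤B₁ r₂≤B₂) δ≤1) δ≤η) ⟩
  r₁ ℚ.* r₂ ℚ.+ (B₁ ℚ.+ B₂ ℚ.+ 1ℚ) ℚ.* η       ∎
  where
  open ℚ.≤-Reasoning
  eq : ∀ a b d → (a ℚ.+ d) ℚ.* (b ℚ.+ d) ≡ a ℚ.* b ℚ.+ (a ℚ.+ b ℚ.+ d) ℚ.* d
  eq = Ring.solve-∀ ℚ-ring

linear-term : ∀ s k E I → I ℚ.* E ≡ 1ℚ →
  (s ℚ.- (E ℚ.- 1ℚ) ℚ.* I ℚ.* k) ℚ.* E ℚ.+ k ℚ.* E ≡ s ℚ.* E ℚ.+ k
linear-term s k E I IE≡1 = trans (eq₁ s k E I) (trans (cong (λ r → s ℚ.* E ℚ.- (E ℚ.- 1ℚ) ℚ.* r ℚ.* k ℚ.+ k ℚ.* E) IE≡1) (eq₂ s k E))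
  where
  eq₁ : ∀ s k E I → (s ℚ.- (E ℚ.- 1ℚ) ℚ.* I ℚ.* k) ℚ.* E ℚ.+ k ℚ.* E ≡
    s ℚ.* E ℚ.- (E ℚ.- 1ℚ) ℚ.* (I ℚ.* E) ℚ.* k ℚ.+ k ℚ.* E
  eq₁ = Ring.solve-∀ ℚ-ring
  eq₂ : ∀ s k E → s ℚ.* E ℚ.- (E ℚ.- 1ℚ) ℚ.* 1ℚ ℚ.* k ℚ.+ k ℚ.* E ≡ s ℚ.* E ℚ.+ k
  eq₂ = Ring.solve-∀ ℚ-ring

Φ-counts : ∀ k n .{{_ : NonZero k}} .{{_ : NonZero n}} → ∀ j → j ≤ k → j ≤ Φ k n →
  2 * (2 ^ j * (Φ k n C j)) ≤ 13 * ((k + 1) / 2 * n)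
Φ-counts k n = subst (λ s → ∀ j → j ≤ k → j ≤ s → 2 * (2 ^ j * (s C j)) ≤ 13 * ((k + 1) / 2 * n))
  (proj₂ (proj₂ attained)) (isB-bound (proj₁ attained) (proj₁ (proj₂ attained)))
  where attained = Φ-attained k n

EventuallyBounded : (ℕ → ℚ) → Set
EventuallyBounded x = ∃[ B ] 0ℚ ℚ.< B × ∃[ N ] ∀ n → N ≤ n → ℚ.∣ x n ∣ ℚ.≤ B

-- Raising both roots by δ = 1/(N + 1) costs (r₁ + r₂ + δ) δ, which tends to 0 since r₁ and r₂ are
-- bounded.
grid-error : ∀ {r₁ r₂ : ℕ → ℚ} → EventuallyBounded r₁ → EventuallyBounded r₂ →
  (∀ N → 0ℚ ℚ.≤ r₁ N) → (∀ N → 0ℚ ℚ.≤ r₂ N) → ∀ ε → 0ℚ ℚ.< ε → ∃[ N₀ ] ∀ N → N₀ ≤ N →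
  (r₁ N ℚ.+ + 1 ℚ./ suc N) ℚ.* (r₂ N ℚ.+ + 1 ℚ./ suc N) ℚ.≤ r₁ N ℚ.* r₂ N ℚ.+ ε
grid-error {r₁} {r₂} (B₁ , 0<B₁ , N₁ , r₁≤B₁) (B₂ , 0<B₂ , N₂ , r₂≤B₂) 0≤r₁ 0≤r₂ ε 0<ε =
  N₁ ⊔ (N₂ ⊔ proj₁ arch) , λ N N₀≤N →
    subst (λ η → (r₁ N ℚ.+ + 1 ℚ./ suc N) ℚ.* (r₂ N ℚ.+ + 1 ℚ./ suc N) ℚ.≤ r₁ N ℚ.* r₂ N ℚ.+ η) (*-scale ε 0<B)
      (perturbed-product {r₁ N} {r₂ N} {+ 1 ℚ./ suc N} {B₁} {B₂} {scale ε 0<B} (0≤r₁ N) (0≤r₂ N) (0≤/ 1 (suc N))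
        (ℚ.≤-trans (RationalLemmas.p≤∣p∣ (r₁ N)) (r₁≤B₁ N (⊔≤ˡ N₀≤N)))
        (ℚ.≤-trans (RationalLemmas.p≤∣p∣ (r₂ N)) (r₂≤B₂ N (⊔≤ˡ (⊔≤ʳ {N₁} N₀≤N))))
        (/-mono 1 (suc N) 1 1 (s≤s z≤n))
        (proj₂ arch N (⊔≤ʳ {N₂} (⊔≤ʳ {N₁} N₀≤N))))
  where
  open CauchyLemmas
  0<B : 0ℚ ℚ.< B₁ ℚ.+ B₂ ℚ.+ 1ℚ
  0<B = ℚ.≤-<-trans (0≤+ (ℚ.<⇒≤ 0<B₁) (ℚ.<⇒≤ 0<B₂)) (p<p+q (ℚ.positive⁻¹ 1ℚ))
  arch : ∃[ N ] ∀ n → N ≤ n → + 1 ℚ./ suc n ℚ.≤ scale ε 0<B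
  arch = archimedean (0<scale 0<ε 0<B)

-- From stage N₀ on the premises hold without error, so the whole of ε is available for the rounding
-- of the roots.
≤ᴿ-product-of-roots : ∀ k .{{_ : NonZero k}} (q : ℚ) x y t N₀ → (∀ N → N₀ ≤ N → 0ℚ ℚ.≤ seq y N) →
  (∀ N → N₀ ≤ N → 0ℚ ℚ.≤ q ℚ.- seq t N → (q ℚ.- seq t N) ^ℚ k ℚ.≤ seq x N ℚ.* seq y N) →
  fromℚ q ≤ᴿ root k x *ᴿ root k y +ᴿ t
≤ᴿ-product-of-roots (suc k) q x y t N₀ 0≤y power ε 0<ε = combine
  (grid-error {seq (root (suc k) x)} {seq (root (suc k) y)}
    (CauchyLemmas.bounded {seq (root (suc k) x)} (cauchy (root (suc k) x)))
    (CauchyLemmas.bounded {seq (root (suc k) y)} (cauchy (root (suc k) y)))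
    (λ N → RootLemmas.0≤rootℚ (suc k) (seq x N) N) (λ N → RootLemmas.0≤rootℚ (suc k) (seq y N) N) ε 0<ε)
  where
  open ℚ.≤-Reasoning
  r₁ r₂ : ℕ → ℚ
  r₁ N = rootℚ (suc k) (seq x N) N
  r₂ N = rootℚ (suc k) (seq y N) N
  eq₁ : ∀ s t → s ≡ s ℚ.- t ℚ.+ t
  eq₁ = Ring.solve-∀ ℚ-ring
  eq₂ : ∀ r ε t → r ℚ.+ ε ℚ.+ t ≡ r ℚ.+ t ℚ.+ ε
  eq₂ = Ring.solve-∀ ℚ-ring
  combine : (∃[ N₁ ] ∀ N → N₁ ≤ N → (r₁ N ℚ.+ + 1 ℚ./ suc N) ℚ.* (r₂ N ℚ.+ + 1 ℚ./ suc N) ℚ.≤ r₁ N ℚ.* r₂ N ℚ.+ ε) →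
    ∃[ N₁ ] ∀ N → N₁ ≤ N → q ℚ.≤ r₁ N ℚ.* r₂ N ℚ.+ seq t N ℚ.+ ε
  combine (N₁ , error) = N₀ ⊔ N₁ , λ N N₀⊔N₁≤N → begin
    q                                            ≡⟨ eq₁ q (seq t N) ⟩
    q ℚ.- seq t N ℚ.+ seq t N                    ≤⟨ ℚ.+-monoˡ-≤ (seq t N) (ℚ.≤-trans
                                                      (≤-product-of-roots k N {seq x N} {seq y N}
                                                        (0≤y N (m⊔n≤o⇒m≤o N₀ N₁ N₀⊔N₁≤N)) (power N (m⊔n≤o⇒m≤o N₀ N₁ N₀⊔N₁≤N)))
                                                      (error N (m⊔n≤o⇒n≤o N₀ N₁ N₀⊔N₁≤N))) ⟩
    r₁ N ℚ.* r₂ N ℚ.+ ε ℚ.+ seq t N              ≡⟨ eq₂ (r₁ N ℚ.* r₂ N) ε (seq t N) ⟩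
    r₁ N ℚ.* r₂ N ℚ.+ seq t N ℚ.+ ε              ∎

-- Stated for arbitrary reals x and p in place of e and π, which are thus never unfolded.
counting⇒≤ᴿ : ∀ (x p : ℝ) b k n s .{{_ : NonZero k}} .{{_ : NonZero n}} N₀ → let h = (k + 1) / 2 in
  (∀ N → 1ℚ ℚ.≤ seq x N) →
  (∀ N → N₀ ≤ N → ι 26 ℚ.≤ seq x N ℚ.* (seq p N ℚ.* (seq p N ℚ.* 1ℚ))) →
  (∀ N → N₀ ≤ N → ∀ i .{{_ : NonZero i}} → i ≤ k → ι (suc i) ^ℚ i ℚ.≤ seq x N ℚ.* (ι i ^ℚ i)) →
  (∀ j → j ≤ k → j ≤ s → 2 * (2 ^ j * (s C j)) ≤ 13 * (h * n)) →
  fromℕ s ≤ᴿ root k (_/ℕ_ (x *ᴿ p ^ᴿ 2 *ᴿ fromℕ h *ᴿ fromℕ (k !)) (2 ^ (k + 2)) {{m^n≢0 2 (k + 2)}}) *ᴿ root k (fromℕ n)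
    +ᴿ _/ᴿ_ (x -ᴿ fromℕ 1) x {{mkPositiveᴿ 1ℚ (ℚ.positive⁻¹ 1ℚ) b}} *ᴿ fromℕ k
counting⇒≤ᴿ x p b k n s N₀ 1≤x 26≤xp² powers counts = ≤ᴿ-product-of-roots k (ι s) _ (fromℕ n)
  (_/ᴿ_ (x -ᴿ fromℕ 1) x {{mkPositiveᴿ 1ℚ (ℚ.positive⁻¹ 1ℚ) b}} *ᴿ fromℕ k) N₀ (λ _ _ → 0≤ι n)
  λ N N₀≤N 0≤u → power-bound-unscaled k s n ((k + 1) / 2) {seq x N} (1≤x N) (powers N N₀≤N) counts
    (coefficient-lower k ((k + 1) / 2) (k !) (26≤xp² N N₀≤N)) 0≤u
    (linear-term (ι s) (ι k) (seq x N) (Reciprocal.recip⊔ 1ℚ (ℚ.positive⁻¹ 1ℚ) (seq x N))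
      (recip-inverse (ℚ.positive⁻¹ 1ℚ) (1≤x N)))

theorem5 : (k n : ℕ) .{{_ : NonZero k}} .{{_ : NonZero n}} →
    fromℕ (Φ k n) ≤ᴿ
    root k (_/ℕ_ (e *ᴿ π ^ᴿ 2 *ᴿ fromℕ ((k + 1) / 2) *ᴿ fromℕ (k !)) (2 ^ (k + 2)) {{m^n≢0 2 (k + 2)}})
    *ᴿ root k (fromℕ n)
    +ᴿ (e -ᴿ fromℕ 1) /ᴿ e *ᴿ fromℕ k
-- From stage 30 on the approximation of π exceeds 3.1; from stage k on that of e dominates (1 +
-- 1/i)^i for all i ≤ k.
theorem5 k n = counting⇒≤ᴿ e π (Positiveᴿ.bounds e-positive) k n (Φ k n) (30 ⊔ k) 1≤e
  (λ N N₀≤N → eπ²-lower (m⊔n≤o⇒m≤o 30 k N₀≤N))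
  (λ N N₀≤N i i≤k → [1+k]^k≤e*k^k i (≤-trans i≤k (m⊔n≤o⇒n≤o 30 k N₀≤N)))
  (Φ-counts k n)
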